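{- Let $G=(U,V,E)$ be an arbitrary (adversarially chosen) edge-weighted stochastic graph with downward-closed online probing constraints, whose online vertices arrive in uniformly random order. If $\mathcal{M}$ is the matching returned by the LP-resolving online probing algorithm described in the context when executing on $G$, then $$\mathbb{E}[w(\mathcal{M})]\ge\left(\frac1e-\frac{1}{|V|}\right)\cdot\mathrm{OPT}(G).$$
   Context: Stochastic graph: a bipartite graph $G=(U,V,E)$ with finite $U$ (offline) and $V$ (online), $n=|V|$, $E=U\times V$, weights $w_e\ge 0$, probabilities $p_e\in[0,1]$. $\partial(r)$ is the set of edges containing $r$. Each edge $e$ is active independently with probability $p_e$. Each $v\in V$ has a probing constraint $\mathcal{C}_v$: a set of strings with distinct entries from $\partial(v)$, containing the empty string $\lambda$ and downward-closed (closed under substrings and permutations). For a set $\mathcal{M}$ of edges, $w(\mathcal{M})=\sum_{e\in\mathcal{M}}w_e$. Benchmark: an offline probing algorithm knows $G$ but not the edge states; it adaptively (possibly with randomization) probes edges in any order, interleaving vertices if desired, each probe revealing whether the edge is active; the sequence of probes at each $v\in V$ must lie in $\mathcal{C}_v$; when a probed edge is active it must irrevocably decide whether to include it before any further probe; it returns a matching of probed active edges. $\mathrm{OPT}(G)$ is the maximum expected weight achievable. Configuration LP of a stochastic graph $G$: with $q(\bm{e})=\prod_{f\in\bm{e}}(1-p_f)$, $q(\lambda)=1$, $\bm{e}_{<f}$ the prefix of $\bm{e}$ strictly before $f$, and $\mathrm{val}(\bm{e})=\sum_{f\in\bm{e}}w_fp_fq(\bm{e}_{<f})$, maximize $\sum_{v\in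 V}\sum_{\bm{e}\in\mathcal{C}_v}\mathrm{val}(\bm{e})x_v(\bm{e})$ over $x_v(\bm{e})\ge0$ subject to $\sum_{v\in V}\sum_{\bm{e}\in\mathcal{C}_v:(u,v)\in\bm{e}}p_{u,v}q(\bm{e}_{<(u,v)})x_v(\bm{e})\le1$ for all $u\in U$ and $\sum_{\bm{e}\in\mathcal{C}_v}x_v(\bm{e})=1$ for all $v\in V$. $\mathtt{VertexProbe}$ on vertex $s$ with probabilities $(x_s(\bm{e}))_{\bm{e}\in\mathcal{C}_s}$ summing to $1$: draw $\bm{e}'\in\mathcal{C}_s$ with probability $x_s(\bm{e}')$; probe the edges of $\bm{e}'$ in order and return the first edge found active; return $\emptyset$ if there is none (or $\bm{e}'=\lambda$). The algorithm: it knows $U$ and $n$ in advance; the vertices of $V$ arrive as $v_1,\dots,v_n$ in uniformly random order (independent of everything else), and when $v_t$ arrives its weights, probabilities and constraint are revealed. Start with $\mathcal{M}=\emptyset$. Let $V_t=\{v_1,\dots,v_t\}$ and let $G_t=G[U\cup V_t]$ be the induced stochastic graph. For $t\le\lfloor n/e\rfloor$ pass on $v_t$ (no probes). For each later $t$, compute an optimal solution $(x_v(\bm{e}))_{v\in V_t,\bm{e}\in\mathcal{C}_v}$ of the configuration LP of $G_t$ (determined by $G_t$, not by the arrival order within $V_t$), run $\mathtt{VertexProbe}$ on $v_t$ with $(x_{v_t}(\bm{e}))_{\bm{e}\in\mathcal{C}_{v_t}}$ using fresh randomness, and if it returns an edge $(u_t,v_t)$ with $u_t$ currently unmatched, add this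 edge to $\mathcal{M}$. Return $\mathcal{M}$. -}

module Defs where

open import Algebra.Bundles using (CommutativeRing)
import Algebra.Definitions.RawMonoid as Multiples
open import Algebra.Structures using (IsCommutativeRing)
open import Data.Bool.Base using (Bool; true; false; if_then_else_)
open import Data.Fin.Base using (Fin)
open import Data.Fin.Properties using (_≟_)
open import Data.Fin.Subset using (Subset; _∈_; _∪_; ⁅_⁆; ⊥)
open import Data.Fin.Subset.Properties using (_∈?_)
open import Data.List.Base
  using (List; []; _∷_; [_]; _++_; _∷ʳ_; map; concatMap; filter; foldr; length;
         upTo; allFin; takeWhile; findᵇ)
import Data.List.Membership.DecPropositional as DecMembership
import Data.List.Membership.Propositional as Membership
open import Data.List.Relation.Binary.Permutation.Propositional using (_↭_)
open import Data.List.Relation.Unary.Unique.Propositional using (Unique)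
import Data.List.Relation.Unary.Unique.DecPropositional as DecUnique
open import Data.Maybe.Base using (Maybe; just; nothing)
open import Data.Nat.Base using (ℕ; zero; suc; _!)
open import Data.Nat.Properties using () renaming (_≤?_ to _≤ℕ?_)
open import Data.Product.Base using (∃; _×_; _,_; proj₁; proj₂)
open import Data.Vec.Base using (Vec; []; _∷_; lookup)
open import Function.Base using (_∘_)
open import Level using (0ℓ)
open import Relation.Binary.PropositionalEquality.Core using (_≡_; _≢_)
open import Relation.Binary.Structures using (IsDecTotalOrder)
open import Relation.Nullary.Decidable.Core using (does)
open import Relation.Nullary.Decidable using (¬?)
open import Relation.Unary using (Pred; Decidable; Satisfiable)

-- The real numbers, up to isomorphism, in their classical axiomatisation.
-- As usual in such an axiomatisation the inverse and the supremum are total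
-- operations, about which nothing is assumed at 0 or at a set that is empty or
-- unbounded.
record CompleteOrderedField : Set₁ where
  infix  8 _⁻¹
  infix  8 -_
  infixl 7 _*_
  infixl 6 _+_ _-_
  infix  4 _≤_
  field
    Carrier           : Set
    _+_ _*_           : Carrier → Carrier → Carrier
    -_ _⁻¹            : Carrier → Carrier
    0# 1#             : Carrier
    _≤_               : Carrier → Carrier → Set
    isCommutativeRing : IsCommutativeRing _≡_ _+_ _*_ -_ 0# 1#
    0≢1               : 0# ≢ 1#
    *-inverseʳ        : ∀ x → x ≢ 0# → x * x ⁻¹ ≡ 1#
    isDecTotalOrder   : IsDecTotalOrder _≡_ _≤_
    +-monoʳ-≤         : ∀ z {x y} → x ≤ y → z + x ≤ z + y
    *-nonNeg          : ∀ {x y} → 0# ≤ x → 0# ≤ y → 0# ≤ x * y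

  IsUpperBound : Pred Carrier 0ℓ → Carrier → Set
  IsUpperBound P b = ∀ x → P x → x ≤ b

  field
    sup         : Pred Carrier 0ℓ → Carrier
    sup-upper   : ∀ P → ∃ (IsUpperBound P) → IsUpperBound P (sup P)
    sup-least   : ∀ P → Satisfiable P → ∀ b → IsUpperBound P b → sup P ≤ b

  commutativeRing : CommutativeRing 0ℓ 0ℓ
  commutativeRing = record { isCommutativeRing = isCommutativeRing }

  open IsDecTotalOrder isDecTotalOrder public using (_≤?_)

  _-_ : Carrier → Carrier → Carrier
  x - y = x + - y

  fromℕ : ℕ → Carrier
  fromℕ n = n · 1#
    where open Multiples (CommutativeRing.+-rawMonoid commutativeRing)
            using () renaming (_×_ to _·_)

-- All lists of length k with entries from xs.
words : {A : Set} → List A → ℕ → List (List A)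
words xs zero    = [ [] ]
words xs (suc k) = concatMap (λ x → map (x ∷_) (words xs k)) xs

module Probing (ℝ : CompleteOrderedField) where

  open CompleteOrderedField ℝ renaming (Carrier to R)

  ∑ : {A : Set} → List A → (A → R) → R
  ∑ xs f = foldr _+_ 0# (map f xs)

  e : R
  e = sup (λ x → ∃ λ k → x ≡ ∑ (upTo k) (λ i → fromℕ (i !) ⁻¹))

  greatest≤ : ℕ → R → ℕ
  greatest≤ zero    x = zero
  greatest≤ (suc b) x = if does (fromℕ (suc b) ≤? x) then suc b else greatest≤ b x

  -- Since e ≥ 1, no natural number above n is at most n / e, and so the search
  -- bounded by n finds the floor.
  ⌊_/e⌋ : ℕ → ℕ
  ⌊ n /e⌋ = greatest≤ n (fromℕ n * e ⁻¹)

  -- Finitely supported distributions, as lists of weighted outcomes.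

  Dist : Set → Set
  Dist A = List (R × A)

  𝔼 : {A : Set} → Dist A → (A → R) → R
  𝔼 d f = ∑ d (λ (p , a) → p * f a)

  return : {A : Set} → A → Dist A
  return a = [ (1# , a) ]

  infixl 1 _>>=_
  _>>=_ : {A B : Set} → Dist A → (A → Dist B) → Dist B
  d >>= k = concatMap (λ (p , a) → map (λ (q , b) → (p * q , b)) (k a)) d

  bernoulli : R → Dist Bool
  bernoulli p = (p , true) ∷ (1# - p , false) ∷ []

  uniform : {A : Set} → List A → Dist A
  uniform xs = map (λ x → (fromℕ (length xs) ⁻¹ , x)) xs

  independent : {A : Set} {k : ℕ} → (Fin k → Dist A) → Dist (Vec A k)
  independent {k = zero}  d = return []
  independent {k = suc k} d =
    d Fin.zero >>= λ a → independent (d ∘ Fin.suc) >>= λ as → return (a ∷ as)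

  -- U = Fin m, V = Fin n and E = U × V.  A string of edges of ∂(v) is written as
  -- the list of the offline endpoints of its edges.
  record StochasticGraph (m n : ℕ) : Set₁ where
    field
      w          : Fin m → Fin n → R
      p          : Fin m → Fin n → R
      w-nonNeg   : ∀ u v → 0# ≤ w u v
      p-nonNeg   : ∀ u v → 0# ≤ p u v
      p≤1        : ∀ u v → p u v ≤ 1#
      C          : Fin n → Pred (List (Fin m)) 0ℓ
      C?         : ∀ v → Decidable (C v)
      C-distinct : ∀ v {us} → C v us → Unique us
      C-empty    : ∀ v → C v []
      C-substring : ∀ v xs ys zs → C v (xs ++ ys ++ zs) → C v ys
      C-permute  : ∀ v {xs ys} → xs ↭ ys → C v xs → C v ys

  module _ {m n : ℕ} (G : StochasticGraph m n) where

    open StochasticGraph G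

    Edge : Set
    Edge = Fin m × Fin n

    weight : List Edge → R
    weight M = ∑ M (λ (u , v) → w u v)

    UnmatchedU : List Edge → Fin m → Set
    UnmatchedU M u = u Membership.∉ map proj₁ M

    UnmatchedV : List Edge → Fin n → Set
    UnmatchedV M v = v Membership.∉ map proj₂ M

    EdgeStates : Set
    EdgeStates = Vec (Vec Bool m) n

    active : EdgeStates → Fin n → Fin m → Bool
    active ω v u = lookup (lookup ω v) u

    edgeStates : Dist EdgeStates
    edgeStates = independent λ v → independent λ u → bernoulli (p u v)

    -- Offline probing algorithms.

    probedAt : Fin n → List Edge → List (Fin m)
    probedAt v ps = map proj₁ (filter (λ f → proj₂ f ≟ v) ps)

    -- Adaptive randomised algorithms whose past probes are ps, in chronological
    -- order, and whose current matching is M.  A probe has one continuation for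
    -- each revealed state of the edge; if the edge is active, the continuation
    -- must settle whether to include it before it can probe again.
    mutual
      data Strategy (ps M : List Edge) : Set where
        stop  : Strategy ps M
        coin  : (r : R) → 0# ≤ r → r ≤ 1# →
                Strategy ps M → Strategy ps M → Strategy ps M
        probe : (u : Fin m) (v : Fin n) → C v (probedAt v ps ∷ʳ u) →
                (ifActive   : Decision (ps ∷ʳ (u , v)) M u v)
                (ifInactive : Strategy (ps ∷ʳ (u , v)) M) →
                Strategy ps M

      data Decision (ps M : List Edge) (u : Fin m) (v : Fin n) : Set where
        include : UnmatchedU M u → UnmatchedV M v →
                  Strategy ps ((u , v) ∷ M) → Decision ps M u v
        decline : Strategy ps M → Decision ps M u v
        coin    : (r : R) → 0# ≤ r → r ≤ 1# →
                  Decision ps M u v → Decision ps M u v → Decision ps M u v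

    mutual
      execute : ∀ {ps M} → EdgeStates → Strategy ps M → Dist (List Edge)
      execute {M = M} ω stop = return M
      execute ω (coin r _ _ s s′) =
        bernoulli r >>= λ b → if b then execute ω s else execute ω s′
      execute ω (probe u v _ ifActive ifInactive) =
        if active ω v u then decide ω ifActive else execute ω ifInactive

      decide : ∀ {ps M u v} → EdgeStates → Decision ps M u v → Dist (List Edge)
      decide ω (include _ _ s) = execute ω s
      decide ω (decline s)     = execute ω s
      decide ω (coin r _ _ d d′) =
        bernoulli r >>= λ b → if b then decide ω d else decide ω d′

    offlineMatching : Strategy [] [] → Dist (List Edge)
    offlineMatching s = edgeStates >>= λ ω → execute ω s

    OPT : R
    OPT = sup (λ x → ∃ λ s → x ≡ 𝔼 (offlineMatching s) weight)

    -- The configuration LP.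

    -- The elements of C v: having distinct entries, they have length at most m.
    strings : Fin n → List (List (Fin m))
    strings v = filter (C? v) (concatMap (words (allFin m)) (upTo (suc m)))

    q : Fin n → List (Fin m) → R
    q v us = foldr _*_ 1# (map (λ u → 1# - p u v) us)

    before : Fin m → List (Fin m) → List (Fin m)
    before u us = takeWhile (λ u′ → ¬? (u′ ≟ u)) us

    val : Fin n → List (Fin m) → R
    val v us = ∑ us (λ u → w u v * p u v * q v (before u us))

    -- The value at v and us is x_v(us); only those with C v us are used.
    Assignment : Set
    Assignment = Fin n → List (Fin m) → R

    -- The configuration LP of the induced stochastic graph G[U ∪ S].
    module ConfigLP (S : Subset n) where

      online : List (Fin n)
      online = filter (_∈? S) (allFin n)

      objective : Assignment → R
      objective x = ∑ online λ v → ∑ (strings v) λ us → val v us * x v us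

      load : Assignment → Fin m → R
      load x u =
        ∑ online λ v → ∑ (filter (u ∈ₗ?_) (strings v)) λ us →
          p u v * q v (before u us) * x v us
        where open DecMembership _≟_ renaming (_∈?_ to _∈ₗ?_)

      record Feasible (x : Assignment) : Set where
        field
          nonNeg     : ∀ v us → v ∈ S → C v us → 0# ≤ x v us
          load≤1     : ∀ u → load x u ≤ 1#
          normalised : ∀ v → v ∈ S → ∑ (strings v) (x v) ≡ 1#

      record Optimal (x : Assignment) : Set where
        field
          feasible : Feasible x
          maximal  : ∀ y → Feasible y → objective y ≤ objective x

    -- The online algorithm.

    vertexProbe : EdgeStates → (s : Fin n) → (List (Fin m) → R) →
                  Dist (Maybe (Fin m))
    vertexProbe ω s x =
      map (λ us → (x us , us)) (strings s) >>= λ us → return (findᵇ (active ω s) us)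

    addEdge : List Edge → Maybe (Fin m) → Fin n → List Edge
    addEdge M nothing  v = M
    addEdge M (just u) v = if does (u ∈ₗ? map proj₁ M) then M else (u , v) ∷ M
      where open DecMembership _≟_ renaming (_∈?_ to _∈ₗ?_)

    -- As G is fixed, G_t is determined by the set V_t, so that a rule for solving
    -- the configuration LPs of the graphs G_t is a function of that set.
    module _ (solve : Subset n → Assignment) (ω : EdgeStates) where

      -- t is the arrival time of the next vertex and S the set of those that have
      -- arrived before it.
      process : (t : ℕ) (S : Subset n) (M : List Edge) (arrivals : List (Fin n)) →
                Dist (List Edge)
      process t S M []       = return M
      process t S M (v ∷ vs) =
        (if does (t ≤ℕ? ⌊ n /e⌋)
          then return M
          else (vertexProbe ω v (solve S′ v) >>= λ result → return (addEdge M result v)))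
        >>= λ M′ → process (suc t) S′ M′ vs
        where
        S′ : Subset n
        S′ = S ∪ ⁅ v ⁆

    arrivalOrders : List (List (Fin n))
    arrivalOrders = filter (DecUnique.unique? _≟_) (words (allFin n) n)

    onlineMatching : (Subset n → Assignment) → Dist (List Edge)
    onlineMatching solve =
      uniform arrivalOrders >>= λ vs → edgeStates >>= λ ω → process solve ω 1 ⊥ [] vs

-- The configuration LP relaxes the benchmark.  Fix an offline strategy and an
-- online vertex v, and replace the probes at v of active edges that the strategy
-- would decline by simulated ones.  The remaining probes at v follow a random
-- string that is settled by what would be probed if all of them failed, so the
-- distribution of this string is a feasible solution at v; its load at u is the
-- probability that u is matched to v, and its value is the expected weight at v.
--
-- The online algorithm is analysed backwards in time.  Given the set S of the
-- first k arrivals, the k-th one is uniform in S and the LP solved at time k is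
-- that of G[U ∪ S].  Hence u is matched at time k with probability at most 1/k,
-- and by induction u is still free after k ≥ a = ⌊n/e⌋ arrivals with probability
-- at least a/k.  Restricting an optimal solution for G to S shows that the k-th
-- probe is worth LP(G)/n on average, so the matching has expected weight at least
-- (a/n) Σ_{a≤k<n} 1/k · LP(G).  The sum is at least 1 because
-- e ≤ n/a = Π_{a≤k<n} (1 + 1/k) ≤ exp (Σ_{a≤k<n} 1/k), and a/n ≥ 1/e - 1/n.
module Submission where

open import Defs
open import Algebra.Bundles using (CommutativeRing)
import Algebra.Properties.Ring as RingProperties
import Algebra.Properties.Semiring.Mult.TCOptimised as Mult
import Algebra.Solver.Ring
open import Algebra.Solver.Ring.AlmostCommutativeRing
  using (fromCommutativeRing; _-Raw-AlmostCommutative⟶_)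
open import Algebra.Structures using (IsCommutativeRing)
open import Data.Bool.Base using (Bool; true; false; if_then_else_)
open import Data.Empty using (⊥-elim)
open import Data.Fin.Base as Fin using (Fin)
open import Data.Fin.Properties using (injective⇒≤; _≟_)
open import Data.Fin.Subset as Subset using (Subset; _∪_; _∩_; ∁; ⁅_⁆)
open import Data.Fin.Subset.Properties as Subsetₚ
  using (∈⊤; _∈?_; x∈p∩q⁺; x∈p∩q⁻; x∈∁p⇒x∉p; x∉p⇒x∈∁p; x∈⁅x⁆; x∈⁅y⁆⇒x≡y; x∈p∪q⁺; x∈p∪q⁻;
         ⊆-antisym; ∉⊥)
open import Data.Integer.Base as ℤ using (ℤ; -[1+_]; _⊖_) renaming (+_ to pos)
import Data.Integer.Properties as ℤₚ
open import Data.List.Base as List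
  using (List; []; _∷_; [_]; _++_; _∷ʳ_; map; concatMap; filter; length; upTo; allFin; findᵇ;
         foldl; initLast; _∷ʳ′_)
import Data.List.Membership.DecPropositional as DecMembership
open import Data.List.Membership.Propositional using (_∈_; _∉_; find; lose)
open import Data.List.Membership.Propositional.Properties
  using (∈-map⁺; ∈-map⁻; ∈-concatMap⁺; ∈-concatMap⁻; ∈-lookup; ∈-filter⁺; ∈-filter⁻; ∈-allFin;
         ∈-upTo⁺; ∈-++⁺ˡ; ∈-++⁺ʳ; ∈-++⁻)
open import Data.List.Membership.Propositional.Properties.WithK using (unique∧set⇒bag)
open import Data.List.Properties
  using (map-++; upTo-∷ʳ; ∷-injectiveʳ; ∷-injectiveˡ; length-++; ++-assoc; ++-identityʳ;
         filter-++; filter-accept; filter-reject; ≡-dec; filter-all; length-tabulate; length-map;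
         foldl-∷ʳ; ∷ʳ-injectiveˡ; ∷ʳ-injectiveʳ)
open import Data.List.Relation.Binary.BagAndSetEquality using (∼bag⇒↭)
open import Data.List.Relation.Binary.Permutation.Propositional as Perm using (_↭_; ↭-sym; ↭⇒↭ₛ)
open import Data.List.Relation.Binary.Permutation.Propositional.Properties
  using (∷↭∷ʳ; shift; ↭-length)
open import Data.List.Relation.Binary.Permutation.Setoid.Properties using (Unique-resp-↭)
open import Data.List.Relation.Unary.All as All using (All; []; _∷_)
open import Data.List.Relation.Unary.All.Properties using (++⁺; map⁺)
open import Data.List.Relation.Unary.AllPairs using ([]; _∷_)
open import Data.List.Relation.Unary.Any using (here; there)
import Data.List.Relation.Unary.Unique.DecPropositional as DecUnique
open import Data.List.Relation.Unary.Unique.Propositional using (Unique)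
import Data.List.Relation.Unary.Unique.Propositional.Properties as Uniqueₚ
open import Data.Maybe.Base using (Maybe; just; nothing; maybe′)
open import Data.Nat.Base as ℕ using (ℕ; zero; suc; _!; NonZero)
import Data.Nat.Properties as ℕₚ
open import Data.Product.Base using (_×_; _,_; proj₁; proj₂; ∃)
open import Data.Sum.Base using (inj₁; inj₂; [_,_]′)
open import Data.Unit.Base using (⊤; tt)
open import Data.Vec.Base using (Vec; []; _∷_; lookup; _[_]≔_)
open import Data.Vec.Properties using (lookup∘update; lookup∘update′; []≔-idempotent)
open import Function.Base using (_∘_; _$_)
open import Function.Bundles using (mk⇔)
open import Level using (0ℓ)
open import Relation.Binary.Bundles using (Poset)
open import Relation.Binary.Definitions using (DecidableEquality)
open import Relation.Binary.PropositionalEquality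
  using (_≡_; _≢_; refl; sym; trans; cong; cong₂; subst; subst₂; module ≡-Reasoning; setoid)
import Relation.Binary.Reasoning.PartialOrder as PartialOrderReasoning
open import Relation.Binary.Structures using (IsDecTotalOrder)
open import Relation.Nullary using (¬_; yes; no; Dec; does)
open import Relation.Nullary.Decidable using (dec-true; dec-false)
open import Relation.Unary using (Pred; Decidable)

-- Both matchings are defined by drawing all edge states at once, whereas the analysis needs a fresh
-- coin at every probe. Each side is therefore rewritten with deferred decisions (`run`, `trace`).
-- This is sound because strings and arrival orders have distinct entries, so no edge is probed
-- twice, and it comes down to resampling one coordinate of a product distribution.
--
-- Value and load are instances of one functional `gain v c`, the expected payoff `c u` of the first
-- active edge: `c` is the weight in one case and the indicator of an offline vertex in the other.
-- The identities are proved once, for arbitrary `c`.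
--
-- Conditional probabilities are avoided: `total k S f` sums the expectation of `f` over all orders
-- of the `k` members of `S`, and splitting off the last arrival `v` gives exact recursions. The law
-- of the probe at `v` depends on `S` and `v` only, not on the order or the matching built before;
-- this independence turns survival of an offline vertex into a product.
--
-- The exponential function is never constructed. Its Taylor polynomials suffice, with the degree
-- raised by one for each factor `1 + 1/k`.

private variable
  A B : Set

-- Arithmetic and order of the reals

module Field (ℝ : CompleteOrderedField) where
  open CompleteOrderedField ℝ renaming (Carrier to R)
  open IsCommutativeRing isCommutativeRing public
    using (+-comm; +-assoc; +-identityˡ; +-identityʳ; *-comm; *-assoc; *-identityˡ; *-identityʳ;
           zeroˡ; zeroʳ; distribˡ; distribʳ; -‿inverseˡ; -‿inverseʳ)
  open IsDecTotalOrder isDecTotalOrder public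
    using (isPartialOrder)
    renaming (refl to ≤-refl; reflexive to ≤-reflexive; trans to ≤-trans; antisym to ≤-antisym; total to ≤-total)

  private
    open Mult (CommutativeRing.semiring commutativeRing)
      using (×-homo-+; ×1-homo-*; 1+×) renaming (_×_ to _·_)
    open RingProperties (CommutativeRing.ring commutativeRing)
      using (-‿+-comm; -‿distribˡ-*; -‿distribʳ-*; -‿involutive; -0#≈0#)

    -- Integer coefficients let the ring solver decide equality of numerals. With the optimised
    -- multiples `⟦ pos 1 ⟧` computes to `1#`, so `con (pos 1)` can stand for `1#` in equations
    -- closed by `refl`.
    ⟦_⟧ : ℤ → R
    ⟦ pos k ⟧ = k · 1#
    ⟦ -[1+ k ] ⟧ = - (suc k · 1#)

    ⟦⟧-neg : ∀ i → ⟦ ℤ.- i ⟧ ≡ - ⟦ i ⟧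
    ⟦⟧-neg (pos zero)    = sym -0#≈0#
    ⟦⟧-neg (pos (suc k)) = refl
    ⟦⟧-neg -[1+ k ]      = sym (-‿involutive _)

    cancel-1 : ∀ a b → a - b ≡ (1# + a) - (1# + b)
    cancel-1 a b = begin
      a - b                             ≡⟨ +-identityˡ _ ⟨
      0# + (a - b)                      ≡⟨ cong (_+ (a - b)) (-‿inverseʳ 1#) ⟨
      (1# - 1#) + (a - b)               ≡⟨ +-assoc _ _ _ ⟩
      1# + (- 1# + (a - b))             ≡⟨ cong (1# +_) (+-assoc _ _ _) ⟨
      1# + ((- 1# + a) - b)             ≡⟨ cong (λ z → 1# + (z - b)) (+-comm _ _) ⟩
      1# + ((a + - 1#) - b)             ≡⟨ cong (1# +_) (+-assoc _ _ _) ⟩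
      1# + (a + (- 1# - b))             ≡⟨ +-assoc _ _ _ ⟨
      (1# + a) + (- 1# - b)             ≡⟨ cong ((1# + a) +_) (-‿+-comm _ _) ⟩
      (1# + a) - (1# + b)               ∎
      where open ≡-Reasoning

    ⟦⟧-⊖ : ∀ j k → ⟦ j ⊖ k ⟧ ≡ j · 1# - k · 1#
    ⟦⟧-⊖ j zero = sym (trans (cong (j · 1# +_) -0#≈0#) (+-identityʳ _))
    ⟦⟧-⊖ zero (suc k) = sym (+-identityˡ _)
    ⟦⟧-⊖ (suc j) (suc k) = begin
      ⟦ suc j ⊖ suc k ⟧                     ≡⟨ cong ⟦_⟧ (ℤₚ.[1+m]⊖[1+n]≡m⊖n j k) ⟩
      ⟦ j ⊖ k ⟧                             ≡⟨ ⟦⟧-⊖ j k ⟩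
      j · 1# - k · 1#                       ≡⟨ cancel-1 _ _ ⟩
      (1# + j · 1#) - (1# + k · 1#)         ≡⟨ cong₂ _-_ (1+× j 1#) (1+× k 1#) ⟨
      suc j · 1# - suc k · 1#               ∎
      where open ≡-Reasoning

    ⟦⟧-+ : ∀ i j → ⟦ i ℤ.+ j ⟧ ≡ ⟦ i ⟧ + ⟦ j ⟧
    ⟦⟧-+ (pos j) (pos k) = ×-homo-+ 1# j k
    ⟦⟧-+ (pos j) -[1+ k ] = ⟦⟧-⊖ j (suc k)
    ⟦⟧-+ -[1+ j ] (pos k) = trans (⟦⟧-⊖ k (suc j)) (+-comm _ _)
    ⟦⟧-+ -[1+ j ] -[1+ k ] = begin
      - (suc (suc (j ℕ.+ k)) · 1#)            ≡⟨ cong (λ z → - (suc z · 1#)) (ℕₚ.+-suc j k) ⟨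
      - ((suc j ℕ.+ suc k) · 1#)              ≡⟨ cong -_ (×-homo-+ 1# (suc j) (suc k)) ⟩
      - (suc j · 1# + suc k · 1#)             ≡⟨ -‿+-comm _ _ ⟨
      - (suc j · 1#) - suc k · 1#             ∎
      where open ≡-Reasoning

    ⟦⟧-pos-* : ∀ j i → ⟦ pos j ℤ.* i ⟧ ≡ j · 1# * ⟦ i ⟧
    ⟦⟧-pos-* j (pos k) = trans (cong ⟦_⟧ (sym (ℤₚ.pos-* j k))) (×1-homo-* j k)
    ⟦⟧-pos-* j -[1+ k ] = begin
      ⟦ pos j ℤ.* -[1+ k ] ⟧           ≡⟨ cong ⟦_⟧ (ℤₚ.neg-distribʳ-* (pos j) (pos (suc k))) ⟨
      ⟦ ℤ.- (pos j ℤ.* pos (suc k)) ⟧  ≡⟨ ⟦⟧-neg (pos j ℤ.* pos (suc k)) ⟩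
      - ⟦ pos j ℤ.* pos (suc k) ⟧      ≡⟨ cong -_ (⟦⟧-pos-* j (pos (suc k))) ⟩
      - (j · 1# * suc k · 1#)          ≡⟨ -‿distribʳ-* _ _ ⟩
      j · 1# * - (suc k · 1#)          ∎
      where open ≡-Reasoning

    ⟦⟧-* : ∀ i j → ⟦ i ℤ.* j ⟧ ≡ ⟦ i ⟧ * ⟦ j ⟧
    ⟦⟧-* (pos j) k = ⟦⟧-pos-* j k
    ⟦⟧-* -[1+ j ] k = begin
      ⟦ -[1+ j ] ℤ.* k ⟧           ≡⟨ cong ⟦_⟧ (ℤₚ.neg-distribˡ-* (pos (suc j)) k) ⟨
      ⟦ ℤ.- (pos (suc j) ℤ.* k) ⟧  ≡⟨ ⟦⟧-neg (pos (suc j) ℤ.* k) ⟩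
      - ⟦ pos (suc j) ℤ.* k ⟧      ≡⟨ cong -_ (⟦⟧-pos-* (suc j) k) ⟩
      - (suc j · 1# * ⟦ k ⟧)       ≡⟨ -‿distribˡ-* _ _ ⟩
      - (suc j · 1#) * ⟦ k ⟧       ∎
      where open ≡-Reasoning

    ℤ-coefficients : ℤ.+-*-rawRing -Raw-AlmostCommutative⟶ fromCommutativeRing commutativeRing
    ℤ-coefficients = record
      { ⟦_⟧ = ⟦_⟧ ; +-homo = ⟦⟧-+ ; *-homo = ⟦⟧-* ; -‿homo = ⟦⟧-neg ; 0-homo = refl ; 1-homo = refl }

    ℤ-equal? : ∀ i j → Maybe (⟦ i ⟧ ≡ ⟦ j ⟧)
    ℤ-equal? i j with i ℤₚ.≟ j
    ... | yes eq = just (cong ⟦_⟧ eq)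
    ... | no _   = nothing

  open Algebra.Solver.Ring ℤ.+-*-rawRing (fromCommutativeRing commutativeRing) ℤ-coefficients ℤ-equal? public
    using (solve; con; _:=_; _:+_; _:*_; _:-_; :-_)

  ≤-poset : Poset _ _ _
  ≤-poset = record { isPartialOrder = isPartialOrder }

  module ≤-Reasoning = PartialOrderReasoning ≤-poset

  +-monoˡ-≤ : ∀ z {x y} → x ≤ y → x + z ≤ y + z
  +-monoˡ-≤ z {x} {y} x≤y = subst₂ _≤_ (+-comm z x) (+-comm z y) (+-monoʳ-≤ z x≤y)

  +-mono-≤ : ∀ {x y x′ y′} → x ≤ y → x′ ≤ y′ → x + x′ ≤ y + y′
  +-mono-≤ p q = ≤-trans (+-monoˡ-≤ _ p) (+-monoʳ-≤ _ q)

  x≤y⇒0≤y-x : ∀ {x y} → x ≤ y → 0# ≤ y - x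
  x≤y⇒0≤y-x {x} {y} x≤y = subst (_≤ y - x) (-‿inverseʳ x) (+-monoˡ-≤ (- x) x≤y)

  0≤y-x⇒x≤y : ∀ {x y} → 0# ≤ y - x → x ≤ y
  0≤y-x⇒x≤y {x} {y} p = subst₂ _≤_ (+-identityˡ x) (solve 2 (λ x y → y :- x :+ x := y) refl x y) (+-monoˡ-≤ x p)

  *-monoʳ-≤ : ∀ {z x y} → 0# ≤ z → x ≤ y → z * x ≤ z * y
  *-monoʳ-≤ {z} {x} {y} 0≤z x≤y = 0≤y-x⇒x≤y
    (subst (0# ≤_) (solve 3 (λ x y z → z :* (y :- x) := z :* y :- z :* x) refl x y z)
      (*-nonNeg 0≤z (x≤y⇒0≤y-x x≤y)))

  *-monoˡ-≤ : ∀ {z x y} → 0# ≤ z → x ≤ y → x * z ≤ y * z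
  *-monoˡ-≤ {z} {x} {y} 0≤z x≤y = subst₂ _≤_ (*-comm z x) (*-comm z y) (*-monoʳ-≤ 0≤z x≤y)

  +-nonNeg : ∀ {x y} → 0# ≤ x → 0# ≤ y → 0# ≤ x + y
  +-nonNeg p q = subst (_≤ _) (+-identityʳ 0#) (+-mono-≤ p q)

  x≤0⇒0≤-x : ∀ {x} → x ≤ 0# → 0# ≤ - x
  x≤0⇒0≤-x {x} p = subst (0# ≤_) (+-identityˡ (- x)) (x≤y⇒0≤y-x p)

  0≤1 : 0# ≤ 1#
  0≤1 with ≤-total 0# 1#
  ... | inj₁ p = p
  -- If `1# ≤ 0#`, then `- 1#` is nonnegative and `1#` is its square.
  ... | inj₂ p = subst (0# ≤_) (solve 0 (:- con (pos 1) :* :- con (pos 1) := con (pos 1)) refl)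
                   (*-nonNeg (x≤0⇒0≤-x p) (x≤0⇒0≤-x p))

  1≰0 : ¬ 1# ≤ 0#
  1≰0 p = 0≢1 (≤-antisym 0≤1 p)

  ≰⇒≥ : ∀ {x y} → ¬ x ≤ y → y ≤ x
  ≰⇒≥ {x} {y} ¬p = [ ⊥-elim ∘ ¬p , (λ q → q) ]′ (≤-total x y)

  -- Strict positivity, phrased as a negation because the order is given in its weak form only;
  -- totality recovers `0# ≤ x`.
  Positive : R → Set
  Positive x = ¬ x ≤ 0#

  positive-nonNeg : ∀ {x} → Positive x → 0# ≤ x
  positive-nonNeg = ≰⇒≥

  positive≢0 : ∀ {x} → Positive x → x ≢ 0#
  positive≢0 p refl = p ≤-refl

  positive-≤ : ∀ {x y} → Positive x → x ≤ y → Positive y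
  positive-≤ p x≤y y≤0 = p (≤-trans x≤y y≤0)

  ⁻¹-inverseʳ : ∀ {x} → Positive x → x * x ⁻¹ ≡ 1#
  ⁻¹-inverseʳ p = *-inverseʳ _ (positive≢0 p)

  ⁻¹-inverseˡ : ∀ {x} → Positive x → x ⁻¹ * x ≡ 1#
  ⁻¹-inverseˡ p = trans (*-comm _ _) (⁻¹-inverseʳ p)

  ⁻¹-positive : ∀ {x} → Positive x → Positive (x ⁻¹)
  ⁻¹-positive {x} p x⁻¹≤0 = 1≰0 (subst₂ _≤_ (⁻¹-inverseʳ p) (zeroʳ x) (*-monoʳ-≤ (positive-nonNeg p) x⁻¹≤0))

  ⁻¹-nonNeg : ∀ {x} → Positive x → 0# ≤ x ⁻¹
  ⁻¹-nonNeg = positive-nonNeg ∘ ⁻¹-positive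

  ⁻¹-cancelˡ : ∀ {z} x → Positive z → z ⁻¹ * (z * x) ≡ x
  ⁻¹-cancelˡ x p = trans (sym (*-assoc _ _ _)) (trans (cong (_* x) (⁻¹-inverseˡ p)) (*-identityˡ x))

  *-cancelˡ-≤ : ∀ {z x y} → Positive z → z * x ≤ z * y → x ≤ y
  *-cancelˡ-≤ {z} {x} {y} p q = subst₂ _≤_ (⁻¹-cancelˡ x p) (⁻¹-cancelˡ y p) (*-monoʳ-≤ (⁻¹-nonNeg p) q)

  *-cancelˡ-≡ : ∀ {z x y} → Positive z → z * x ≡ z * y → x ≡ y
  *-cancelˡ-≡ {z} {x} {y} p q = trans (sym (⁻¹-cancelˡ x p)) (trans (cong (z ⁻¹ *_) q) (⁻¹-cancelˡ y p))

  fromℕ-nonNeg : ∀ k → 0# ≤ fromℕ k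
  fromℕ-nonNeg zero    = ≤-refl
  fromℕ-nonNeg (suc k) = +-nonNeg 0≤1 (fromℕ-nonNeg k)

  fromℕ-positive : ∀ k → Positive (fromℕ (suc k))
  fromℕ-positive k = positive-≤ 1≰0 (subst (_≤ fromℕ (suc k)) (+-identityʳ 1#) (+-monoʳ-≤ 1# (fromℕ-nonNeg k)))

  fromℕ-positive′ : ∀ k .{{_ : ℕ.NonZero k}} → Positive (fromℕ k)
  fromℕ-positive′ (suc k) = fromℕ-positive k

  fromℕ-1 : fromℕ 1 ≡ 1#
  fromℕ-1 = +-identityʳ 1#

  fromℕ-+ : ∀ j k → fromℕ (j ℕ.+ k) ≡ fromℕ j + fromℕ k
  fromℕ-+ zero    k = sym (+-identityˡ _)
  fromℕ-+ (suc j) k = trans (cong (1# +_) (fromℕ-+ j k)) (sym (+-assoc _ _ _))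

  fromℕ-* : ∀ j k → fromℕ (j ℕ.* k) ≡ fromℕ j * fromℕ k
  fromℕ-* zero    k = sym (zeroˡ _)
  fromℕ-* (suc j) k = begin
    fromℕ (k ℕ.+ j ℕ.* k)            ≡⟨ fromℕ-+ k (j ℕ.* k) ⟩
    fromℕ k + fromℕ (j ℕ.* k)        ≡⟨ cong (fromℕ k +_) (fromℕ-* j k) ⟩
    fromℕ k + fromℕ j * fromℕ k
      ≡⟨ solve 2 (λ x y → y :+ x :* y := (con (pos 1) :+ x) :* y) refl (fromℕ j) (fromℕ k) ⟩
    (1# + fromℕ j) * fromℕ k         ∎
    where open ≡-Reasoning

  fromℕ-mono : ∀ {j k} → j ℕ.≤ k → fromℕ j ≤ fromℕ k
  fromℕ-mono {k = k} ℕ.z≤n = fromℕ-nonNeg k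
  fromℕ-mono (ℕ.s≤s p)     = +-monoʳ-≤ 1# (fromℕ-mono p)

-- Finite sums, indicators and expectations

module Sums (ℝ : CompleteOrderedField) where
  open CompleteOrderedField ℝ renaming (Carrier to R)
  open Probing ℝ
  open Field ℝ

  ∑-cong-∈ : ∀ (xs : List A) {f g : A → R} → (∀ {x} → x ∈ xs → f x ≡ g x) → ∑ xs f ≡ ∑ xs g
  ∑-cong-∈ []       eq = refl
  ∑-cong-∈ (x ∷ xs) eq = cong₂ _+_ (eq (here refl)) (∑-cong-∈ xs (eq ∘ there))

  ∑-cong : ∀ (xs : List A) {f g : A → R} → (∀ x → f x ≡ g x) → ∑ xs f ≡ ∑ xs g
  ∑-cong xs eq = ∑-cong-∈ xs (λ {x} _ → eq x)

  ∑-mono-∈ : ∀ (xs : List A) {f g : A → R} → (∀ {x} → x ∈ xs → f x ≤ g x) → ∑ xs f ≤ ∑ xs g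
  ∑-mono-∈ []       le = ≤-refl
  ∑-mono-∈ (x ∷ xs) le = +-mono-≤ (le (here refl)) (∑-mono-∈ xs (le ∘ there))

  ∑-nonNeg-∈ : ∀ (xs : List A) {f : A → R} → (∀ {x} → x ∈ xs → 0# ≤ f x) → 0# ≤ ∑ xs f
  ∑-nonNeg-∈ []       le = ≤-refl
  ∑-nonNeg-∈ (x ∷ xs) le = +-nonNeg (le (here refl)) (∑-nonNeg-∈ xs (le ∘ there))

  ∑-++ : ∀ (xs ys : List A) (f : A → R) → ∑ (xs ++ ys) f ≡ ∑ xs f + ∑ ys f
  ∑-++ []       ys f = sym (+-identityˡ _)
  ∑-++ (x ∷ xs) ys f = trans (cong (f x +_) (∑-++ xs ys f)) (sym (+-assoc _ _ _))

  ∑-map : ∀ (g : A → B) (xs : List A) (f : B → R) → ∑ (map g xs) f ≡ ∑ xs (f ∘ g)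
  ∑-map g []       f = refl
  ∑-map g (x ∷ xs) f = cong (f (g x) +_) (∑-map g xs f)

  ∑-concatMap : ∀ (k : A → List B) (xs : List A) (f : B → R) → ∑ (concatMap k xs) f ≡ ∑ xs (λ x → ∑ (k x) f)
  ∑-concatMap k []       f = refl
  ∑-concatMap k (x ∷ xs) f = trans (∑-++ (k x) _ f) (cong (∑ (k x) f +_) (∑-concatMap k xs f))

  ∑-0 : ∀ (xs : List A) → ∑ xs (λ _ → 0#) ≡ 0#
  ∑-0 []       = refl
  ∑-0 (x ∷ xs) = trans (+-identityˡ _) (∑-0 xs)

  ∑-+ : ∀ (xs : List A) (f g : A → R) → ∑ xs (λ x → f x + g x) ≡ ∑ xs f + ∑ xs g
  ∑-+ []       f g = sym (+-identityˡ 0#)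
  ∑-+ (x ∷ xs) f g = trans (cong (f x + g x +_) (∑-+ xs f g))
    (solve 4 (λ a b c d → (a :+ b) :+ (c :+ d) := (a :+ c) :+ (b :+ d)) refl (f x) (g x) (∑ xs f) (∑ xs g))

  ∑-*ˡ : ∀ (xs : List A) c (f : A → R) → ∑ xs (λ x → c * f x) ≡ c * ∑ xs f
  ∑-*ˡ []       c f = sym (zeroʳ c)
  ∑-*ˡ (x ∷ xs) c f = trans (cong (c * f x +_) (∑-*ˡ xs c f)) (sym (distribˡ c _ _))

  ∑-*ʳ : ∀ (xs : List A) c (f : A → R) → ∑ xs (λ x → f x * c) ≡ ∑ xs f * c
  ∑-*ʳ xs c f = trans (∑-cong xs (λ x → *-comm (f x) c)) (trans (∑-*ˡ xs c f) (*-comm c _))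

  ∑-swap : ∀ (xs : List A) (ys : List B) (f : A → B → R) →
           ∑ xs (λ x → ∑ ys (f x)) ≡ ∑ ys (λ y → ∑ xs (λ x → f x y))
  ∑-swap []       ys f = sym (∑-0 ys)
  ∑-swap (x ∷ xs) ys f = trans (cong (∑ ys (f x) +_) (∑-swap xs ys f)) (sym (∑-+ ys (f x) _))

  ∑-const : ∀ (xs : List A) c → ∑ xs (λ _ → c) ≡ fromℕ (length xs) * c
  ∑-const []       c = sym (zeroˡ c)
  ∑-const (x ∷ xs) c = trans (cong (c +_) (∑-const xs c))
    (solve 2 (λ c l → c :+ l :* c := (con (pos 1) :+ l) :* c) refl c (fromℕ (length xs)))

  ∑-↭ : ∀ {xs ys : List A} (f : A → R) → xs ↭ ys → ∑ xs f ≡ ∑ ys f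
  ∑-↭ f Perm.refl          = refl
  ∑-↭ f (Perm.prep x p)    = cong (f x +_) (∑-↭ f p)
  ∑-↭ f (Perm.swap x y p)  = trans (cong (λ z → f x + (f y + z)) (∑-↭ f p))
    (solve 3 (λ a b c → a :+ (b :+ c) := b :+ (a :+ c)) refl (f x) (f y) _)
  ∑-↭ f (Perm.trans p q)   = trans (∑-↭ f p) (∑-↭ f q)

  𝟙 : ∀ {P : Set} → Dec P → R
  𝟙 P? = if does P? then 1# else 0#

  𝟙-true : ∀ {P : Set} (P? : Dec P) → P → 𝟙 P? ≡ 1#
  𝟙-true P? p rewrite dec-true P? p = refl

  𝟙-false : ∀ {P : Set} (P? : Dec P) → ¬ P → 𝟙 P? ≡ 0#
  𝟙-false P? ¬p rewrite dec-false P? ¬p = refl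

  0≤𝟙 : ∀ {P : Set} (P? : Dec P) → 0# ≤ 𝟙 P?
  0≤𝟙 (yes _) = 0≤1
  0≤𝟙 (no _)  = ≤-refl

  ∑-filter : ∀ {P : Pred A 0ℓ} (P? : Decidable P) (xs : List A) (f : A → R) →
             ∑ (filter P? xs) f ≡ ∑ xs (λ x → 𝟙 (P? x) * f x)
  ∑-filter P? [] f = refl
  ∑-filter P? (x ∷ xs) f with P? x
  ... | yes _ = cong₂ _+_ (sym (*-identityˡ (f x))) (∑-filter P? xs f)
  ... | no _  = trans (∑-filter P? xs f) (trans (sym (+-identityˡ _)) (cong (_+ ∑ xs (λ x → 𝟙 (P? x) * f x)) (sym (zeroˡ (f x)))))

  module _ (_≟_ : DecidableEquality A) where

    ∑-𝟙-∉ : ∀ {x} xs (f : A → R) → x ∉ xs → ∑ xs (λ y → f y * 𝟙 (y ≟ x)) ≡ 0#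
    ∑-𝟙-∉ {x} xs f x∉xs = trans
      (∑-cong-∈ xs (λ {y} y∈xs →
        trans (cong (f y *_) (𝟙-false (y ≟ x) (λ y≡x → x∉xs (subst (_∈ xs) y≡x y∈xs)))) (zeroʳ (f y))))
      (∑-0 xs)

    ∑-𝟙-∈ : ∀ {x xs} (f : A → R) → Unique xs → x ∈ xs → ∑ xs (λ y → f y * 𝟙 (y ≟ x)) ≡ f x
    ∑-𝟙-∈ {x} {_ ∷ xs} f (x∉ ∷ _) (here refl) = begin
      f x * 𝟙 (x ≟ x) + ∑ xs (λ y → f y * 𝟙 (y ≟ x))
        ≡⟨ cong₂ _+_ (trans (cong (f x *_) (𝟙-true (x ≟ x) refl)) (*-identityʳ (f x)))
                     (∑-𝟙-∉ xs f (λ x∈ → All.lookup x∉ x∈ refl)) ⟩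
      f x + 0#  ≡⟨ +-identityʳ (f x) ⟩
      f x       ∎
      where open ≡-Reasoning
    ∑-𝟙-∈ {x} {y ∷ xs} f (y∉ ∷ u) (there x∈) = begin
      f y * 𝟙 (y ≟ x) + ∑ xs (λ y → f y * 𝟙 (y ≟ x))
        ≡⟨ cong₂ _+_ (trans (cong (f y *_) (𝟙-false (y ≟ x) (All.lookup y∉ x∈))) (zeroʳ (f y)))
                     (∑-𝟙-∈ f u x∈) ⟩
      0# + f x  ≡⟨ +-identityˡ (f x) ⟩
      f x       ∎
      where open ≡-Reasoning

  𝔼-cong : ∀ (d : Dist A) {f g : A → R} → (∀ x → f x ≡ g x) → 𝔼 d f ≡ 𝔼 d g
  𝔼-cong d eq = ∑-cong d (λ (p , a) → cong (p *_) (eq a))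

  𝔼-return : ∀ (a : A) (f : A → R) → 𝔼 (return a) f ≡ f a
  𝔼-return a f = trans (+-identityʳ _) (*-identityˡ (f a))

  𝔼->>= : ∀ (d : Dist A) (k : A → Dist B) (f : B → R) → 𝔼 (d >>= k) f ≡ 𝔼 d (λ a → 𝔼 (k a) f)
  𝔼->>= d k f = trans (∑-concatMap _ d _) $ ∑-cong d λ (p , a) → begin
    ∑ (map (λ (q , b) → (p * q , b)) (k a)) (λ (q , b) → q * f b)  ≡⟨ ∑-map _ (k a) _ ⟩
    ∑ (k a) (λ (q , b) → p * q * f b)
      ≡⟨ ∑-cong (k a) (λ (q , b) → *-assoc p q (f b)) ⟩
    ∑ (k a) (λ (q , b) → p * (q * f b))                            ≡⟨ ∑-*ˡ (k a) p _ ⟩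
    p * 𝔼 (k a) f                                                  ∎
    where open ≡-Reasoning

  𝔼-+ : ∀ (d : Dist A) (f g : A → R) → 𝔼 d (λ a → f a + g a) ≡ 𝔼 d f + 𝔼 d g
  𝔼-+ d f g = trans (∑-cong d (λ (p , a) → distribˡ p (f a) (g a))) (∑-+ d _ _)

  𝔼-*ˡ : ∀ (d : Dist A) c (f : A → R) → 𝔼 d (λ a → c * f a) ≡ c * 𝔼 d f
  𝔼-*ˡ d c f = trans (∑-cong d (λ (p , a) → solve 3 (λ p c x → p :* (c :* x) := c :* (p :* x)) refl p c (f a))) (∑-*ˡ d c _)

  𝔼-∑ : ∀ (d : Dist A) (xs : List B) (f : B → A → R) → 𝔼 d (λ a → ∑ xs (λ x → f x a)) ≡ ∑ xs (λ x → 𝔼 d (f x))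
  𝔼-∑ d xs f = trans (∑-cong d (λ (p , a) → sym (∑-*ˡ xs p _))) (∑-swap d xs _)

  𝔼-swap : ∀ (d : Dist A) (d′ : Dist B) (f : A → B → R) →
           𝔼 d (λ a → 𝔼 d′ (f a)) ≡ 𝔼 d′ (λ b → 𝔼 d (λ a → f a b))
  𝔼-swap d d′ f = trans (𝔼-∑ d d′ (λ (q , b) a → q * f a b)) (∑-cong d′ (λ (q , b) → 𝔼-*ˡ d q _))

  -- A `Dist` is an arbitrary weighted list, so total mass one is a separate property. It is phrased
  -- in the form in which it is used: a draw on which nothing depends integrates out.
  Normalised : Dist A → Set
  Normalised d = ∀ c → 𝔼 d (λ _ → c) ≡ c

  return-normalised : ∀ (a : A) → Normalised (return a)
  return-normalised a c = 𝔼-return a _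

  >>=-normalised : ∀ (d : Dist A) (k : A → Dist B) → Normalised d → (∀ a → Normalised (k a)) → Normalised (d >>= k)
  >>=-normalised d k nd nk c = trans (𝔼->>= d k _) (trans (𝔼-cong d (λ a → nk a c)) (nd c))

  𝔼-bernoulli : ∀ p (f : Bool → R) → 𝔼 (bernoulli p) f ≡ p * f true + (1# - p) * f false
  𝔼-bernoulli p f = cong (p * f true +_) (+-identityʳ _)

  bernoulli-normalised : ∀ p → Normalised (bernoulli p)
  bernoulli-normalised p c = trans (𝔼-bernoulli p (λ _ → c))
    (solve 2 (λ p c → p :* c :+ (con (pos 1) :- p) :* c := c) refl p c)

  -- The weights of a `Dist` may be negative, so monotonicity of `𝔼` needs this condition. The
  -- predicate carries invariants of the outcomes through `_>>=_`.
  Valid : Pred A 0ℓ → Dist A → Set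
  Valid P d = All (λ (q , a) → 0# ≤ q × P a) d

  return-valid : ∀ {P : Pred A 0ℓ} {a} → P a → Valid P (return a)
  return-valid pa = (0≤1 , pa) ∷ []

  >>=-valid : ∀ {P : Pred A 0ℓ} {Q : Pred B 0ℓ} {d : Dist A} {k : A → Dist B} →
              Valid P d → (∀ {a} → P a → Valid Q (k a)) → Valid Q (d >>= k)
  >>=-valid {d = []} [] vk = []
  >>=-valid {d = (p , a) ∷ d} ((0≤p , pa) ∷ vd) vk =
    ++⁺ (map⁺ (All.map (λ (0≤q , qb) → *-nonNeg 0≤p 0≤q , qb) (vk pa))) (>>=-valid vd vk)

  valid-map : ∀ {P Q : Pred A 0ℓ} {d : Dist A} → (∀ {a} → P a → Q a) → Valid P d → Valid Q d
  valid-map f = All.map (λ (0≤q , pa) → 0≤q , f pa)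

  𝔼-mono : ∀ {P : Pred A 0ℓ} {d : Dist A} → Valid P d → {f g : A → R} → (∀ {a} → P a → f a ≤ g a) → 𝔼 d f ≤ 𝔼 d g
  𝔼-mono {d = d} vd le = ∑-mono-∈ d (λ x∈d → let (0≤q , pa) = All.lookup vd x∈d in *-monoʳ-≤ 0≤q (le pa))

  𝔼-cong-valid : ∀ {P : Pred A 0ℓ} {d : Dist A} → Valid P d → {f g : A → R} → (∀ {a} → P a → f a ≡ g a) → 𝔼 d f ≡ 𝔼 d g
  𝔼-cong-valid {d = d} vd eq = ∑-cong-∈ d (λ {x} x∈d → cong (proj₁ x *_) (eq (proj₂ (All.lookup vd x∈d))))

  bernoulli-valid : ∀ {p} → 0# ≤ p → p ≤ 1# → {P : Pred Bool 0ℓ} → P true → P false → Valid P (bernoulli p)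
  bernoulli-valid 0≤p p≤1 pt pf = (0≤p , pt) ∷ (x≤y⇒0≤y-x p≤1 , pf) ∷ []

  𝔼-uniform : ∀ (xs : List A) (f : A → R) → 𝔼 (uniform xs) f ≡ fromℕ (length xs) ⁻¹ * ∑ xs f
  𝔼-uniform xs f = trans (∑-map _ xs _) (∑-*ˡ xs _ f)

  𝔼-independent-suc : ∀ {k} (d : Fin (suc k) → Dist A) (f : Vec A (suc k) → R) →
    𝔼 (independent d) f ≡ 𝔼 (d Fin.zero) (λ a → 𝔼 (independent (d ∘ Fin.suc)) (λ as → f (a ∷ as)))
  𝔼-independent-suc d f = trans (𝔼->>= (d Fin.zero) (λ a → ds >>= λ as → return (a ∷ as)) f) $ 𝔼-cong (d Fin.zero) λ a →
    trans (𝔼->>= ds (λ as → return (a ∷ as)) f) $ 𝔼-cong ds λ as → 𝔼-return (a ∷ as) f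
    where ds = independent (d ∘ Fin.suc)

  independent-normalised : ∀ {k} (d : Fin k → Dist A) → (∀ i → Normalised (d i)) → Normalised (independent d)
  independent-normalised {A = A} {k = zero}  d nd = return-normalised {A = Vec A zero} []
  independent-normalised {k = suc k} d nd c =
    trans (𝔼-independent-suc d (λ _ → c)) $
    trans (𝔼-cong (d Fin.zero) (λ _ → independent-normalised (d ∘ Fin.suc) (nd ∘ Fin.suc) c)) (nd Fin.zero c)

  -- By independence, coordinate `i` can be drawn separately and written over its old value, whose
  -- own draw then integrates out. All deferred decisions rest on this.
  𝔼-resample : ∀ {k} (d : Fin k → Dist A) → (∀ i → Normalised (d i)) → ∀ i (f : Vec A k → R) →
    𝔼 (independent d) f ≡ 𝔼 (d i) (λ a → 𝔼 (independent d) (λ as → f (as [ i ]≔ a)))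
  𝔼-resample d nd Fin.zero f = begin
    𝔼 (independent d) f                                                        ≡⟨ 𝔼-independent-suc d f ⟩
    𝔼 d₀ (λ a → 𝔼 ds (λ as → f (a ∷ as)))                                      ≡⟨ 𝔼-cong d₀ (λ a → nd Fin.zero _) ⟨
    𝔼 d₀ (λ a → 𝔼 d₀ (λ _ → 𝔼 ds (λ as → f (a ∷ as))))
      ≡⟨ 𝔼-cong d₀ (λ a → 𝔼-independent-suc d _) ⟨
    𝔼 d₀ (λ a → 𝔼 (independent d) (λ as → f (as [ Fin.zero ]≔ a)))             ∎
    where
    open ≡-Reasoning
    d₀ = d Fin.zero
    ds = independent (d ∘ Fin.suc)
  𝔼-resample d nd (Fin.suc i) f = begin
    𝔼 (independent d) f                                                        ≡⟨ 𝔼-independent-suc d f ⟩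
    𝔼 d₀ (λ a → 𝔼 ds (λ as → f (a ∷ as)))
      ≡⟨ 𝔼-cong d₀ (λ a → 𝔼-resample (d ∘ Fin.suc) (nd ∘ Fin.suc) i _) ⟩
    𝔼 d₀ (λ a → 𝔼 dᵢ (λ b → 𝔼 ds (λ as → f (a ∷ as [ i ]≔ b))))                ≡⟨ 𝔼-swap d₀ dᵢ _ ⟩
    𝔼 dᵢ (λ b → 𝔼 d₀ (λ a → 𝔼 ds (λ as → f (a ∷ as [ i ]≔ b))))
      ≡⟨ 𝔼-cong dᵢ (λ b → 𝔼-independent-suc d _) ⟨
    𝔼 dᵢ (λ b → 𝔼 (independent d) (λ as → f (as [ Fin.suc i ]≔ b)))            ∎
    where
    open ≡-Reasoning
    d₀ = d Fin.zero
    dᵢ = d (Fin.suc i)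
    ds = independent (d ∘ Fin.suc)

  -- The coin clauses of `execute` and `decide` are this mixture by computation.
  choose : R → Dist A → Dist A → Dist A
  choose r d d′ = bernoulli r >>= λ b → if b then d else d′

  𝔼-choose : ∀ r (d d′ : Dist A) (f : A → R) → 𝔼 (choose r d d′) f ≡ r * 𝔼 d f + (1# - r) * 𝔼 d′ f
  𝔼-choose r d d′ f = trans
    (𝔼->>= (bernoulli r) (λ b → if b then d else d′) f)
    (𝔼-bernoulli r (λ b → 𝔼 (if b then d else d′) f))

  choose-normalised : ∀ r (d d′ : Dist A) → Normalised d → Normalised d′ → Normalised (choose r d d′)
  choose-normalised r d d′ nd nd′ = >>=-normalised (bernoulli r) (λ b → if b then d else d′) (bernoulli-normalised r)
    λ { true → nd ; false → nd′ }

  choose-valid : ∀ {r} {d d′ : Dist A} {P : Pred A 0ℓ} → 0# ≤ r → r ≤ 1# → Valid P d → Valid P d′ → Valid P (choose r d d′)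
  choose-valid {d = d} {d′} {P} 0≤r r≤1 vd vd′ =
    >>=-valid {P = λ _ → ⊤} {k = λ b → if b then d else d′} (bernoulli-valid 0≤r r≤1 tt tt)
      λ { {true} _ → vd ; {false} _ → vd′ }

-- The exponential series, harmonic sums and the floor of n/e

module Euler (ℝ : CompleteOrderedField) where
  open CompleteOrderedField ℝ renaming (Carrier to R)
  open Probing ℝ
  open Field ℝ
  open Sums ℝ

  ∑-upTo-suc : ∀ k (f : ℕ → R) → ∑ (upTo (suc k)) f ≡ ∑ (upTo k) f + f k
  ∑-upTo-suc k f = begin
    ∑ (upTo (suc k)) f          ≡⟨ cong (λ xs → ∑ xs f) (upTo-∷ʳ k) ⟨
    ∑ (upTo k ∷ʳ k) f           ≡⟨ ∑-++ (upTo k) [ k ] f ⟩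
    ∑ (upTo k) f + (f k + 0#)   ≡⟨ cong (∑ (upTo k) f +_) (+-identityʳ (f k)) ⟩
    ∑ (upTo k) f + f k          ∎
    where open ≡-Reasoning

  infixr 8 _^_
  _^_ : R → ℕ → R
  x ^ zero  = 1#
  x ^ suc k = x * x ^ k

  ^-nonNeg : ∀ {x} k → 0# ≤ x → 0# ≤ x ^ k
  ^-nonNeg zero    p = 0≤1
  ^-nonNeg (suc k) p = *-nonNeg p (^-nonNeg k p)

  ^-≤1 : ∀ {x} k → 0# ≤ x → x ≤ 1# → x ^ k ≤ 1#
  ^-≤1 zero    p q = ≤-refl
  ^-≤1 {x} (suc k) p q = begin
    x * x ^ k   ≤⟨ *-monoʳ-≤ p (^-≤1 k p q) ⟩
    x * 1#      ≡⟨ *-identityʳ x ⟩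
    x           ≤⟨ q ⟩
    1#          ∎
    where open ≤-Reasoning

  k!-positive : ∀ k → Positive (fromℕ (k !))
  k!-positive k = fromℕ-positive′ (k !) {{k ℕₚ.!≢0}}

  1/_! : ℕ → R
  1/ k ! = fromℕ (k !) ⁻¹

  1/k!-nonNeg : ∀ k → 0# ≤ 1/ k !
  1/k!-nonNeg k = ⁻¹-nonNeg (k!-positive k)

  1/0! : 1/ 0 ! ≡ 1#
  1/0! = trans (sym (*-identityˡ _)) (trans (cong (_* 1/ 0 !) (sym fromℕ-1)) (⁻¹-inverseʳ (k!-positive 0)))

  suc-*-1/suc! : ∀ k → fromℕ (suc k) * 1/ suc k ! ≡ 1/ k !
  suc-*-1/suc! k = *-cancelˡ-≡ (k!-positive k) (begin
    fromℕ (k !) * (fromℕ (suc k) * 1/ suc k !)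
      ≡⟨ solve 3 (λ a b c → a :* (b :* c) := (b :* a) :* c) refl (fromℕ (k !)) (fromℕ (suc k)) (1/ suc k !) ⟩
    (fromℕ (suc k) * fromℕ (k !)) * 1/ suc k !   ≡⟨ cong (_* 1/ suc k !) (fromℕ-* (suc k) (k !)) ⟨
    fromℕ (suc k !) * 1/ suc k !                 ≡⟨ ⁻¹-inverseʳ (k!-positive (suc k)) ⟩
    1#                                           ≡⟨ ⁻¹-inverseʳ (k!-positive k) ⟨
    fromℕ (k !) * 1/ k !                         ∎)
    where open ≡-Reasoning

  -- The Taylor polynomial of degree `N` of the exponential function at 0.
  exp≤ : ℕ → R → R
  exp≤ zero    x = 1#
  exp≤ (suc N) x = exp≤ N x + x ^ suc N * 1/ suc N !

  1^ : ∀ k → 1# ^ k ≡ 1#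
  1^ zero    = refl
  1^ (suc k) = trans (*-identityˡ _) (1^ k)

  exp≤-1 : ∀ N → exp≤ N 1# ≡ ∑ (upTo (suc N)) 1/_!
  exp≤-1 zero = sym (trans (+-identityʳ _) 1/0!)
  exp≤-1 (suc N) = trans
    (cong₂ _+_ (exp≤-1 N) (trans (cong (_* 1/ suc N !) (1^ (suc N))) (*-identityˡ _)))
    (sym (∑-upTo-suc (suc N) 1/_!))

  exp≤-mono : ∀ N {x} → 0# ≤ x → exp≤ N x ≤ exp≤ (suc N) x
  exp≤-mono N {x} 0≤x = subst (_≤ exp≤ (suc N) x) (+-identityʳ _)
    (+-monoʳ-≤ (exp≤ N x) (*-nonNeg (^-nonNeg (suc N) 0≤x) (1/k!-nonNeg (suc N))))

  -- The first two terms of the binomial expansion; the others are nonnegative.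
  ^-bernoulli : ∀ {σ x} k → 0# ≤ σ → 0# ≤ x → σ ^ suc k + fromℕ (suc k) * (x * σ ^ k) ≤ (σ + x) ^ suc k
  ^-bernoulli {σ} {x} zero 0≤σ 0≤x = ≤-reflexive
    (solve 2 (λ σ x → σ :* con (pos 1) :+ (con (pos 1) :+ con (pos 0)) :* (x :* con (pos 1)) := (σ :+ x) :* con (pos 1)) refl σ x)
  ^-bernoulli {σ} {x} (suc k) 0≤σ 0≤x = begin
    σ * s + (1# + c) * (x * s)                       ≡⟨ +-identityʳ _ ⟨
    -- The term replacing `0#` is the part quadratic in `x` of the product that the induction
    -- hypothesis bounds.
    σ * s + (1# + c) * (x * s) + 0#
      ≤⟨ +-monoʳ-≤ _ (*-nonNeg (*-nonNeg (fromℕ-nonNeg (suc k)) (*-nonNeg 0≤x 0≤x)) (^-nonNeg k 0≤σ)) ⟩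
    σ * s + (1# + c) * (x * s) + c * (x * x) * σ ^ k ≡⟨ solve 4 (λ σ x c t →
        σ :* (σ :* t) :+ (con (pos 1) :+ c) :* (x :* (σ :* t)) :+ c :* (x :* x) :* t
        := (σ :+ x) :* (σ :* t :+ c :* (x :* t))) refl σ x c (σ ^ k) ⟩
    (σ + x) * (s + c * (x * σ ^ k))                  ≤⟨ *-monoʳ-≤ (+-nonNeg 0≤σ 0≤x) (^-bernoulli k 0≤σ 0≤x) ⟩
    (σ + x) * (σ + x) ^ suc k                        ∎
    where
    open ≤-Reasoning
    s = σ ^ suc k
    c = fromℕ (suc k)

  -- A tangent-line bound: `exp≤ N` is the derivative of `exp≤ (suc N)`, which is convex on the
  -- nonnegative reals. Degree by degree it is `^-bernoulli`.
  exp≤-step : ∀ N {σ x} → 0# ≤ σ → 0# ≤ x → exp≤ (suc N) σ + x * exp≤ N σ ≤ exp≤ (suc N) (σ + x)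
  exp≤-step zero {σ} {x} 0≤σ 0≤x = ≤-reflexive (begin
    1# + σ * 1# * i + x * 1#         ≡⟨ cong (λ z → 1# + σ * 1# * z + x * 1#) i≡1 ⟩
    1# + σ * 1# * 1# + x * 1#
      ≡⟨ solve 2 (λ σ x → con (pos 1) :+ σ :* con (pos 1) :* con (pos 1) :+ x :* con (pos 1)
                                           := con (pos 1) :+ (σ :+ x) :* con (pos 1) :* con (pos 1)) refl σ x ⟩
    1# + (σ + x) * 1# * 1#           ≡⟨ cong (λ z → 1# + (σ + x) * 1# * z) i≡1 ⟨
    1# + (σ + x) * 1# * i            ∎)
    where
    open ≡-Reasoning
    i = 1/ 1 !
    i≡1 : i ≡ 1#
    i≡1 = 1/0!
  exp≤-step (suc N) {σ} {x} 0≤σ 0≤x = begin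
    E + X * j + x * (E′ + Y * i)          ≡⟨ cong (λ z → E + X * j + x * (E′ + Y * z)) (suc-*-1/suc! (suc N)) ⟨
    E + X * j + x * (E′ + Y * (c * j))    ≡⟨ solve 7 (λ E X j x E′ Y c → E :+ X :* j :+ x :* (E′ :+ Y :* (c :* j))
                                                := (E :+ x :* E′) :+ (X :+ c :* (x :* Y)) :* j) refl E X j x E′ Y c ⟩
    (E + x * E′) + (X + c * (x * Y)) * j  ≤⟨ +-mono-≤ (exp≤-step N 0≤σ 0≤x)
                                               (*-monoˡ-≤ (1/k!-nonNeg (suc (suc N))) (^-bernoulli (suc N) 0≤σ 0≤x)) ⟩
    exp≤ (suc (suc N)) (σ + x)            ∎
    where
    open ≤-Reasoning
    E  = exp≤ (suc N) σ
    E′ = exp≤ N σ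
    X  = σ ^ suc (suc N)
    Y  = σ ^ suc N
    i  = 1/ suc N !
    j  = 1/ suc (suc N) !
    c  = fromℕ (suc (suc N))

  -- Finite form of `1 + x ≤ exp x` combined with the functional equation; the degree grows by one
  -- to absorb the factor.
  exp≤-*-≤ : ∀ N {σ x} → 0# ≤ σ → 0# ≤ x → (1# + x) * exp≤ N σ ≤ exp≤ (suc N) (σ + x)
  exp≤-*-≤ N {σ} {x} 0≤σ 0≤x = begin
    (1# + x) * exp≤ N σ            ≡⟨ solve 2 (λ x E → (con (pos 1) :+ x) :* E := E :+ x :* E) refl x (exp≤ N σ) ⟩
    exp≤ N σ + x * exp≤ N σ        ≤⟨ +-monoˡ-≤ (x * exp≤ N σ) (exp≤-mono N 0≤σ) ⟩
    exp≤ (suc N) σ + x * exp≤ N σ  ≤⟨ exp≤-step N 0≤σ 0≤x ⟩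
    exp≤ (suc N) (σ + x)           ∎
    where open ≤-Reasoning

  -- The linear term alone has slope 1 and every other term is monotone. This quantitative growth
  -- makes it possible to read off `1# ≤ x` from an inequality between values.
  exp≤-gap : ∀ N {x} → 0# ≤ x → x ≤ 1# → exp≤ (suc N) x + (1# - x) ≤ exp≤ (suc N) 1#
  exp≤-gap zero {x} 0≤x x≤1 = ≤-reflexive (begin
    1# + x * 1# * i + (1# - x)      ≡⟨ cong (λ z → 1# + x * 1# * z + (1# - x)) i≡1 ⟩
    1# + x * 1# * 1# + (1# - x)
      ≡⟨ solve 1 (λ x → con (pos 1) :+ x :* con (pos 1) :* con (pos 1) :+ (con (pos 1) :- x)
                                          := con (pos 1) :+ con (pos 1) :* con (pos 1) :* con (pos 1)) refl x ⟩
    1# + 1# * 1# * 1#               ≡⟨ cong (λ z → 1# + 1# * 1# * z) i≡1 ⟨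
    1# + 1# * 1# * i                ∎)
    where
    open ≡-Reasoning
    i = 1/ 1 !
    i≡1 : i ≡ 1#
    i≡1 = 1/0!
  exp≤-gap (suc N) {x} 0≤x x≤1 = begin
    E + X * i + (1# - x)            ≡⟨ solve 3 (λ E Y y → E :+ Y :+ y := (E :+ y) :+ Y) refl E (X * i) (1# - x) ⟩
    (E + (1# - x)) + X * i          ≤⟨ +-mono-≤ (exp≤-gap N 0≤x x≤1) (*-monoˡ-≤ (1/k!-nonNeg (suc (suc N))) X≤1) ⟩
    exp≤ (suc N) 1# + 1# ^ suc (suc N) * i  ∎
    where
    open ≤-Reasoning
    E = exp≤ (suc N) x
    X = x ^ suc (suc N)
    i = 1/ suc (suc N) !
    X≤1 : X ≤ 1# ^ suc (suc N)
    X≤1 = subst (X ≤_) (sym (1^ (suc (suc N)))) (^-≤1 (suc (suc N)) 0≤x x≤1)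

  -- The last summand is added once more as slack: since `2 ≤ k + 2`, two copies of
  -- `1/ suc (suc k) !` fit into one copy of `1/ suc k !`. Some upper bound is required before
  -- `sup-upper` says anything about `e`.
  partial-e-bound : ∀ k → ∑ (upTo (suc (suc k))) 1/_! + 1/ suc k ! ≤ fromℕ 3
  partial-e-bound zero = ≤-reflexive (begin
    1/ 0 ! + (1/ 1 ! + 0#) + 1/ 1 !  ≡⟨ cong (λ z → z + (z + 0#) + z) 1/0! ⟩
    1# + (1# + 0#) + 1#              ≡⟨ solve 0 (con (pos 1) :+ (con (pos 1) :+ con (pos 0)) :+ con (pos 1)
                                          := con (pos 1) :+ (con (pos 1) :+ (con (pos 1) :+ con (pos 0)))) refl ⟩
    fromℕ 3                          ∎)
    where open ≡-Reasoning
  partial-e-bound (suc k) = begin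
    ∑ (upTo (suc (suc (suc k)))) 1/_! + j                ≡⟨ cong (_+ j) (∑-upTo-suc (suc (suc k)) 1/_!) ⟩
    (S + j) + j
      ≡⟨ solve 2 (λ s j → (s :+ j) :+ j := s :+ (con (pos 1) :+ (con (pos 1) :+ con (pos 0))) :* j) refl S j ⟩
    S + fromℕ 2 * j
      ≤⟨ +-monoʳ-≤ S (*-monoˡ-≤ (1/k!-nonNeg (suc (suc k))) (fromℕ-mono (ℕ.s≤s (ℕ.s≤s (ℕ.z≤n {k}))))) ⟩
    S + fromℕ (suc (suc k)) * j                          ≡⟨ cong (S +_) (suc-*-1/suc! (suc k)) ⟩
    S + 1/ suc k !                                       ≤⟨ partial-e-bound k ⟩
    fromℕ 3                                              ∎
    where
    open ≤-Reasoning
    S = ∑ (upTo (suc (suc k))) 1/_!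
    j = 1/ suc (suc k) !

  partial-e≤e : ∀ k → ∑ (upTo k) 1/_! ≤ e
  partial-e≤e k = sup-upper _ (fromℕ 3 , λ { _ (k , refl) → bound k }) _ (k , refl)
    where
    open ≤-Reasoning
    grow : ∀ k → ∑ (upTo k) 1/_! ≤ ∑ (upTo (suc k)) 1/_!
    grow k = begin
      ∑ (upTo k) 1/_!            ≡⟨ +-identityʳ _ ⟨
      ∑ (upTo k) 1/_! + 0#       ≤⟨ +-monoʳ-≤ _ (1/k!-nonNeg k) ⟩
      ∑ (upTo k) 1/_! + 1/ k !   ≡⟨ ∑-upTo-suc k 1/_! ⟨
      ∑ (upTo (suc k)) 1/_!      ∎
    bound : ∀ k → ∑ (upTo k) 1/_! ≤ fromℕ 3
    bound k = begin
      ∑ (upTo k) 1/_!                          ≤⟨ grow k ⟩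
      ∑ (upTo (suc k)) 1/_!                    ≤⟨ grow (suc k) ⟩
      ∑ (upTo (suc (suc k))) 1/_!              ≡⟨ +-identityʳ _ ⟨
      ∑ (upTo (suc (suc k))) 1/_! + 0#         ≤⟨ +-monoʳ-≤ _ (1/k!-nonNeg (suc k)) ⟩
      ∑ (upTo (suc (suc k))) 1/_! + 1/ suc k ! ≤⟨ partial-e-bound k ⟩
      fromℕ 3                                  ∎

  1≤e : 1# ≤ e
  1≤e = subst (_≤ e) (trans (+-identityʳ _) 1/0!) (partial-e≤e 1)

  e-positive : Positive e
  e-positive = positive-≤ 1≰0 1≤e

  -- For `x ≤ 1#` the growth bound gives `e + (1# - x) ≤ exp≤ (suc N) 1# ≤ e`, as the middle term is
  -- a partial sum of `e`. Passing to `suc N` provides the linear term on which `exp≤-gap` relies.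
  e≤exp≤⇒1≤ : ∀ N {x} → 0# ≤ x → e ≤ exp≤ N x → 1# ≤ x
  e≤exp≤⇒1≤ N {x} 0≤x e≤exp with ≤-total 1# x
  ... | inj₁ 1≤x = 1≤x
  ... | inj₂ x≤1 = 0≤y-x⇒x≤y (subst (0# ≤_)
      (solve 2 (λ e x → e :- (e :+ (con (pos 1) :- x)) := x :- con (pos 1)) refl e x)
      (x≤y⇒0≤y-x (begin
        e + (1# - x)               ≤⟨ +-monoˡ-≤ _ (≤-trans e≤exp (exp≤-mono N 0≤x)) ⟩
        exp≤ (suc N) x + (1# - x)  ≤⟨ exp≤-gap N 0≤x x≤1 ⟩
        exp≤ (suc N) 1#            ≡⟨ exp≤-1 (suc N) ⟩
        ∑ (upTo (suc (suc N))) 1/_!  ≤⟨ partial-e≤e (suc (suc N)) ⟩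
        e                          ∎)))
    where open ≤-Reasoning

  -- Σ_{t=a}^{a+j-1} 1/t
  harmonic : ℕ → ℕ → R
  harmonic a zero    = 0#
  harmonic a (suc j) = harmonic a j + fromℕ (a ℕ.+ j) ⁻¹

  harmonic-nonNeg : ∀ a .{{_ : ℕ.NonZero a}} j → 0# ≤ harmonic a j
  harmonic-nonNeg a zero    = ≤-refl
  harmonic-nonNeg (suc a) (suc j) = +-nonNeg (harmonic-nonNeg (suc a) j) (⁻¹-nonNeg (fromℕ-positive (a ℕ.+ j)))

  -- (a+j)/a is the product of the factors 1 + 1/t.
  ratio≤exp-harmonic : ∀ a .{{_ : ℕ.NonZero a}} j → fromℕ (a ℕ.+ j) ≤ fromℕ a * exp≤ j (harmonic a j)
  ratio≤exp-harmonic a zero = ≤-reflexive (trans (cong fromℕ (ℕₚ.+-identityʳ a)) (sym (*-identityʳ _)))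
  ratio≤exp-harmonic a@(suc b) (suc j) = begin
    fromℕ (a ℕ.+ suc j)                      ≡⟨ cong fromℕ (ℕₚ.+-suc a j) ⟩
    1# + k                                   ≡⟨ cong (_+ k) (⁻¹-inverseˡ k>0) ⟨
    k ⁻¹ * k + k
      ≡⟨ solve 2 (λ i k → i :* k :+ k := (con (pos 1) :+ i) :* k) refl (k ⁻¹) k ⟩
    (1# + k ⁻¹) * k                          ≤⟨ *-monoʳ-≤ (+-nonNeg 0≤1 (⁻¹-nonNeg k>0)) (ratio≤exp-harmonic a j) ⟩
    (1# + k ⁻¹) * (fromℕ a * E)
      ≡⟨ solve 3 (λ x a E → x :* (a :* E) := a :* (x :* E)) refl (1# + k ⁻¹) (fromℕ a) E ⟩
    fromℕ a * ((1# + k ⁻¹) * E)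
      ≤⟨ *-monoʳ-≤ (fromℕ-nonNeg a) (exp≤-*-≤ j (harmonic-nonNeg a j) (⁻¹-nonNeg k>0)) ⟩
    fromℕ a * exp≤ (suc j) (harmonic a (suc j)) ∎
    where
    open ≤-Reasoning
    k = fromℕ (a ℕ.+ j)
    k>0 : Positive k
    k>0 = fromℕ-positive (b ℕ.+ j)
    E = exp≤ j (harmonic a j)

  1≤harmonic : ∀ a .{{_ : ℕ.NonZero a}} j → e * fromℕ a ≤ fromℕ (a ℕ.+ j) → 1# ≤ harmonic a j
  1≤harmonic a j ea≤a+j = e≤exp≤⇒1≤ j (harmonic-nonNeg a j) (*-cancelˡ-≤ (fromℕ-positive′ a)
    (≤-trans (≤-reflexive (*-comm (fromℕ a) e)) (≤-trans ea≤a+j (ratio≤exp-harmonic a j))))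

  greatest≤-≤ : ∀ b {x} → 0# ≤ x → fromℕ (greatest≤ b x) ≤ x
  greatest≤-≤ zero    0≤x = 0≤x
  greatest≤-≤ (suc b) {x} 0≤x with fromℕ (suc b) ≤? x
  ... | yes p = p
  ... | no _  = greatest≤-≤ b 0≤x

  greatest≤-bound : ∀ b x → greatest≤ b x ℕ.≤ b
  greatest≤-bound zero    x = ℕ.z≤n
  greatest≤-bound (suc b) x with fromℕ (suc b) ≤? x
  ... | yes _ = ℕₚ.≤-refl
  ... | no _  = ℕₚ.m≤n⇒m≤1+n (greatest≤-bound b x)

  -- The search starts at `b`, so a result equal to `b` carries no information about the next
  -- number.
  greatest≤-maximal : ∀ b x → greatest≤ b x ℕ.< b → ¬ fromℕ (suc (greatest≤ b x)) ≤ x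
  greatest≤-maximal (suc b) x lt with fromℕ (suc b) ≤? x
  ... | yes _ = λ _ → ℕₚ.<-irrefl refl lt
  ... | no ¬p with ℕₚ.m≤n⇒m<n∨m≡n (greatest≤-bound b x)
  ...   | inj₁ g<b = greatest≤-maximal b x g<b
  ...   | inj₂ g≡b = λ p → ¬p (subst (λ z → fromℕ (suc z) ≤ x) g≡b p)

-- Lists with distinct entries and the enumeration of words

lookup-injective : ∀ {xs : List A} → Unique xs → ∀ {i j} → List.lookup xs i ≡ List.lookup xs j → i ≡ j
lookup-injective (x∉ ∷ u) {Fin.zero}  {Fin.zero}  eq = refl
lookup-injective {xs = x ∷ xs} (x∉ ∷ u) {Fin.zero}  {Fin.suc j} eq = ⊥-elim (All.lookup x∉ (∈-lookup {xs = xs} j) eq)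
lookup-injective {xs = x ∷ xs} (x∉ ∷ u) {Fin.suc i} {Fin.zero}  eq = ⊥-elim (All.lookup x∉ (∈-lookup {xs = xs} i) (sym eq))
lookup-injective (x∉ ∷ u) {Fin.suc i} {Fin.suc j} eq = cong Fin.suc (lookup-injective u eq)

unique-length≤ : ∀ {m} {xs : List (Fin m)} → Unique xs → length xs ℕ.≤ m
unique-length≤ u = injective⇒≤ (lookup-injective u)

unique-∷ʳ : ∀ {xs : List A} {x} → Unique (xs ∷ʳ x) → Unique (x ∷ xs)
unique-∷ʳ {xs = xs} {x} = Unique-resp-↭ (setoid _) (↭⇒↭ₛ (↭-sym (∷↭∷ʳ x xs)))

∷ʳ-unique : ∀ {xs : List A} {x} → x ∉ xs → Unique xs → Unique (xs ∷ʳ x)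
∷ʳ-unique {xs = xs} {x} x∉ u = Unique-resp-↭ (setoid _) (↭⇒↭ₛ (∷↭∷ʳ x xs)) (All.tabulate (λ y∈ eq → x∉ (subst (_∈ xs) (sym eq) y∈)) ∷ u)

same-members⇒↭ : ∀ {xs ys : List A} → Unique xs → Unique ys →
                 (∀ {x} → x ∈ xs → x ∈ ys) → (∀ {x} → x ∈ ys → x ∈ xs) → xs ↭ ys
same-members⇒↭ u v f g = ∼bag⇒↭ (unique∧set⇒bag u v (mk⇔ f g))

∈-concatMap : ∀ (k : A → List B) {xs x y} → x ∈ xs → y ∈ k x → y ∈ concatMap k xs
∈-concatMap k x∈ y∈ = ∈-concatMap⁺ k (lose x∈ y∈)

concatMap-∈ : ∀ (k : A → List B) {xs y} → y ∈ concatMap k xs → ∃ λ x → x ∈ xs × y ∈ k x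
concatMap-∈ k y∈ = find (∈-concatMap⁻ k y∈)

concatMap-unique : ∀ (k : A → List B) {xs} → Unique xs → (∀ x → Unique (k x)) →
                   (∀ {x y z} → z ∈ k x → z ∈ k y → x ≡ y) → Unique (concatMap k xs)
concatMap-unique k []       uk inj = []
concatMap-unique k {x ∷ xs} (x∉ ∷ u) uk inj = Uniqueₚ.++⁺ (uk x) (concatMap-unique k u uk inj)
  (λ (z∈kx , z∈) → let (y , y∈ , z∈ky) = concatMap-∈ k z∈ in All.lookup x∉ y∈ (inj z∈kx z∈ky))

length-concatMap : ∀ (k : A → List B) xs {c} → (∀ {x} → x ∈ xs → length (k x) ≡ c) → length (concatMap k xs) ≡ length xs ℕ.* c
length-concatMap k []       eq = refl
length-concatMap k (x ∷ xs) eq = trans (length-++ (k x)) (cong₂ ℕ._+_ (eq (here refl)) (length-concatMap k xs (eq ∘ there)))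

words-unique : ∀ {xs : List A} → Unique xs → ∀ k → Unique (words xs k)
words-unique u zero    = [] ∷ []
words-unique {xs = xs} u (suc k) = concatMap-unique (λ x → map (x ∷_) (words xs k)) u
  (λ x → Uniqueₚ.map⁺ ∷-injectiveʳ (words-unique u k))
  λ z∈x z∈y → let (_ , _ , eq) = ∈-map⁻ _ z∈x ; (_ , _ , eq′) = ∈-map⁻ _ z∈y in
    ∷-injectiveˡ (trans (sym eq) eq′)

words-length : ∀ {xs : List A} k {ys} → ys ∈ words xs k → length ys ≡ k
words-length zero    (here refl) = refl
words-length {xs = xs} (suc k) ys∈ with concatMap-∈ (λ x → map (x ∷_) (words xs k)) {xs = xs} ys∈
... | x , _ , ys∈′ with ∈-map⁻ (x ∷_) ys∈′
...   | zs , zs∈ , refl = cong suc (words-length k zs∈)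

∈-words : ∀ {xs : List A} (ys : List A) → (∀ {y} → y ∈ ys → y ∈ xs) → ys ∈ words xs (length ys)
∈-words []       ys⊆ = here refl
∈-words {xs = xs} (y ∷ ys) ys⊆ = ∈-concatMap (λ x → map (x ∷_) (words xs (length ys))) (ys⊆ (here refl))
  (∈-map⁺ (y ∷_) (∈-words ys (ys⊆ ∘ there)))

-- Probing a single online vertex

module Graph (ℝ : CompleteOrderedField) {m n : ℕ} (G : Probing.StochasticGraph ℝ m n) where
  open CompleteOrderedField ℝ renaming (Carrier to R)
  open Probing ℝ
  open Field ℝ
  open Sums ℝ
  open StochasticGraph G

  row : Fin n → Dist (Vec Bool m)
  row v = independent λ u → bernoulli (p u v)

  row-normalised : ∀ v → Normalised (row v)
  row-normalised v = independent-normalised _ (λ u → bernoulli-normalised (p u v))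

  edgeStates-normalised : Normalised (edgeStates G)
  edgeStates-normalised = independent-normalised _ row-normalised

  payoff : (Fin m → R) → Maybe (Fin m) → R
  payoff c = maybe′ c 0#

  -- The outcome of `vertexProbe` on a fixed string, with each edge state drawn at the moment of the
  -- probe.
  firstActive : Fin n → List (Fin m) → Dist (Maybe (Fin m))
  firstActive v []       = return nothing
  firstActive v (u ∷ us) = choose (p u v) (return (just u)) (firstActive v us)

  𝔼-firstActive-∷ : ∀ v u us (h : Maybe (Fin m) → R) →
    𝔼 (firstActive v (u ∷ us)) h ≡ p u v * h (just u) + (1# - p u v) * 𝔼 (firstActive v us) h
  𝔼-firstActive-∷ v u us h = trans
    (𝔼-choose (p u v) (return (just u)) (firstActive v us) h)
    (cong (λ z → p u v * z + (1# - p u v) * 𝔼 (firstActive v us) h) (𝔼-return (just u) h))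

  firstActive-normalised : ∀ v us → Normalised (firstActive v us)
  firstActive-normalised v []       = return-normalised {A = Maybe (Fin m)} nothing
  firstActive-normalised v (u ∷ us) = choose-normalised (p u v) (return (just u)) (firstActive v us)
    (return-normalised (just u)) (firstActive-normalised v us)

  firstActive-valid : ∀ v us → Valid (λ _ → ⊤) (firstActive v us)
  firstActive-valid v []       = return-valid tt
  firstActive-valid v (u ∷ us) = choose-valid (p-nonNeg u v) (p≤1 u v) (return-valid tt) (firstActive-valid v us)

  -- Linear in the payoff `c`. The weights give `val`, and the indicator of `u` gives the
  -- coefficient of the load at `u`.
  gain : Fin n → (Fin m → R) → List (Fin m) → R
  gain v c us = 𝔼 (firstActive v us) (payoff c)

  gain-[] : ∀ v c → gain v c [] ≡ 0#
  gain-[] v c = 𝔼-return {A = Maybe (Fin m)} nothing (payoff c)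

  gain-nonNeg : ∀ v us {c} → (∀ u → 0# ≤ c u) → 0# ≤ gain v c us
  gain-nonNeg v us 0≤c = ≤-trans (≤-reflexive (sym (firstActive-normalised v us 0#)))
    (𝔼-mono (firstActive-valid v us) {λ _ → 0#} {payoff _} λ { {nothing} _ → ≤-refl ; {just u} _ → 0≤c u })

  gain-mono : ∀ v us {c c′} → (∀ u → c u ≤ c′ u) → gain v c us ≤ gain v c′ us
  gain-mono v us c≤c′ = 𝔼-mono (firstActive-valid v us) λ { {nothing} _ → ≤-refl ; {just u} _ → c≤c′ u }

  -- For `u` in a string with distinct entries, this is the probability that `u` is its first active
  -- edge.
  reach : Fin n → List (Fin m) → Fin m → R
  reach v us u = p u v * q G v (before G u us)

  reach-here : ∀ v u us → reach v (u ∷ us) u ≡ p u v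
  reach-here v u us with u ≟ u
  ... | yes _  = *-identityʳ (p u v)
  ... | no u≢u = ⊥-elim (u≢u refl)

  reach-there : ∀ v {u u′} us → u ≢ u′ → reach v (u ∷ us) u′ ≡ (1# - p u v) * reach v us u′
  reach-there v {u} {u′} us u≢u′ with u ≟ u′
  ... | yes eq = ⊥-elim (u≢u′ eq)
  ... | no _   = solve 3 (λ a b c → a :* (b :* c) := b :* (a :* c)) refl (p u′ v) (1# - p u v) (q G v (before G u′ us))

  gain-reach : ∀ v c {us} → Unique us → gain v c us ≡ ∑ us (λ u → c u * reach v us u)
  gain-reach v c {[]} [] = gain-[] v c
  gain-reach v c {u ∷ us} (u∉ ∷ uq) = begin
    gain v c (u ∷ us)                            ≡⟨ 𝔼-firstActive-∷ v u us (payoff c) ⟩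
    p u v * c u + r * gain v c us
      ≡⟨ cong₂ (λ a b → a + r * b) (trans (*-comm _ _) (cong (c u *_) (sym (reach-here v u us)))) (gain-reach v c uq) ⟩
    c u * reach v (u ∷ us) u + r * ∑ us (λ u′ → c u′ * reach v us u′)
      ≡⟨ cong (c u * reach v (u ∷ us) u +_) (∑-*ˡ us r _) ⟨
    c u * reach v (u ∷ us) u + ∑ us (λ u′ → r * (c u′ * reach v us u′))
      ≡⟨ cong (c u * reach v (u ∷ us) u +_) (∑-cong-∈ us λ {u′} u′∈ → trans
           (solve 3 (λ a b c → a :* (b :* c) := b :* (a :* c)) refl r (c u′) (reach v us u′))
           (cong (c u′ *_) (sym (reach-there v us (All.lookup u∉ u′∈))))) ⟩
    c u * reach v (u ∷ us) u + ∑ us (λ u′ → c u′ * reach v (u ∷ us) u′) ∎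
    where
    open ≡-Reasoning
    r = 1# - p u v

  val-gain : ∀ v {us} → Unique us → val G v us ≡ gain v (λ u → w u v) us
  val-gain v {us} uq = trans (∑-cong us (λ u → *-assoc (w u v) (p u v) _)) (sym (gain-reach v (λ u → w u v) uq))

  open DecMembership (_≟_ {n = m}) using () renaming (_∈?_ to _∈ₗ?_)

  -- If `u` is absent, `before u us` is the whole string and `reach` need not vanish. The indicator,
  -- which is the filter in `load`, removes these strings.
  reach-gain : ∀ v u {us} → Unique us → 𝟙 (u ∈ₗ? us) * reach v us u ≡ gain v (λ u′ → 𝟙 (u′ ≟ u)) us
  reach-gain v u {us} uq = trans lemma (sym (trans (gain-reach v _ uq) (∑-cong us (λ u′ → *-comm _ _))))
    where
    lemma : 𝟙 (u ∈ₗ? us) * reach v us u ≡ ∑ us (λ u′ → reach v us u′ * 𝟙 (u′ ≟ u))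
    lemma with u ∈ₗ? us
    ... | yes u∈ = trans (*-identityˡ _) (sym (∑-𝟙-∈ _≟_ (reach v us) uq u∈))
    ... | no u∉  = trans (zeroˡ _) (sym (∑-𝟙-∉ _≟_ us (reach v us) u∉))

  allStrings-unique : Unique (concatMap (words (allFin m)) (upTo (suc m)))
  allStrings-unique = concatMap-unique (words (allFin m)) (Uniqueₚ.upTo⁺ (suc m))
    (words-unique (Uniqueₚ.allFin⁺ m)) (λ {k} {l} z∈k z∈l → trans (sym (words-length k z∈k)) (words-length l z∈l))

  strings-unique : ∀ v → Unique (strings G v)
  strings-unique v = Uniqueₚ.filter⁺ (C? v) allStrings-unique

  ∈-strings : ∀ v {us} → C v us → us ∈ strings G v
  ∈-strings v {us} Cus = ∈-filter⁺ (C? v)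
    (∈-concatMap (words (allFin m)) (∈-upTo⁺ (ℕ.s≤s (unique-length≤ (C-distinct v Cus)))) (∈-words us (λ _ → ∈-allFin _))) Cus

  strings-C : ∀ v {us} → us ∈ strings G v → C v us
  strings-C v us∈ = proj₂ (∈-filter⁻ (C? v) {xs = concatMap (words (allFin m)) (upTo (suc m))} us∈)

  module _ (S : Subset n) where
    open ConfigLP G S

    objective-gain : ∀ x → objective x ≡ ∑ online λ v → ∑ (strings G v) λ us → gain v (λ u → w u v) us * x v us
    objective-gain x = ∑-cong online λ v → ∑-cong-∈ (strings G v) λ {us} us∈ →
      cong (_* x v us) (val-gain v (C-distinct v (strings-C v us∈)))

    load-gain : ∀ x u → load x u ≡ ∑ online λ v → ∑ (strings G v) λ us → gain v (λ u′ → 𝟙 (u′ ≟ u)) us * x v us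
    load-gain x u = ∑-cong online λ v → trans (∑-filter (u ∈ₗ?_) (strings G v) _) $ ∑-cong-∈ (strings G v) λ {us} us∈ → trans
      (sym (*-assoc (𝟙 (u ∈ₗ? us)) (reach v us u) (x v us)))
      (cong (_* x v us) (reach-gain v u (C-distinct v (strings-C v us∈))))

  𝔼-edgeStates-row : ∀ v (f : EdgeStates G → R) →
    𝔼 (edgeStates G) f ≡ 𝔼 (row v) (λ r → 𝔼 (edgeStates G) (λ ω → f (ω [ v ]≔ r)))
  𝔼-edgeStates-row v f = 𝔼-resample row row-normalised v f

  setState : EdgeStates G → Fin m → Fin n → Bool → EdgeStates G
  setState ω u v b = ω [ v ]≔ (lookup ω v [ u ]≔ b)

  active-setState : ∀ ω u v b → active G (setState ω u v b) v u ≡ b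
  active-setState ω u v b = trans
    (cong (λ r → lookup r u) (lookup∘update v ω (lookup ω v [ u ]≔ b)))
    (lookup∘update u (lookup ω v) b)

  active-setState′ : ∀ ω {u v u′ v′} b → (u′ , v′) ≢ (u , v) → active G (setState ω u v b) v′ u′ ≡ active G ω v′ u′
  active-setState′ ω {u} {v} {u′} {v′} b e≢ with v′ ≟ v
  ... | no v′≢v  = cong (λ r → lookup r u′) (lookup∘update′ v′≢v ω _)
  ... | yes refl = trans
    (cong (λ r → lookup r u′) (lookup∘update v ω (lookup ω v [ u ]≔ b)))
    (lookup∘update′ (λ u′≡u → e≢ (cong (_, v) u′≡u)) (lookup ω v) b)

  𝔼-row-state : ∀ v u (f : Vec Bool m → R) →
    𝔼 (row v) f ≡ p u v * 𝔼 (row v) (λ r → f (r [ u ]≔ true)) + (1# - p u v) * 𝔼 (row v) (λ r → f (r [ u ]≔ false))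
  𝔼-row-state v u f = trans
    (𝔼-resample (λ u → bernoulli (p u v)) (λ u → bernoulli-normalised (p u v)) u f)
    (𝔼-bernoulli (p u v) (λ b → 𝔼 (row v) (λ r → f (r [ u ]≔ b))))

  -- Resampling twice, first row `v` and then its entry `u`, isolates the single coin behind the
  -- edge.
  𝔼-edgeStates-state : ∀ v u (f : EdgeStates G → R) → 𝔼 (edgeStates G) f ≡
    p u v * 𝔼 (edgeStates G) (λ ω → f (setState ω u v true)) + (1# - p u v) * 𝔼 (edgeStates G) (λ ω → f (setState ω u v false))
  𝔼-edgeStates-state v u f = begin
    𝔼 (edgeStates G) f                                             ≡⟨ 𝔼-edgeStates-row v f ⟩
    𝔼 (row v) (λ r → 𝔼 (edgeStates G) (λ ω → f (ω [ v ]≔ r)))      ≡⟨ 𝔼-row-state v u _ ⟩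
    p u v * part true + (1# - p u v) * part false
      ≡⟨ cong₂ (λ a b → p u v * a + (1# - p u v) * b) (eq true) (eq false) ⟩
    p u v * 𝔼 (edgeStates G) (λ ω → f (setState ω u v true)) + (1# - p u v) * 𝔼 (edgeStates G) (λ ω → f (setState ω u v false)) ∎
    where
    open ≡-Reasoning
    part : Bool → R
    part b = 𝔼 (row v) (λ r → 𝔼 (edgeStates G) (λ ω → f (ω [ v ]≔ (r [ u ]≔ b))))
    eq : ∀ b → part b ≡ 𝔼 (edgeStates G) (λ ω → f (setState ω u v b))
    -- Writing a fresh row and then overwriting its entry is a single update of row `v`, so the
    -- resampled row can be absorbed again.
    eq b = sym $ trans (𝔼-edgeStates-row v _) $ 𝔼-cong (row v) λ r → 𝔼-cong (edgeStates G) λ ω → cong f $ trans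
      (cong (λ r′ → (ω [ v ]≔ r) [ v ]≔ (r′ [ u ]≔ b)) (lookup∘update v ω r))
      ([]≔-idempotent ω v)

  findᵇ-update : ∀ (r : Vec Bool m) {u} b us → u ∉ us → findᵇ (lookup (r [ u ]≔ b)) us ≡ findᵇ (lookup r) us
  findᵇ-update r b []        u∉ = refl
  findᵇ-update r b (u′ ∷ us) u∉
    rewrite lookup∘update′ (λ u′≡u → u∉ (here (sym u′≡u))) r b | findᵇ-update r b us (u∉ ∘ there) = refl

  -- Once the state of `u` has been fixed, the rest of the string does not contain `u` and so cannot
  -- see the overwritten entry.
  𝔼-findᵇ : ∀ v {us} → Unique us → (h : Maybe (Fin m) → R) →
    𝔼 (row v) (λ r → h (findᵇ (lookup r) us)) ≡ 𝔼 (firstActive v us) h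
  𝔼-findᵇ v {[]}     []        h = trans (row-normalised v (h nothing)) (sym (𝔼-return {A = Maybe (Fin m)} nothing h))
  𝔼-findᵇ v {u ∷ us} (u∉ ∷ uq) h = begin
    𝔼 (row v) (λ r → h (findᵇ (lookup r) (u ∷ us)))             ≡⟨ 𝔼-row-state v u _ ⟩
    p u v * 𝔼 (row v) (λ r → h (findᵇ (lookup (r [ u ]≔ true)) (u ∷ us)))
      + (1# - p u v) * 𝔼 (row v) (λ r → h (findᵇ (lookup (r [ u ]≔ false)) (u ∷ us)))
      ≡⟨ cong₂ (λ a b → p u v * a + (1# - p u v) * b)
           (trans (𝔼-cong (row v) (λ r → cong h (found r))) (row-normalised v _))
           (trans (𝔼-cong (row v) (λ r → cong h (skipped r))) (𝔼-findᵇ v uq h)) ⟩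
    p u v * h (just u) + (1# - p u v) * 𝔼 (firstActive v us) h  ≡⟨ 𝔼-firstActive-∷ v u us h ⟨
    𝔼 (firstActive v (u ∷ us)) h                                ∎
    where
    open ≡-Reasoning
    found : ∀ r → findᵇ (lookup (r [ u ]≔ true)) (u ∷ us) ≡ just u
    found r rewrite lookup∘update u r true = refl
    skipped : ∀ r → findᵇ (lookup (r [ u ]≔ false)) (u ∷ us) ≡ findᵇ (lookup r) us
    skipped r rewrite lookup∘update u r false = findᵇ-update r false us (λ u∈ → All.lookup u∉ u∈ refl)

-- The benchmark and its relaxation

module Offline (ℝ : CompleteOrderedField) {m n : ℕ} (G : Probing.StochasticGraph ℝ m n) where
  open CompleteOrderedField ℝ renaming (Carrier to R)
  open Probing ℝ
  open Field ℝ
  open Sums ℝ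
  open Graph ℝ G
  open StochasticGraph G

  ∈-probedAt : ∀ {u v ps} → (u , v) ∈ ps → u ∈ probedAt G v ps
  ∈-probedAt {v = v} uv∈ = ∈-map⁺ proj₁ (∈-filter⁺ (λ f → proj₂ f ≟ v) uv∈ refl)

  probedAt-∷ʳ : ∀ ps u v → probedAt G v (ps ∷ʳ (u , v)) ≡ probedAt G v ps ∷ʳ u
  probedAt-∷ʳ ps u v = begin
    map proj₁ (filter at-v (ps ∷ʳ (u , v)))                  ≡⟨ cong (map proj₁) (filter-++ at-v ps _) ⟩
    map proj₁ (filter at-v ps ++ filter at-v [ (u , v) ])
      ≡⟨ cong (λ es → map proj₁ (filter at-v ps ++ es)) (filter-accept at-v refl) ⟩
    map proj₁ (filter at-v ps ∷ʳ (u , v))                    ≡⟨ map-++ proj₁ (filter at-v ps) _ ⟩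
    probedAt G v ps ∷ʳ u                                     ∎
    where
    open ≡-Reasoning
    at-v = λ (f : Edge G) → proj₂ f ≟ v

  probedAt-∷ʳ′ : ∀ ps u {v v′} → v′ ≢ v → probedAt G v (ps ∷ʳ (u , v′)) ≡ probedAt G v ps
  probedAt-∷ʳ′ ps u {v} {v′} v′≢v = begin
    map proj₁ (filter at-v (ps ∷ʳ (u , v′)))                 ≡⟨ cong (map proj₁) (filter-++ at-v ps _) ⟩
    map proj₁ (filter at-v ps ++ filter at-v [ (u , v′) ])
      ≡⟨ cong (λ es → map proj₁ (filter at-v ps ++ es)) (filter-reject at-v v′≢v) ⟩
    map proj₁ (filter at-v ps ++ [])                         ≡⟨ cong (map proj₁) (++-identityʳ _) ⟩
    probedAt G v ps                                          ∎
    where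
    open ≡-Reasoning
    at-v = λ (f : Edge G) → proj₂ f ≟ v

  -- The string probed at `v′` has distinct entries, so an edge is never probed again.
  fresh-probe : ∀ {ps u v u′ v′} → C v′ (probedAt G v′ ps ∷ʳ u′) → (u , v) ∈ ps → (u′ , v′) ≢ (u , v)
  fresh-probe {v′ = v′} Cus uv∈ refl = Uniqueₚ.Unique[x∷xs]⇒x∉xs (unique-∷ʳ (C-distinct v′ Cus)) (∈-probedAt uv∈)

  mutual
    -- Changing the state of an edge already probed is invisible to the remaining execution, by
    -- `fresh-probe`.
    execute-setState : ∀ {ps M} (s : Strategy G ps M) ω {u v} b → (u , v) ∈ ps →
                       execute G (setState ω u v b) s ≡ execute G ω s
    execute-setState stop ω b uv∈ = refl
    execute-setState (coin r _ _ s s′) ω b uv∈ =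
      cong₂ (choose r) (execute-setState s ω b uv∈) (execute-setState s′ ω b uv∈)
    execute-setState (probe u′ v′ Cus d s) ω {u} {v} b uv∈
      rewrite active-setState′ ω b (fresh-probe Cus uv∈)
            | decide-setState d ω b (∈-++⁺ˡ {ys = [ (u′ , v′) ]} uv∈)
            | execute-setState s ω b (∈-++⁺ˡ {ys = [ (u′ , v′) ]} uv∈) = refl

    decide-setState : ∀ {ps M u′ v′} (d : Decision G ps M u′ v′) ω {u v} b → (u , v) ∈ ps →
                      decide G (setState ω u v b) d ≡ decide G ω d
    decide-setState (include _ _ s) ω b uv∈ = execute-setState s ω b uv∈
    decide-setState (decline s) ω b uv∈ = execute-setState s ω b uv∈
    decide-setState (coin r _ _ d d′) ω b uv∈ =
      cong₂ (choose r) (decide-setState d ω b uv∈) (decide-setState d′ ω b uv∈)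

  -- Deferred decisions: the state of an edge is drawn when the edge is probed.
  mutual
    run : ∀ {ps M} → Strategy G ps M → Dist (List (Edge G))
    run {M = M} stop         = return M
    run (coin r _ _ s s′)    = choose r (run s) (run s′)
    run (probe u v _ d s)    = choose (p u v) (runDecision d) (run s)

    runDecision : ∀ {ps M u v} → Decision G ps M u v → Dist (List (Edge G))
    runDecision (include _ _ s)   = run s
    runDecision (decline s)       = run s
    runDecision (coin r _ _ d d′) = choose r (runDecision d) (runDecision d′)

  module _ (f : List (Edge G) → R) where
    private
      Ω = edgeStates G

      𝔼-mix : ∀ r (g g′ : EdgeStates G → R) → 𝔼 Ω (λ ω → r * g ω + (1# - r) * g′ ω) ≡ r * 𝔼 Ω g + (1# - r) * 𝔼 Ω g′
      𝔼-mix r g g′ = trans (𝔼-+ Ω _ _) (cong₂ _+_ (𝔼-*ˡ Ω r g) (𝔼-*ˡ Ω (1# - r) g′))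

    mutual
      -- At a probe, the state of its edge is resampled. The two continuations then ignore the
      -- overwritten state, and the induction hypotheses apply to the original distribution of all
      -- states.
      execute-run : ∀ {ps M} (s : Strategy G ps M) → 𝔼 Ω (λ ω → 𝔼 (execute G ω s) f) ≡ 𝔼 (run s) f
      execute-run {M = M} stop = edgeStates-normalised _
      execute-run (coin r _ _ s s′) = begin
        𝔼 Ω (λ ω → 𝔼 (choose r (execute G ω s) (execute G ω s′)) f)
          ≡⟨ 𝔼-cong Ω (λ ω → 𝔼-choose r (execute G ω s) (execute G ω s′) f) ⟩
        𝔼 Ω (λ ω → r * 𝔼 (execute G ω s) f + (1# - r) * 𝔼 (execute G ω s′) f)
          ≡⟨ 𝔼-mix r _ _ ⟩
        r * 𝔼 Ω (λ ω → 𝔼 (execute G ω s) f) + (1# - r) * 𝔼 Ω (λ ω → 𝔼 (execute G ω s′) f)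
          ≡⟨ cong₂ (λ a b → r * a + (1# - r) * b) (execute-run s) (execute-run s′) ⟩
        r * 𝔼 (run s) f + (1# - r) * 𝔼 (run s′) f
          ≡⟨ 𝔼-choose r (run s) (run s′) f ⟨
        𝔼 (choose r (run s) (run s′)) f ∎
        where open ≡-Reasoning
      execute-run {ps = ps} (probe u v Cus d s) = begin
        𝔼 Ω (λ ω → 𝔼 (execute G ω (probe u v Cus d s)) f)
          ≡⟨ 𝔼-edgeStates-state v u _ ⟩
        p u v * 𝔼 Ω (λ ω → 𝔼 (execute G (setState ω u v true) (probe u v Cus d s)) f)
          + (1# - p u v) * 𝔼 Ω (λ ω → 𝔼 (execute G (setState ω u v false) (probe u v Cus d s)) f)
          ≡⟨ cong₂ (λ a b → p u v * a + (1# - p u v) * b)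
               (𝔼-cong Ω (λ ω → cong (λ D → 𝔼 D f) (on-true ω)))
               (𝔼-cong Ω (λ ω → cong (λ D → 𝔼 D f) (on-false ω))) ⟩
        p u v * 𝔼 Ω (λ ω → 𝔼 (decide G ω d) f) + (1# - p u v) * 𝔼 Ω (λ ω → 𝔼 (execute G ω s) f)
          ≡⟨ cong₂ (λ a b → p u v * a + (1# - p u v) * b) (decide-run d) (execute-run s) ⟩
        p u v * 𝔼 (runDecision d) f + (1# - p u v) * 𝔼 (run s) f
          ≡⟨ 𝔼-choose (p u v) (runDecision d) (run s) f ⟨
        𝔼 (choose (p u v) (runDecision d) (run s)) f ∎
        where
        open ≡-Reasoning
        uv∈ = ∈-++⁺ʳ ps {[ (u , v) ]} (here refl)
        on-true : ∀ ω → execute G (setState ω u v true) (probe u v Cus d s) ≡ decide G ω d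
        on-true ω rewrite active-setState ω u v true = decide-setState d ω true uv∈
        on-false : ∀ ω → execute G (setState ω u v false) (probe u v Cus d s) ≡ execute G ω s
        on-false ω rewrite active-setState ω u v false = execute-setState s ω false uv∈

      decide-run : ∀ {ps M u v} (d : Decision G ps M u v) → 𝔼 Ω (λ ω → 𝔼 (decide G ω d) f) ≡ 𝔼 (runDecision d) f
      decide-run (include _ _ s) = execute-run s
      decide-run (decline s)     = execute-run s
      decide-run (coin r _ _ d d′) = begin
        𝔼 Ω (λ ω → 𝔼 (choose r (decide G ω d) (decide G ω d′)) f)
          ≡⟨ 𝔼-cong Ω (λ ω → 𝔼-choose r (decide G ω d) (decide G ω d′) f) ⟩
        𝔼 Ω (λ ω → r * 𝔼 (decide G ω d) f + (1# - r) * 𝔼 (decide G ω d′) f)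
          ≡⟨ 𝔼-mix r _ _ ⟩
        r * 𝔼 Ω (λ ω → 𝔼 (decide G ω d) f) + (1# - r) * 𝔼 Ω (λ ω → 𝔼 (decide G ω d′) f)
          ≡⟨ cong₂ (λ a b → r * a + (1# - r) * b) (decide-run d) (decide-run d′) ⟩
        r * 𝔼 (runDecision d) f + (1# - r) * 𝔼 (runDecision d′) f
          ≡⟨ 𝔼-choose r (runDecision d) (runDecision d′) f ⟨
        𝔼 (choose r (runDecision d) (runDecision d′)) f ∎
        where open ≡-Reasoning

    𝔼-offlineMatching : ∀ s → 𝔼 (offlineMatching G s) f ≡ 𝔼 (run s) f
    𝔼-offlineMatching s = trans (𝔼->>= Ω (λ ω → execute G ω s) f) (execute-run s)

  mutual
    run-normalised : ∀ {ps M} (s : Strategy G ps M) → Normalised (run s)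
    run-normalised {M = M} stop      = return-normalised {A = List (Edge G)} M
    run-normalised (coin r _ _ s s′) = choose-normalised r (run s) (run s′) (run-normalised s) (run-normalised s′)
    run-normalised (probe u v _ d s) = choose-normalised (p u v) (runDecision d) (run s) (runDecision-normalised d) (run-normalised s)

    runDecision-normalised : ∀ {ps M u v} (d : Decision G ps M u v) → Normalised (runDecision d)
    runDecision-normalised (include _ _ s)   = run-normalised s
    runDecision-normalised (decline s)       = run-normalised s
    runDecision-normalised (coin r _ _ d d′) =
      choose-normalised r (runDecision d) (runDecision d′) (runDecision-normalised d) (runDecision-normalised d′)

  -- Through `count-≤1` this invariant becomes the LP constraint at each offline vertex.
  MatchesU : List (Edge G) → Set
  MatchesU M = Unique (map proj₁ M)

  mutual
    run-valid : ∀ {ps M} (s : Strategy G ps M) → MatchesU M → Valid MatchesU (run s)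
    run-valid stop                  uq = return-valid uq
    run-valid (coin r 0≤r r≤1 s s′) uq = choose-valid 0≤r r≤1 (run-valid s uq) (run-valid s′ uq)
    run-valid (probe u v _ d s)     uq = choose-valid (p-nonNeg u v) (p≤1 u v) (runDecision-valid d uq) (run-valid s uq)

    runDecision-valid : ∀ {ps M u v} (d : Decision G ps M u v) → MatchesU M → Valid MatchesU (runDecision d)
    runDecision-valid {M = M} (include u∉ _ s) uq =
      run-valid s (All.tabulate (λ u′∈ u≡u′ → u∉ (subst (_∈ map proj₁ M) (sym u≡u′) u′∈)) ∷ uq)
    runDecision-valid (decline s)             uq = run-valid s uq
    runDecision-valid (coin r 0≤r r≤1 d d′)   uq = choose-valid 0≤r r≤1 (runDecision-valid d uq) (runDecision-valid d′ uq)

  count-≤1 : ∀ u {M} → MatchesU M → ∑ M (λ (u′ , _) → 𝟙 (u′ ≟ u)) ≤ 1#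
  count-≤1 u {[]} uq = 0≤1
  count-≤1 u {(u′ , v′) ∷ M} (u′∉ ∷ uq) with u′ ≟ u
  ... | no _     = ≤-trans (≤-reflexive (+-identityˡ _)) (count-≤1 u uq)
  ... | yes refl = ≤-reflexive (trans (cong (1# +_) rest≡0) (+-identityʳ 1#))
    where
    rest≡0 : ∑ M (λ (u″ , _) → 𝟙 (u″ ≟ u)) ≡ 0#
    rest≡0 = trans (∑-cong-∈ M (λ {e} e∈ → 𝟙-false (proj₁ e ≟ u) (λ eq → All.lookup u′∉ (∈-map⁺ proj₁ e∈) (sym eq)))) (∑-0 M)

  -- Splits a sum over a matching by online vertex; `∑-massAt` puts it together again.
  massAt : Fin n → (Fin m → R) → List (Edge G) → R
  massAt v c M = ∑ M (λ (u , v′) → 𝟙 (v′ ≟ v) * c u)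

  massAt-unmatched : ∀ v c {M} → UnmatchedV G M v → massAt v c M ≡ 0#
  massAt-unmatched v c {M} v∉ = trans
    (∑-cong-∈ M (λ {e} e∈ → trans
      (cong (_* c (proj₁ e)) (𝟙-false (proj₂ e ≟ v) (λ eq → v∉ (subst (_∈ map proj₂ M) eq (∈-map⁺ proj₂ e∈)))))
      (zeroˡ (c (proj₁ e)))))
    (∑-0 M)

  massAt-∷ : ∀ c u v M → massAt v c ((u , v) ∷ M) ≡ c u + massAt v c M
  massAt-∷ c u v M = cong (_+ massAt v c M) (trans (cong (_* c u) (𝟙-true (v ≟ v) refl)) (*-identityˡ (c u)))

  massAt-∷′ : ∀ c u {v v′} M → v′ ≢ v → massAt v c ((u , v′) ∷ M) ≡ massAt v c M
  massAt-∷′ c u {v} {v′} M v′≢v = trans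
    (cong (_+ massAt v c M) (trans (cong (_* c u) (𝟙-false (v′ ≟ v) v′≢v)) (zeroˡ (c u))))
    (+-identityˡ _)

  ∑-massAt : ∀ (c : Fin m → Fin n → R) M → ∑ (allFin n) (λ v → massAt v (λ u → c u v) M) ≡ ∑ M (λ (u , v) → c u v)
  ∑-massAt c M = trans (∑-swap (allFin n) M _) $ ∑-cong M λ (u , v′) → trans
    (∑-cong (allFin n) (λ v → trans (*-comm _ _) (cong (c u v *_) (flip-𝟙 v v′))))
    (∑-𝟙-∈ _≟_ (c u) (Uniqueₚ.allFin⁺ n) (∈-allFin v′))
    where
    flip-𝟙 : ∀ v v′ → 𝟙 (v′ ≟ v) ≡ 𝟙 (v ≟ v′)
    flip-𝟙 v v′ with v ≟ v′
    ... | yes v≡v′ = 𝟙-true (v′ ≟ v) (sym v≡v′)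
    ... | no v≢v′  = 𝟙-false (v′ ≟ v) (v≢v′ ∘ sym)

  -- The string probed at one online vertex

  module AtVertex (v : Fin n) where

    -- The string that a strategy probes at v if all these probes fail.  When it
    -- would decline the edge it skips the probe and draws the state of the edge
    -- itself, so that an edge that is really probed is accepted if active.
    mutual
      probedString : ∀ {ps M} → Strategy G ps M → Dist (List (Fin m))
      probedString stop = return []
      probedString (coin r _ _ s s′) = choose r (probedString s) (probedString s′)
      probedString (probe u v′ _ d s) =
        if does (v′ ≟ v) then string-at u v′ d (probedString s)
                         else choose (p u v′) (string-elsewhere d) (probedString s)

      string-at : ∀ {ps M u′ v″} (u : Fin m) (v′ : Fin n) → Decision G ps M u′ v″ → Dist (List (Fin m)) → Dist (List (Fin m))
      string-at u v′ (include _ _ _)   D = D >>= λ us → return (u ∷ us)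
      string-at u v′ (decline s)       D = choose (p u v′) (probedString s) D
      string-at u v′ (coin r _ _ d d′) D = choose r (string-at u v′ d D) (string-at u v′ d′ D)

      string-elsewhere : ∀ {ps M u′ v′} → Decision G ps M u′ v′ → Dist (List (Fin m))
      string-elsewhere (include _ _ s)   = probedString s
      string-elsewhere (decline s)       = probedString s
      string-elsewhere (coin r _ _ d d′) = choose r (string-elsewhere d) (string-elsewhere d′)

    mutual
      probedString-normalised : ∀ {ps M} (s : Strategy G ps M) → Normalised (probedString s)
      probedString-normalised stop = return-normalised {A = List (Fin m)} []
      probedString-normalised (coin r _ _ s s′) =
        choose-normalised r (probedString s) (probedString s′) (probedString-normalised s) (probedString-normalised s′)
      probedString-normalised (probe u v′ _ d s) with v′ ≟ v
      ... | yes _ = string-at-normalised u v′ d (probedString s) (probedString-normalised s)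
      ... | no _  =
          choose-normalised (p u v′) (string-elsewhere d) (probedString s) (string-elsewhere-normalised d) (probedString-normalised s)

      string-at-normalised : ∀ {ps M u′ v″} (u : Fin m) (v′ : Fin n) (d : Decision G ps M u′ v″) D →
                               Normalised D → Normalised (string-at u v′ d D)
      string-at-normalised u v′ (include _ _ _)   D nD =
        >>=-normalised D (λ us → return (u ∷ us)) nD (λ us → return-normalised {A = List (Fin m)} (u ∷ us))
      string-at-normalised u v′ (decline s)       D nD =
        choose-normalised (p u v′) (probedString s) D (probedString-normalised s) nD
      string-at-normalised u v′ (coin r _ _ d d′) D nD =
        choose-normalised r (string-at u v′ d D) (string-at u v′ d′ D)
          (string-at-normalised u v′ d D nD) (string-at-normalised u v′ d′ D nD)

      string-elsewhere-normalised : ∀ {ps M u′ v′} (d : Decision G ps M u′ v′) → Normalised (string-elsewhere d)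
      string-elsewhere-normalised (include _ _ s)   = probedString-normalised s
      string-elsewhere-normalised (decline s)       = probedString-normalised s
      string-elsewhere-normalised (coin r _ _ d d′) =
        choose-normalised r (string-elsewhere d) (string-elsewhere d′) (string-elsewhere-normalised d) (string-elsewhere-normalised d′)

    -- Move `u` to the front by a permutation, then drop it by passing to a substring. This is where
    -- downward closure permits skipping the probes of declined edges.
    C-skip : ∀ xs u ys → C v ((xs ∷ʳ u) ++ ys) → C v (xs ++ ys)
    C-skip xs u ys c = C-substring v [ u ] (xs ++ ys) [] $
      subst (C v) (cong (u ∷_) (sym (++-identityʳ (xs ++ ys)))) $
      C-permute v (shift u xs ys) (subst (C v) (++-assoc xs [ u ] ys) c)

    mutual
      -- The past probes at `v` are kept as a prefix so that the constraint checked by `probe` can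
      -- be used. A skipped probe enters that prefix and is removed again by `C-skip`.
      probedString-valid : ∀ {ps M} (s : Strategy G ps M) → C v (probedAt G v ps) →
                           Valid (λ us → C v (probedAt G v ps ++ us)) (probedString s)
      probedString-valid stop c = return-valid (subst (C v) (sym (++-identityʳ _)) c)
      probedString-valid (coin r 0≤r r≤1 s s′) c = choose-valid 0≤r r≤1 (probedString-valid s c) (probedString-valid s′ c)
      probedString-valid {ps} (probe u v′ c′ d s) c with v′ ≟ v
      ... | yes refl = string-at-valid {ps = ps} u d (probedString s) c″
          (valid-map (λ {us} → subst (λ xs → C v (xs ++ us)) (probedAt-∷ʳ ps u v))
            (probedString-valid s (c″ (probedAt-∷ʳ ps u v))))
        where
        c″ : ∀ {xs} → xs ≡ probedAt G v ps ∷ʳ u → C v xs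
        c″ refl = c′
      ... | no v′≢v = choose-valid (p-nonNeg u v′) (p≤1 u v′)
          (subst (λ xs → Valid (λ us → C v (xs ++ us)) (string-elsewhere d)) eq (string-elsewhere-valid d (subst (C v) (sym eq) c)))
          (subst (λ xs → Valid (λ us → C v (xs ++ us)) (probedString s)) eq (probedString-valid s (subst (C v) (sym eq) c)))
        where eq = probedAt-∷ʳ′ ps u v′≢v

      string-at-valid : ∀ {ps M u′ v″} u (d : Decision G (ps ∷ʳ (u , v)) M u′ v″) D →
        (∀ {xs} → xs ≡ probedAt G v ps ∷ʳ u → C v xs) →
        Valid (λ us → C v ((probedAt G v ps ∷ʳ u) ++ us)) D →
        Valid (λ us → C v (probedAt G v ps ++ us)) (string-at u v d D)
      string-at-valid {ps} u (include _ _ _) D c vD =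
        >>=-valid vD (λ {us} cus → return-valid (subst (C v) (++-assoc (probedAt G v ps) [ u ] us) cus))
      string-at-valid {ps} u (decline s) D c vD = choose-valid (p-nonNeg u v) (p≤1 u v)
        (valid-map (λ {us} cus → C-skip (probedAt G v ps) u us (subst (λ xs → C v (xs ++ us)) (probedAt-∷ʳ ps u v) cus))
          (probedString-valid s (c (probedAt-∷ʳ ps u v))))
        (valid-map (λ {us} → C-skip (probedAt G v ps) u us) vD)
      string-at-valid {ps} u (coin r 0≤r r≤1 d d′) D c vD =
        choose-valid 0≤r r≤1 (string-at-valid {ps} u d D c vD) (string-at-valid {ps} u d′ D c vD)

      string-elsewhere-valid : ∀ {ps M u′ v′} (d : Decision G ps M u′ v′) → C v (probedAt G v ps) →
                               Valid (λ us → C v (probedAt G v ps ++ us)) (string-elsewhere d)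
      string-elsewhere-valid (include _ _ s) c = probedString-valid s c
      string-elsewhere-valid (decline s)     c = probedString-valid s c
      string-elsewhere-valid (coin r 0≤r r≤1 d d′) c =
        choose-valid 0≤r r≤1 (string-elsewhere-valid d c) (string-elsewhere-valid d′ c)

    module _ (c : Fin m → R) where
      private
        Φ : List (Edge G) → R
        Φ = massAt v c

        g : List (Fin m) → R
        g = gain v c

        mix : ∀ r (d d′ : Dist (List (Edge G))) (D D′ : Dist (List (Fin m))) →
              𝔼 d Φ ≡ 𝔼 D g → 𝔼 d′ Φ ≡ 𝔼 D′ g → 𝔼 (choose r d d′) Φ ≡ 𝔼 (choose r D D′) g
        mix r d d′ D D′ eq eq′ = trans (𝔼-choose r d d′ Φ)
          (trans (cong₂ (λ a b → r * a + (1# - r) * b) eq eq′) (sym (𝔼-choose r D D′ g)))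

        const-mix : ∀ r (d d′ : Dist (List (Edge G))) z → 𝔼 d Φ ≡ z → 𝔼 d′ Φ ≡ z → 𝔼 (choose r d d′) Φ ≡ z
        const-mix r d d′ z eq eq′ = trans (𝔼-choose r d d′ Φ)
          (trans (cong₂ (λ a b → r * a + (1# - r) * b) eq eq′)
            (solve 2 (λ r z → r :* z :+ (con (pos 1) :- r) :* z := z) refl r z))

      mutual
        -- `include` demands that its online vertex be unmatched, so nothing is added at `v` any
        -- more.
        run-matched : ∀ {ps M} (s : Strategy G ps M) → v ∈ map proj₂ M → 𝔼 (run s) Φ ≡ Φ M
        run-matched {M = M} stop v∈ = 𝔼-return M Φ
        run-matched (coin r _ _ s s′) v∈ =
          const-mix r (run s) (run s′) _ (run-matched s v∈) (run-matched s′ v∈)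
        run-matched (probe u v′ _ d s) v∈ =
          const-mix (p u v′) (runDecision d) (run s) _ (runDecision-matched d v∈) (run-matched s v∈)

        runDecision-matched : ∀ {ps M u v′} (d : Decision G ps M u v′) → v ∈ map proj₂ M → 𝔼 (runDecision d) Φ ≡ Φ M
        runDecision-matched {M = M} {u} {v′} (include _ v′∉ s) v∈ =
          trans (run-matched s (there v∈)) (massAt-∷′ c u {v′ = v′} M λ { refl → v′∉ v∈ })
        runDecision-matched (decline s)       v∈ = run-matched s v∈
        runDecision-matched (coin r _ _ d d′) v∈ =
          const-mix r (runDecision d) (runDecision d′) _ (runDecision-matched d v∈) (runDecision-matched d′ v∈)

      mutual
        -- Both sides satisfy the same recursion. At an included edge of `v`, activity fixes the
        -- mass at `c u` forever and inactivity continues, as in `firstActive`; all other choices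
        -- are mixtures with the same weights.
        run-gain : ∀ {ps M} (s : Strategy G ps M) → UnmatchedV G M v → 𝔼 (run s) Φ ≡ 𝔼 (probedString s) g
        run-gain {M = M} stop v∉ = begin
          𝔼 (return M) Φ         ≡⟨ 𝔼-return M Φ ⟩
          Φ M                    ≡⟨ massAt-unmatched v c v∉ ⟩
          0#                     ≡⟨ gain-[] v c ⟨
          g []                   ≡⟨ 𝔼-return {A = List (Fin m)} [] g ⟨
          𝔼 (return []) g        ∎
          where open ≡-Reasoning
        run-gain (coin r _ _ s s′) v∉ = mix r (run s) (run s′) (probedString s) (probedString s′) (run-gain s v∉) (run-gain s′ v∉)
        run-gain (probe u v′ _ d s) v∉ with v′ ≟ v
        ... | yes refl = trans (𝔼-choose (p u v) (runDecision d) (run s) Φ)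
          (here-gain d (run s) (probedString s) (probedString-normalised s) v∉ (run-gain s v∉))
        ... | no v′≢v  =
          mix (p u v′) (runDecision d) (run s) (string-elsewhere d) (probedString s) (elsewhere-gain d v′≢v v∉) (run-gain s v∉)

        here-gain : ∀ {ps M u} (d : Decision G ps M u v) D D′ → Normalised D′ → UnmatchedV G M v → 𝔼 D Φ ≡ 𝔼 D′ g →
          p u v * 𝔼 (runDecision d) Φ + (1# - p u v) * 𝔼 D Φ ≡ 𝔼 (string-at u v d D′) g
        here-gain {M = M} {u} (include _ _ s) D D′ nD′ v∉ eq = begin
          p u v * 𝔼 (run s) Φ + r * 𝔼 D Φ
            ≡⟨ cong₂ (λ a b → p u v * a + r * b) run≡ eq ⟩
          -- The constant is moved under the draw of the remaining string, where it completes the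
          -- recursion of `gain` for `u ∷ us`.
          p u v * c u + r * 𝔼 D′ g
            ≡⟨ cong₂ _+_ (nD′ (p u v * c u)) (𝔼-*ˡ D′ r g) ⟨
          𝔼 D′ (λ _ → p u v * c u) + 𝔼 D′ (λ us → r * g us)
            ≡⟨ 𝔼-+ D′ _ _ ⟨
          𝔼 D′ (λ us → p u v * c u + r * g us)
            ≡⟨ 𝔼-cong D′ (λ us → 𝔼-firstActive-∷ v u us (payoff c)) ⟨
          𝔼 D′ (λ us → g (u ∷ us))
            ≡⟨ 𝔼-cong D′ (λ us → 𝔼-return (u ∷ us) g) ⟨
          𝔼 D′ (λ us → 𝔼 (return (u ∷ us)) g)
            ≡⟨ 𝔼->>= D′ (λ us → return (u ∷ us)) g ⟨
          𝔼 (D′ >>= λ us → return (u ∷ us)) g ∎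
          where
          open ≡-Reasoning
          r = 1# - p u v
          run≡ : 𝔼 (run s) Φ ≡ c u
          run≡ = trans (run-matched s (here refl)) (trans (massAt-∷ c u v M)
            (trans (cong (c u +_) (massAt-unmatched v c v∉)) (+-identityʳ (c u))))
        here-gain {u = u} (decline s) D D′ nD′ v∉ eq = trans
          (cong₂ (λ a b → p u v * a + (1# - p u v) * b) (run-gain s v∉) eq)
          (sym (𝔼-choose (p u v) (probedString s) D′ g))
        here-gain {u = u} (coin r _ _ d d′) D D′ nD′ v∉ eq = begin
          p u v * 𝔼 (choose r (runDecision d) (runDecision d′)) Φ + (1# - p u v) * 𝔼 D Φ
            ≡⟨ cong (λ z → p u v * z + (1# - p u v) * 𝔼 D Φ) (𝔼-choose r (runDecision d) (runDecision d′) Φ) ⟩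
          -- The strategy tosses this coin after seeing the edge active, the string before probing
          -- it. The order is immaterial, as both outcomes share the continuation after an inactive
          -- edge.
          p u v * (r * 𝔼 (runDecision d) Φ + (1# - r) * 𝔼 (runDecision d′) Φ) + (1# - p u v) * 𝔼 D Φ
            ≡⟨ solve 5 (λ q r x y z → q :* (r :* x :+ (con (pos 1) :- r) :* y) :+ (con (pos 1) :- q) :* z
                 := r :* (q :* x :+ (con (pos 1) :- q) :* z) :+ (con (pos 1) :- r) :* (q :* y :+ (con (pos 1) :- q) :* z))
                 refl (p u v) r (𝔼 (runDecision d) Φ) (𝔼 (runDecision d′) Φ) (𝔼 D Φ) ⟩
          r * (p u v * 𝔼 (runDecision d) Φ + (1# - p u v) * 𝔼 D Φ) + (1# - r) * (p u v * 𝔼 (runDecision d′) Φ + (1# - p u v) * 𝔼 D Φ)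
            ≡⟨ cong₂ (λ a b → r * a + (1# - r) * b) (here-gain d D D′ nD′ v∉ eq) (here-gain d′ D D′ nD′ v∉ eq) ⟩
          r * 𝔼 (string-at u v d D′) g + (1# - r) * 𝔼 (string-at u v d′ D′) g
            ≡⟨ 𝔼-choose r (string-at u v d D′) (string-at u v d′ D′) g ⟨
          𝔼 (choose r (string-at u v d D′) (string-at u v d′ D′)) g ∎
          where open ≡-Reasoning

        elsewhere-gain : ∀ {ps M u v′} (d : Decision G ps M u v′) → v′ ≢ v → UnmatchedV G M v →
                         𝔼 (runDecision d) Φ ≡ 𝔼 (string-elsewhere d) g
        elsewhere-gain (include _ _ s) v′≢v v∉ = run-gain s λ { (here eq) → v′≢v (sym eq) ; (there v∈) → v∉ v∈ }
        elsewhere-gain (decline s)     v′≢v v∉ = run-gain s v∉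
        elsewhere-gain (coin r _ _ d d′) v′≢v v∉ =
          mix r (runDecision d) (runDecision d′) (string-elsewhere d) (string-elsewhere d′) (elsewhere-gain d v′≢v v∉) (elsewhere-gain d′ v′≢v v∉)

  open AtVertex using (probedString; probedString-valid; probedString-normalised; run-gain)

  -- A feasible LP solution from a strategy

  module Relaxation (s : Strategy G [] []) where
    open ConfigLP G Subset.⊤

    private
      D : Fin n → Dist (List (Fin m))
      D v = probedString v s

      _≟ₛ_ = ≡-dec (_≟_ {n = m})

    probability : Assignment G
    probability v us = 𝔼 (D v) (λ us′ → 𝟙 (us ≟ₛ us′))

    -- With no past probes, `probedString-valid` places every drawn string in `C v`, so the
    -- enumeration `strings` misses none of them.
    ∑-probability : ∀ v (f : List (Fin m) → R) → ∑ (strings G v) (λ us → f us * probability v us) ≡ 𝔼 (D v) f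
    ∑-probability v f = begin
      ∑ (strings G v) (λ us → f us * probability v us)
        ≡⟨ ∑-cong (strings G v) (λ us → 𝔼-*ˡ (D v) (f us) _) ⟨
      ∑ (strings G v) (λ us → 𝔼 (D v) (λ us′ → f us * 𝟙 (us ≟ₛ us′)))
        ≡⟨ 𝔼-∑ (D v) (strings G v) (λ us us′ → f us * 𝟙 (us ≟ₛ us′)) ⟨
      𝔼 (D v) (λ us′ → ∑ (strings G v) (λ us → f us * 𝟙 (us ≟ₛ us′)))
        ≡⟨ 𝔼-cong-valid (probedString-valid v s (C-empty v)) (λ cus → ∑-𝟙-∈ _≟ₛ_ f (strings-unique v) (∈-strings v cus)) ⟩
      𝔼 (D v) f ∎
      where open ≡-Reasoning

    online-⊤ : ∀ (f : Fin n → R) → ∑ online f ≡ ∑ (allFin n) f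
    online-⊤ f = trans (∑-filter (Subsetₚ._∈? Subset.⊤) (allFin n) f)
      (∑-cong (allFin n) (λ v → trans (cong (_* f v) (𝟙-true (v Subsetₚ.∈? Subset.⊤) ∈⊤)) (*-identityˡ (f v))))

    -- With `c` the weights this evaluates the objective; with `c` the indicator of `u` it turns the
    -- load into the expected number of matched edges at `u`.
    ∑-gain : ∀ (c : Fin m → Fin n → R) →
      ∑ online (λ v → ∑ (strings G v) (λ us → gain v (λ u → c u v) us * probability v us)) ≡
      𝔼 (run s) (λ M → ∑ M (λ (u , v) → c u v))
    ∑-gain c = begin
      ∑ online (λ v → ∑ (strings G v) (λ us → gain v (λ u → c u v) us * probability v us))
        ≡⟨ online-⊤ _ ⟩
      ∑ (allFin n) (λ v → ∑ (strings G v) (λ us → gain v (λ u → c u v) us * probability v us))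
        ≡⟨ ∑-cong (allFin n) (λ v → trans (∑-probability v (gain v (λ u → c u v))) (sym (run-gain v (λ u → c u v) s λ ()))) ⟩
      ∑ (allFin n) (λ v → 𝔼 (run s) (massAt v (λ u → c u v)))
        ≡⟨ 𝔼-∑ (run s) (allFin n) _ ⟨
      𝔼 (run s) (λ M → ∑ (allFin n) (λ v → massAt v (λ u → c u v) M))
        ≡⟨ 𝔼-cong (run s) (∑-massAt c) ⟩
      𝔼 (run s) (λ M → ∑ M (λ (u , v) → c u v)) ∎
      where open ≡-Reasoning

    probability-feasible : Feasible probability
    probability-feasible = record
      { nonNeg = λ v us _ _ → ≤-trans (≤-reflexive (sym (probedString-normalised v s 0#)))
          (𝔼-mono (probedString-valid v s (C-empty v)) {λ _ → 0#} {λ us′ → 𝟙 (us ≟ₛ us′)} (λ {us′} _ → 0≤𝟙 (us ≟ₛ us′)))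
      ; load≤1 = λ u → begin
          load probability u
            ≡⟨ load-gain Subset.⊤ probability u ⟩
          ∑ online (λ v → ∑ (strings G v) (λ us → gain v (λ u′ → 𝟙 (u′ ≟ u)) us * probability v us))
            ≡⟨ ∑-gain (λ u′ _ → 𝟙 (u′ ≟ u)) ⟩
          𝔼 (run s) (λ M → ∑ M (λ (u′ , _) → 𝟙 (u′ ≟ u)))
            ≤⟨ 𝔼-mono (run-valid s []) {g = λ _ → 1#} (count-≤1 u) ⟩
          𝔼 (run s) (λ _ → 1#)
            ≡⟨ run-normalised s 1# ⟩
          1# ∎
      ; normalised = λ v _ → trans (∑-cong (strings G v) (λ us → sym (*-identityˡ (probability v us))))
          (trans (∑-probability v (λ _ → 1#)) (probedString-normalised v s 1#))
      }
      where open ≤-Reasoning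

    𝔼-weight : 𝔼 (offlineMatching G s) (weight G) ≡ objective probability
    𝔼-weight = trans (𝔼-offlineMatching (weight G) s) (sym (trans (objective-gain Subset.⊤ probability) (∑-gain w)))

  module _ {x : Assignment G} (optimal : ConfigLP.Optimal G Subset.⊤ x) where
    open ConfigLP G Subset.⊤
    open Relaxation using (probability; probability-feasible; 𝔼-weight)

    private
      values-bounded : IsUpperBound (λ z → ∃ λ s → z ≡ 𝔼 (offlineMatching G s) (weight G)) (objective x)
      values-bounded _ (s , refl) =
        ≤-trans (≤-reflexive (𝔼-weight s)) (Optimal.maximal optimal (probability s) (probability-feasible s))

    OPT≤objective : OPT G ≤ objective x
    OPT≤objective = sup-least _ (_ , stop , refl) _ values-bounded

    -- `stop` earns nothing, and the LP value supplies the bound under which a supremum dominates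
    -- its set. Nonnegativity allows the constant in front of `OPT G` to be enlarged at the end.
    0≤OPT : 0# ≤ OPT G
    0≤OPT = subst (_≤ OPT G) (trans (𝔼-offlineMatching (weight G) stop) (𝔼-return {A = List (Edge G)} [] (weight G)))
      (sup-upper _ (_ , values-bounded) _ (stop , refl))

-- Sets of arrivals and their orders

-- The list `online` of `ConfigLP` by computation, so LP sums can be read as sums over `members`.
members : ∀ {n} → Subset n → List (Fin n)
members {n} S = filter (_∈? S) (allFin n)

_∖_ : ∀ {n} → Subset n → Fin n → Subset n
S ∖ v = S ∩ ∁ ⁅ v ⁆

Size : ∀ {n} → ℕ → Subset n → Set
Size k S = length (members S) ≡ k

-- The injective words of length k over S, built from the last letter: the LP that
-- the algorithm solves at the last arrival depends only on S.
orders : ∀ {n} → ℕ → Subset n → List (List (Fin n))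
orders zero    S = [ [] ]
orders (suc k) S = concatMap (λ v → map (_∷ʳ v) (orders k (S ∖ v))) (members S)

-- Extends the set of past arrivals exactly as `process` does.
gather : ∀ {n} → Subset n → List (Fin n) → Subset n
gather = foldl (λ S v → S ∪ ⁅ v ⁆)

module _ {n : ℕ} where

  ∈-members : ∀ {S : Subset n} {v} → v Subset.∈ S → v ∈ members S
  ∈-members {S} v∈S = ∈-filter⁺ (_∈? S) (∈-allFin _) v∈S

  members-∈ : ∀ {S : Subset n} {v} → v ∈ members S → v Subset.∈ S
  members-∈ {S} v∈ = proj₂ (∈-filter⁻ (_∈? S) {xs = allFin n} v∈)

  members-unique : ∀ (S : Subset n) → Unique (members S)
  members-unique S = Uniqueₚ.filter⁺ (_∈? S) (Uniqueₚ.allFin⁺ n)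

  v∉S∖v : ∀ {S : Subset n} {v} → v Subset.∉ S ∖ v
  v∉S∖v {S} {v} v∈ = x∈∁p⇒x∉p (proj₂ (x∈p∩q⁻ S (∁ ⁅ v ⁆) v∈)) (x∈⁅x⁆ v)

  ∈-∖⁺ : ∀ {S : Subset n} {u v} → u Subset.∈ S → u ≢ v → u Subset.∈ S ∖ v
  ∈-∖⁺ {v = v} u∈S u≢v = x∈p∩q⁺ (u∈S , x∉p⇒x∈∁p (u≢v ∘ x∈⁅y⁆⇒x≡y v))

  ∈-∖⁻ : ∀ {S : Subset n} {u v} → u Subset.∈ S ∖ v → u Subset.∈ S
  ∈-∖⁻ {S} {v = v} u∈ = proj₁ (x∈p∩q⁻ S (∁ ⁅ v ⁆) u∈)

  ∖-∪ : ∀ {S : Subset n} {v} → v Subset.∈ S → (S ∖ v) ∪ ⁅ v ⁆ ≡ S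
  ∖-∪ {S} {v} v∈S = ⊆-antisym to from
    where
    to : (S ∖ v) ∪ ⁅ v ⁆ Subset.⊆ S
    to u∈ with x∈p∪q⁻ (S ∖ v) ⁅ v ⁆ u∈
    ... | inj₁ u∈S∖v = ∈-∖⁻ {S} u∈S∖v
    ... | inj₂ u∈v   = subst (Subset._∈ S) (sym (x∈⁅y⁆⇒x≡y v u∈v)) v∈S
    from : S Subset.⊆ (S ∖ v) ∪ ⁅ v ⁆
    from {u} u∈S with u ≟ v
    ... | yes refl = x∈p∪q⁺ (inj₂ (x∈⁅x⁆ v))
    ... | no u≢v   = x∈p∪q⁺ (inj₁ (∈-∖⁺ u∈S u≢v))

  members-∖ : ∀ {S : Subset n} {v} → v Subset.∈ S → members S ↭ v ∷ members (S ∖ v)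
  members-∖ {S} {v} v∈S = same-members⇒↭ (members-unique S)
    (All.tabulate (λ u∈ v≡u → v∉S∖v (subst (Subset._∈ S ∖ v) (sym v≡u) (members-∈ u∈))) ∷ members-unique (S ∖ v))
    to λ { (here refl) → ∈-members v∈S ; (there u∈) → ∈-members (∈-∖⁻ {S} (members-∈ u∈)) }
    where
    to : ∀ {u} → u ∈ members S → u ∈ v ∷ members (S ∖ v)
    to {u} u∈ with u ≟ v
    ... | yes u≡v = here u≡v
    ... | no u≢v  = there (∈-members (∈-∖⁺ (members-∈ u∈) u≢v))

  size-∖ : ∀ {k} {S : Subset n} {v} → Size (suc k) S → v Subset.∈ S → Size k (S ∖ v)
  size-∖ size v∈S = ℕₚ.suc-injective (trans (sym (↭-length (members-∖ v∈S))) size)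

  size-0 : ∀ {S : Subset n} → Size 0 S → Subset.⊥ ≡ S
  size-0 {S} size = ⊆-antisym (⊥-elim ∘ ∉⊥) (λ v∈S → ⊥-elim (empty (members S) size (∈-members v∈S)))
    where
    empty : ∀ {v} (vs : List (Fin n)) → length vs ≡ 0 → v ∉ vs
    empty [] _ ()

  orders-∈ : ∀ {k} {S : Subset n} {vs} → vs ∈ orders (suc k) S →
             ∃ λ v → ∃ λ us → v Subset.∈ S × us ∈ orders k (S ∖ v) × vs ≡ us ∷ʳ v
  orders-∈ {k} {S} vs∈ with concatMap-∈ (λ v → map (_∷ʳ v) (orders k (S ∖ v))) {xs = members S} vs∈
  ... | v , v∈ , vs∈′ with ∈-map⁻ (_∷ʳ v) vs∈′
  ...   | us , us∈ , eq = v , us , members-∈ v∈ , us∈ , eq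

  length-∷ʳ : ∀ {A : Set} (xs : List A) {x} → length (xs ∷ʳ x) ≡ suc (length xs)
  length-∷ʳ xs = trans (length-++ xs) (ℕₚ.+-comm (length xs) 1)

  orders-length : ∀ k {S : Subset n} {vs} → vs ∈ orders k S → length vs ≡ k
  orders-length zero    (here refl) = refl
  orders-length (suc k) {S} vs∈ with orders-∈ {k} {S} vs∈
  ... | v , us , _ , us∈ , refl = trans (length-∷ʳ us) (cong suc (orders-length k us∈))

  orders-⊆ : ∀ k {S : Subset n} {vs v} → vs ∈ orders k S → v ∈ vs → v Subset.∈ S
  orders-⊆ zero (here refl) ()
  orders-⊆ (suc k) {S} vs∈ w∈ with orders-∈ {k} {S} vs∈
  ... | v , us , v∈S , us∈ , refl with ∈-++⁻ us w∈
  ...   | inj₁ w∈us       = ∈-∖⁻ {S} (orders-⊆ k us∈ w∈us)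
  ...   | inj₂ (here refl) = v∈S

  orders-injective : ∀ k {S : Subset n} {vs} → vs ∈ orders k S → Unique vs
  orders-injective zero    (here refl) = []
  orders-injective (suc k) {S} vs∈ with orders-∈ {k} {S} vs∈
  ... | v , us , v∈S , us∈ , refl = ∷ʳ-unique (λ v∈us → v∉S∖v (orders-⊆ k us∈ v∈us)) (orders-injective k us∈)

  ∈-orders : ∀ k {S : Subset n} vs → length vs ≡ k → Unique vs → (∀ {v} → v ∈ vs → v Subset.∈ S) → vs ∈ orders k S
  ∈-orders zero    [] _ _ _ = here refl
  ∈-orders (suc k) {S} vs len uq ⊆S with initLast vs
  ... | us ∷ʳ′ v = ∈-concatMap (λ v → map (_∷ʳ v) (orders k (S ∖ v))) (∈-members (⊆S (∈-++⁺ʳ us (here refl))))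
    (∈-map⁺ (_∷ʳ v) (∈-orders k us (ℕₚ.suc-injective (trans (sym (length-∷ʳ us)) len)) (unique-tail (unique-∷ʳ uq))
      λ {u} u∈ → ∈-∖⁺ (⊆S (∈-++⁺ˡ u∈)) λ u≡v → Uniqueₚ.Unique[x∷xs]⇒x∉xs (unique-∷ʳ uq) (subst (_∈ us) u≡v u∈)))
    where
    unique-tail : ∀ {x : Fin n} {xs} → Unique (x ∷ xs) → Unique xs
    unique-tail (_ ∷ u) = u

  orders-unique : ∀ k (S : Subset n) → Unique (orders k S)
  orders-unique zero    S = [] ∷ []
  orders-unique (suc k) S = concatMap-unique (λ v → map (_∷ʳ v) (orders k (S ∖ v))) (members-unique S)
    (λ v → Uniqueₚ.map⁺ (∷ʳ-injectiveˡ _ _) (orders-unique k (S ∖ v)))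
    λ {u} {v} z∈u z∈v → let (us , _ , eq) = ∈-map⁻ (_∷ʳ u) z∈u ; (vs , _ , eq′) = ∈-map⁻ (_∷ʳ v) z∈v in
      ∷ʳ-injectiveʳ us vs (trans (sym eq) eq′)

  -- The accumulated set forgets the order; hence all orders of `S` lead to the same LP.
  gather-orders : ∀ k {S : Subset n} {vs} → Size k S → vs ∈ orders k S → gather Subset.⊥ vs ≡ S
  gather-orders zero    size (here refl) = size-0 size
  gather-orders (suc k) {S} size vs∈ with orders-∈ {k} {S} vs∈
  ... | v , us , v∈S , us∈ , refl = trans (foldl-∷ʳ (λ S v → S ∪ ⁅ v ⁆) Subset.⊥ v us)
    (trans (cong (_∪ ⁅ v ⁆) (gather-orders k (size-∖ size v∈S) us∈)) (∖-∪ v∈S))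

  size-⊤ : Size n (Subset.⊤ {n})
  size-⊤ = trans (cong length (filter-all (_∈? Subset.⊤) {xs = allFin n} (All.tabulate (λ _ → ∈⊤)))) (length-tabulate (λ i → i))

  orders-count : ∀ k {S : Subset n} → Size k S → length (orders k S) ≡ k !
  orders-count zero    size = refl
  orders-count (suc k) {S} size = trans
    (length-concatMap (λ v → map (_∷ʳ v) (orders k (S ∖ v))) (members S)
      (λ {v} v∈ → trans (length-map (_∷ʳ v) (orders k (S ∖ v))) (orders-count k (size-∖ size (members-∈ v∈)))))
    (cong (ℕ._* (k !)) size)

-- The online algorithm with deferred decisions

module Online (ℝ : CompleteOrderedField) {m n : ℕ} (G : Probing.StochasticGraph ℝ m n)
              (solution : Subset n → Probing.Assignment ℝ G) where
  open CompleteOrderedField ℝ renaming (Carrier to R)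
  open Probing ℝ
  open Field ℝ
  open Sums ℝ
  open Graph ℝ G
  open StochasticGraph G
  open DecMembership (_≟_ {n = m}) using () renaming (_∈?_ to _∈ₗ?_)

  private
    Ω : Dist (EdgeStates G)
    Ω = edgeStates G

    a : ℕ
    a = ⌊ n /e⌋

  draw : Subset n → Fin n → Dist (List (Fin m))
  draw S v = map (λ us → (solution S v us , us)) (strings G v)

  -- Optimality constrains `solution S v` for `v` in `S` only, so later uses carry this membership
  -- to have a probability distribution.
  probeFrom : Subset n → Fin n → Dist (Maybe (Fin m))
  probeFrom S v = draw S v >>= firstActive v

  𝔼-draw : ∀ S v (f : List (Fin m) → R) → 𝔼 (draw S v) f ≡ ∑ (strings G v) (λ us → solution S v us * f us)
  𝔼-draw S v f = ∑-map _ (strings G v) _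

  𝔼-probeFrom : ∀ S v (h : Maybe (Fin m) → R) →
    𝔼 (probeFrom S v) h ≡ ∑ (strings G v) (λ us → solution S v us * 𝔼 (firstActive v us) h)
  𝔼-probeFrom S v h = trans (𝔼->>= (draw S v) (firstActive v) h) (𝔼-draw S v _)

  add : List (Edge G) → Fin n → Maybe (Fin m) → Dist (List (Edge G))
  add M v r = return (addEdge G M r v)

  -- Here `S` already contains the arriving `v`, as the LP is solved after its arrival.
  step : ℕ → Subset n → Fin n → List (Edge G) → Dist (List (Edge G))
  step t S v M = if does (t ℕₚ.≤? a) then return M else (probeFrom S v >>= add M v)

  -- The algorithm with deferred decisions, like run for strategies.
  trace : ℕ → Subset n → List (Edge G) → List (Fin n) → Dist (List (Edge G))
  trace t S M []       = return M
  trace t S M (v ∷ vs) = step t (S ∪ ⁅ v ⁆) v M >>= λ M′ → trace (suc t) (S ∪ ⁅ v ⁆) M′ vs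

  𝔼-step-early : ∀ {t} S v M (f : List (Edge G) → R) → t ℕ.≤ a → 𝔼 (step t S v M) f ≡ f M
  𝔼-step-early {t} S v M f t≤a rewrite dec-true (t ℕₚ.≤? a) t≤a = 𝔼-return M f

  𝔼-step-late : ∀ {t} S v M (f : List (Edge G) → R) → ¬ t ℕ.≤ a →
                𝔼 (step t S v M) f ≡ 𝔼 (probeFrom S v) (λ r → f (addEdge G M r v))
  𝔼-step-late {t} S v M f t≰a rewrite dec-false (t ℕₚ.≤? a) t≰a = trans
    (𝔼->>= (probeFrom S v) (add M v) f)
    (𝔼-cong (probeFrom S v) (λ r → 𝔼-return (addEdge G M r v) f))

  module _ (f : List (Edge G) → R) where
    private
      P : EdgeStates G → ℕ → Subset n → List (Edge G) → List (Fin n) → R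
      P ω t S M vs = 𝔼 (process G solution ω t S M vs) f

    process-early : ∀ {t} ω S M v vs → t ℕ.≤ a → P ω t S M (v ∷ vs) ≡ P ω (suc t) (S ∪ ⁅ v ⁆) M vs
    process-early {t} ω S M v vs t≤a rewrite dec-true (t ℕₚ.≤? a) t≤a =
      trans (𝔼->>= (return M) (λ M′ → process G solution ω (suc t) (S ∪ ⁅ v ⁆) M′ vs) f)
            (𝔼-return M (λ M′ → P ω (suc t) (S ∪ ⁅ v ⁆) M′ vs))

    process-late : ∀ {t} ω S M v vs → ¬ t ℕ.≤ a → P ω t S M (v ∷ vs) ≡
      ∑ (strings G v) (λ us → solution (S ∪ ⁅ v ⁆) v us * P ω (suc t) (S ∪ ⁅ v ⁆) (addEdge G M (findᵇ (active G ω v) us) v) vs)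
    process-late {t} ω S M v vs t≰a rewrite dec-false (t ℕₚ.≤? a) t≰a = begin
      𝔼 ((vp >>= add M v) >>= k) f
        ≡⟨ 𝔼->>= (vp >>= add M v) k f ⟩
      𝔼 (vp >>= add M v) (λ M′ → 𝔼 (k M′) f)
        ≡⟨ 𝔼->>= vp (add M v) _ ⟩
      𝔼 vp (λ r → 𝔼 (add M v r) (λ M′ → 𝔼 (k M′) f))
        ≡⟨ 𝔼-cong vp (λ r → 𝔼-return (addEdge G M r v) (λ M′ → 𝔼 (k M′) f)) ⟩
      𝔼 vp (λ r → 𝔼 (k (addEdge G M r v)) f)
        ≡⟨ 𝔼->>= (draw S′ v) (λ us → return (findᵇ (active G ω v) us)) _ ⟩
      𝔼 (draw S′ v) (λ us → 𝔼 (return (findᵇ (active G ω v) us)) (λ r → 𝔼 (k (addEdge G M r v)) f))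
        ≡⟨ 𝔼-cong (draw S′ v) (λ us → 𝔼-return (findᵇ (active G ω v) us) (λ r → 𝔼 (k (addEdge G M r v)) f)) ⟩
      𝔼 (draw S′ v) (λ us → 𝔼 (k (addEdge G M (findᵇ (active G ω v) us) v)) f)
        ≡⟨ 𝔼-draw S′ v _ ⟩
      ∑ (strings G v) (λ us → solution S′ v us * 𝔼 (k (addEdge G M (findᵇ (active G ω v) us) v)) f) ∎
      where
      open ≡-Reasoning
      S′ = S ∪ ⁅ v ⁆
      vp = vertexProbe G ω v (solution S′ v)
      k  = λ M′ → process G solution ω (suc t) S′ M′ vs

    -- Only rows of future arrivals are read.
    process-row : ∀ t ω S M {v} r vs → v ∉ vs → P (ω [ v ]≔ r) t S M vs ≡ P ω t S M vs
    process-row t ω S M r [] v∉ = refl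
    process-row t ω S M {v} r (u ∷ vs) v∉ with t ℕₚ.≤? a
    ... | yes t≤a = trans (process-early (ω [ v ]≔ r) S M u vs t≤a)
      (trans (process-row (suc t) ω (S ∪ ⁅ u ⁆) M r vs (v∉ ∘ there)) (sym (process-early ω S M u vs t≤a)))
    ... | no t≰a = trans (process-late (ω [ v ]≔ r) S M u vs t≰a)
      (trans (∑-cong (strings G u) (λ us → cong (solution (S ∪ ⁅ u ⁆) u us *_) (trans
          (process-row (suc t) ω (S ∪ ⁅ u ⁆) _ r vs (v∉ ∘ there))
          (cong (λ ρ → P ω (suc t) (S ∪ ⁅ u ⁆) (addEdge G M (findᵇ (lookup ρ) us) u) vs)
            (lookup∘update′ (λ u≡v → v∉ (here (sym u≡v))) ω r)))))
        (sym (process-late ω S M u vs t≰a)))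

    -- On the arrival of `v` its whole row is resampled. By `process-row` the later run ignores the
    -- new row, because arrivals are distinct, so the row can be averaged out in this one probe.
    process-trace : ∀ t S M {vs} → Unique vs → 𝔼 Ω (λ ω → P ω t S M vs) ≡ 𝔼 (trace t S M vs) f
    process-trace t S M {[]} [] = edgeStates-normalised _
    process-trace t S M {v ∷ vs} (v∉ ∷ uq) with t ℕₚ.≤? a
    ... | yes t≤a = begin
      𝔼 Ω (λ ω → P ω t S M (v ∷ vs))              ≡⟨ 𝔼-cong Ω (λ ω → process-early ω S M v vs t≤a) ⟩
      𝔼 Ω (λ ω → P ω (suc t) S′ M vs)             ≡⟨ process-trace (suc t) S′ M uq ⟩
      𝔼 (trace (suc t) S′ M vs) f                 ≡⟨ 𝔼-step-early S′ v M _ t≤a ⟨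
      𝔼 (step t S′ v M) (λ M′ → 𝔼 (k M′) f)       ≡⟨ 𝔼->>= (step t S′ v M) k f ⟨
      𝔼 (step t S′ v M >>= k) f                   ∎
      where
      open ≡-Reasoning
      S′ = S ∪ ⁅ v ⁆
      k  = λ M′ → trace (suc t) S′ M′ vs
    ... | no t≰a = begin
      𝔼 Ω (λ ω → P ω t S M (v ∷ vs))
        ≡⟨ 𝔼-edgeStates-row v _ ⟩
      𝔼 (row v) (λ ρ → 𝔼 Ω (λ ω → P (ω [ v ]≔ ρ) t S M (v ∷ vs)))
        ≡⟨ 𝔼-cong (row v) (λ ρ → 𝔼-cong Ω (λ ω → one-row ω ρ)) ⟩
      𝔼 (row v) (λ ρ → 𝔼 Ω (λ ω → ∑ (strings G v) (λ us → x us * P ω (suc t) S′ (M⁺ (findᵇ (lookup ρ) us)) vs)))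
        ≡⟨ 𝔼-cong (row v) (λ ρ → trans (𝔼-∑ Ω (strings G v) _) (∑-cong (strings G v) (λ us → 𝔼-*ˡ Ω (x us) _))) ⟩
      𝔼 (row v) (λ ρ → ∑ (strings G v) (λ us → x us * 𝔼 Ω (λ ω → P ω (suc t) S′ (M⁺ (findᵇ (lookup ρ) us)) vs)))
        ≡⟨ 𝔼-cong (row v) (λ ρ → ∑-cong (strings G v) (λ us → cong (x us *_) (process-trace (suc t) S′ (M⁺ (findᵇ (lookup ρ) us)) uq))) ⟩
      𝔼 (row v) (λ ρ → ∑ (strings G v) (λ us → x us * K (findᵇ (lookup ρ) us)))
        ≡⟨ trans (𝔼-∑ (row v) (strings G v) _) (∑-cong (strings G v) (λ us → 𝔼-*ˡ (row v) (x us) _)) ⟩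
      ∑ (strings G v) (λ us → x us * 𝔼 (row v) (λ ρ → K (findᵇ (lookup ρ) us)))
        ≡⟨ ∑-cong-∈ (strings G v) (λ {us} us∈ → cong (x us *_) (𝔼-findᵇ v (C-distinct v (strings-C v us∈)) K)) ⟩
      ∑ (strings G v) (λ us → x us * 𝔼 (firstActive v us) K)
        ≡⟨ 𝔼-probeFrom S′ v K ⟨
      𝔼 (probeFrom S′ v) K
        ≡⟨ 𝔼-step-late S′ v M _ t≰a ⟨
      𝔼 (step t S′ v M) (λ M′ → 𝔼 (k M′) f)
        ≡⟨ 𝔼->>= (step t S′ v M) k f ⟨
      𝔼 (step t S′ v M >>= k) f ∎
      where
      open ≡-Reasoning
      S′ = S ∪ ⁅ v ⁆
      x  = solution S′ v
      M⁺ = λ r → addEdge G M r v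
      k  = λ M′ → trace (suc t) S′ M′ vs
      K  = λ r → 𝔼 (trace (suc t) S′ (M⁺ r) vs) f
      one-row : ∀ ω ρ → P (ω [ v ]≔ ρ) t S M (v ∷ vs) ≡
        ∑ (strings G v) (λ us → x us * P ω (suc t) S′ (M⁺ (findᵇ (lookup ρ) us)) vs)
      one-row ω ρ = trans (process-late (ω [ v ]≔ ρ) S M v vs t≰a) $ ∑-cong (strings G v) λ us → cong (x us *_) $ trans
        (process-row (suc t) ω S′ _ ρ vs (λ v∈ → All.lookup v∉ v∈ refl))
        (cong (λ ρ′ → P ω (suc t) S′ (M⁺ (findᵇ (lookup ρ′) us)) vs) (lookup∘update v ω ρ))

    -- `trace` recurses on the earliest arrival, whereas the analysis conditions on the latest one.
    -- The last step takes place at time `length vs + t`.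
    trace-∷ʳ : ∀ t S M vs v → 𝔼 (trace t S M (vs ∷ʳ v)) f ≡
      𝔼 (trace t S M vs) (λ M′ → 𝔼 (step (length vs ℕ.+ t) (gather S vs ∪ ⁅ v ⁆) v M′) f)
    trace-∷ʳ t S M [] v = begin
      𝔼 (step t S′ v M >>= return) f                   ≡⟨ 𝔼->>= (step t S′ v M) return f ⟩
      𝔼 (step t S′ v M) (λ M′ → 𝔼 (return M′) f)       ≡⟨ 𝔼-cong (step t S′ v M) (λ M′ → 𝔼-return M′ f) ⟩
      𝔼 (step t S′ v M) f                              ≡⟨ 𝔼-return M (λ M′ → 𝔼 (step t S′ v M′) f) ⟨
      𝔼 (return M) (λ M′ → 𝔼 (step t S′ v M′) f)       ∎
      where
      open ≡-Reasoning
      S′ = S ∪ ⁅ v ⁆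
    trace-∷ʳ t S M (u ∷ vs) v = begin
      𝔼 (s >>= λ M′ → trace (suc t) S′ M′ (vs ∷ʳ v)) f
        ≡⟨ 𝔼->>= s (λ M′ → trace (suc t) S′ M′ (vs ∷ʳ v)) f ⟩
      𝔼 s (λ M′ → 𝔼 (trace (suc t) S′ M′ (vs ∷ʳ v)) f)
        ≡⟨ 𝔼-cong s (λ M′ → trace-∷ʳ (suc t) S′ M′ vs v) ⟩
      𝔼 s (λ M′ → 𝔼 (trace (suc t) S′ M′ vs) (last (length vs ℕ.+ suc t)))
        ≡⟨ cong (λ t′ → 𝔼 s (λ M′ → 𝔼 (trace (suc t) S′ M′ vs) (last t′))) (ℕₚ.+-suc (length vs) t) ⟩
      𝔼 s (λ M′ → 𝔼 (trace (suc t) S′ M′ vs) (last (suc (length vs ℕ.+ t))))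
        ≡⟨ 𝔼->>= s (λ M′ → trace (suc t) S′ M′ vs) (last (suc (length vs ℕ.+ t))) ⟨
      𝔼 (s >>= λ M′ → trace (suc t) S′ M′ vs) (last (suc (length vs ℕ.+ t))) ∎
      where
      open ≡-Reasoning
      S′ = S ∪ ⁅ u ⁆
      s  = step t S′ u M
      last = λ t′ M″ → 𝔼 (step t′ (gather S′ vs ∪ ⁅ v ⁆) v M″) f

  matching : List (Fin n) → Dist (List (Edge G))
  matching = trace 1 Subset.⊥ []

  module _ {k : ℕ} {S : Subset n} {v : Fin n} (size : Size (suc k) S) (v∈S : v Subset.∈ S)
           {vs : List (Fin n)} (vs∈ : vs ∈ orders k (S ∖ v)) (f : List (Edge G) → R) where

    -- The final step mentions `k`, `S` and `v` but not `vs`, so it is common to all orders of the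
    -- earlier arrivals.
    matching-∷ʳ : 𝔼 (matching (vs ∷ʳ v)) f ≡ 𝔼 (matching vs) (λ M → 𝔼 (step (suc k) S v M) f)
    matching-∷ʳ = trans (trace-∷ʳ f 1 Subset.⊥ [] vs v) (cong₂ (λ t S′ → 𝔼 (matching vs) (λ M → 𝔼 (step t S′ v M) f))
      (trans (ℕₚ.+-comm (length vs) 1) (cong suc (orders-length k vs∈)))
      (trans (cong (_∪ ⁅ v ⁆) (gather-orders k (size-∖ size v∈S) vs∈)) (∖-∪ v∈S)))

  𝔼-onlineMatching : 𝔼 (onlineMatching G solution) (weight G) ≡
    fromℕ (length (arrivalOrders G)) ⁻¹ * ∑ (arrivalOrders G) (λ vs → 𝔼 (matching vs) (weight G))
  𝔼-onlineMatching = begin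
    𝔼 (onlineMatching G solution) (weight G)
      ≡⟨ 𝔼->>= (uniform (arrivalOrders G)) (λ vs → Ω >>= λ ω → process G solution ω 1 Subset.⊥ [] vs) (weight G) ⟩
    𝔼 (uniform (arrivalOrders G)) (λ vs → 𝔼 (Ω >>= λ ω → process G solution ω 1 Subset.⊥ [] vs) (weight G))
      ≡⟨ 𝔼-uniform (arrivalOrders G) _ ⟩
    fromℕ (length (arrivalOrders G)) ⁻¹ * ∑ (arrivalOrders G) (λ vs → 𝔼 (Ω >>= λ ω → process G solution ω 1 Subset.⊥ [] vs) (weight G))
      ≡⟨ cong (fromℕ (length (arrivalOrders G)) ⁻¹ *_) (∑-cong-∈ (arrivalOrders G) (λ {vs} vs∈ →
           trans (𝔼->>= Ω (λ ω → process G solution ω 1 Subset.⊥ [] vs) (weight G))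
                 (process-trace (weight G) 1 Subset.⊥ [] (arrival-unique vs∈)))) ⟩
    fromℕ (length (arrivalOrders G)) ⁻¹ * ∑ (arrivalOrders G) (λ vs → 𝔼 (matching vs) (weight G)) ∎
    where
    open ≡-Reasoning
    arrival-unique : ∀ {vs} → vs ∈ arrivalOrders G → Unique vs
    arrival-unique vs∈ = proj₂ (∈-filter⁻ (DecUnique.unique? _≟_) {xs = words (allFin n) n} vs∈)

  -- Two enumerations without repetition of the same words; the second one splits off the last
  -- letter.
  arrivalOrders-↭ : arrivalOrders G ↭ orders n Subset.⊤
  arrivalOrders-↭ = same-members⇒↭
    (Uniqueₚ.filter⁺ (DecUnique.unique? _≟_) (words-unique (Uniqueₚ.allFin⁺ n) n))
    (orders-unique n Subset.⊤)
    (λ {vs} vs∈ → let (vs∈w , uq) = ∈-filter⁻ (DecUnique.unique? _≟_) {xs = words (allFin n) n} vs∈ in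
      ∈-orders n vs (words-length n vs∈w) uq (λ _ → ∈⊤))
    (λ {vs} vs∈ → ∈-filter⁺ (DecUnique.unique? _≟_)
      (subst (λ k → vs ∈ words (allFin n) k) (orders-length n vs∈) (∈-words vs (λ _ → ∈-allFin _)))
      (orders-injective n vs∈))

  free : Fin m → List (Edge G) → R
  free u M = if does (u ∈ₗ? map proj₁ M) then 0# else 1#

  weight-addEdge : ∀ M r v → weight G (addEdge G M r v) ≡ weight G M + payoff (λ u → w u v * free u M) r
  weight-addEdge M nothing  v = sym (+-identityʳ _)
  weight-addEdge M (just u) v with u ∈ₗ? map proj₁ M
  ... | yes _ = sym (trans (cong (weight G M +_) (zeroʳ (w u v))) (+-identityʳ _))
  ... | no _  = trans (+-comm (w u v) (weight G M)) (cong (weight G M +_) (sym (*-identityʳ (w u v))))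

  -- In product form the factor depends on the probe alone. If `u` was matched before, `free u M`
  -- already vanishes.
  free-addEdge : ∀ u M r v → free u (addEdge G M r v) ≡ free u M * (1# - payoff (λ u′ → 𝟙 (u′ ≟ u)) r)
  free-addEdge u M nothing v = solve 1 (λ x → x := x :* (con (pos 1) :- con (pos 0))) refl (free u M)
  free-addEdge u M (just u′) v with u′ ∈ₗ? map proj₁ M | u′ ≟ u
  ... | yes u′∈ | yes refl rewrite dec-true (u ∈ₗ? map proj₁ M) u′∈ = sym (zeroˡ _)
  ... | yes u′∈ | no _     = solve 1 (λ x → x := x :* (con (pos 1) :- con (pos 0))) refl (free u M)
  ... | no u′∉  | yes refl rewrite dec-true (u ≟ u) refl =
    solve 1 (λ x → con (pos 0) := x :* (con (pos 1) :- con (pos 1))) refl (free u M)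
  ... | no u′∉  | no u′≢u rewrite dec-false (u ≟ u′) (u′≢u ∘ sym) =
    solve 1 (λ x → x := x :* (con (pos 1) :- con (pos 0))) refl (free u M)

-- Averaging over the last arrival

module Averaging (ℝ : CompleteOrderedField) {m n : ℕ} (G : Probing.StochasticGraph ℝ m n)
                 (solution : Subset n → Probing.Assignment ℝ G)
                 (optimal : ∀ S → Probing.ConfigLP.Optimal ℝ G S (solution S)) where
  open CompleteOrderedField ℝ renaming (Carrier to R)
  open Probing ℝ
  open Field ℝ
  open Sums ℝ
  open Euler ℝ
  open Graph ℝ G
  open Offline ℝ G using (OPT≤objective; 0≤OPT)
  open Online ℝ G solution
  open StochasticGraph G
  open ConfigLP using (Feasible; Optimal)

  private
    a : ℕ
    a = ⌊ n /e⌋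

    feasible : ∀ S → Feasible G S (solution S)
    feasible S = Optimal.feasible (optimal S)

  solution-nonNeg : ∀ {S v us} → v Subset.∈ S → us ∈ strings G v → 0# ≤ solution S v us
  solution-nonNeg {S} {v} {us} v∈S us∈ = Feasible.nonNeg (feasible S) v us v∈S (strings-C v us∈)

  probeFrom-normalised : ∀ {S v} → v Subset.∈ S → Normalised (probeFrom S v)
  probeFrom-normalised {S} {v} v∈S z = begin
    𝔼 (probeFrom S v) (λ _ → z)                                                ≡⟨ 𝔼-probeFrom S v (λ _ → z) ⟩
    ∑ (strings G v) (λ us → solution S v us * 𝔼 (firstActive v us) (λ _ → z))
      ≡⟨ ∑-cong (strings G v) (λ us → cong (solution S v us *_) (firstActive-normalised v us z)) ⟩
    ∑ (strings G v) (λ us → solution S v us * z)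
      ≡⟨ ∑-*ʳ (strings G v) z (solution S v) ⟩
    ∑ (strings G v) (solution S v) * z
      ≡⟨ cong (_* z) (Feasible.normalised (feasible S) v v∈S) ⟩
    1# * z                                                                     ≡⟨ *-identityˡ z ⟩
    z                                                                          ∎
    where open ≡-Reasoning

  -- The contribution of `v` to a linear functional of the LP solution for `S`: the load at `u` for
  -- `hits u`, the objective for `w`.
  payoffAt : Subset n → (Fin m → Fin n → R) → Fin n → R
  payoffAt S c v = 𝔼 (probeFrom S v) (payoff (λ u → c u v))

  payoffAt-∑ : ∀ S c v → payoffAt S c v ≡ ∑ (strings G v) (λ us → gain v (λ u → c u v) us * solution S v us)
  payoffAt-∑ S c v = trans (𝔼-probeFrom S v _) (∑-cong (strings G v) (λ us → *-comm _ _))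

  payoffAt-mono : ∀ {S v} c c′ → v Subset.∈ S → (∀ u → c u v ≤ c′ u v) → payoffAt S c v ≤ payoffAt S c′ v
  payoffAt-mono {S} {v} c c′ v∈S c≤c′ = subst₂ _≤_ (sym (𝔼-probeFrom S v _)) (sym (𝔼-probeFrom S v _))
    (∑-mono-∈ (strings G v) (λ {us} us∈ → *-monoʳ-≤ (solution-nonNeg v∈S us∈) (gain-mono v us c≤c′)))

  hits : Fin m → Fin m → Fin n → R
  hits u u′ _ = 𝟙 (u′ ≟ u)

  payoffAt-hits-nonNeg : ∀ {S v} u → v Subset.∈ S → 0# ≤ payoffAt S (hits u) v
  payoffAt-hits-nonNeg {S} {v} u v∈S = subst (0# ≤_) (sym (𝔼-probeFrom S v _))
    (∑-nonNeg-∈ (strings G v) (λ {us} us∈ → *-nonNeg (solution-nonNeg v∈S us∈) (gain-nonNeg v us (λ u′ → 0≤𝟙 (u′ ≟ u)))))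

  ∑-payoffAt-hits≤1 : ∀ S u → ∑ (members S) (payoffAt S (hits u)) ≤ 1#
  ∑-payoffAt-hits≤1 S u = ≤-trans
    (≤-reflexive (trans (∑-cong (members S) (payoffAt-∑ S (hits u))) (sym (load-gain S (solution S) u))))
    (Feasible.load≤1 (feasible S) u)

  payoffAt-hits≤1 : ∀ {S v} u → v Subset.∈ S → payoffAt S (hits u) v ≤ 1#
  payoffAt-hits≤1 {S} {v} u v∈S = begin
    ρ v                             ≡⟨ +-identityʳ (ρ v) ⟨
    ρ v + 0#
      ≤⟨ +-monoʳ-≤ (ρ v) (∑-nonNeg-∈ (members (S ∖ v)) (λ u′∈ → payoffAt-hits-nonNeg u (∈-∖⁻ {S = S} (members-∈ u′∈)))) ⟩
    ρ v + ∑ (members (S ∖ v)) ρ     ≡⟨ ∑-↭ ρ (members-∖ v∈S) ⟨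
    ∑ (members S) ρ                 ≤⟨ ∑-payoffAt-hits≤1 S u ⟩
    1#                              ∎
    where
    open ≤-Reasoning
    ρ = payoffAt S (hits u)

  -- The `suc k` hit probabilities add up to at most 1 by the load constraint. Averaged over the
  -- last arrival, `u` survives with probability at least `k / (k + 1)`.
  ∑-miss : ∀ {k} {S} u → Size (suc k) S → fromℕ k ≤ ∑ (members S) (λ v → 1# - payoffAt S (hits u) v)
  ∑-miss {k} {S} u size = 0≤y-x⇒x≤y (subst (0# ≤_) eq (x≤y⇒0≤y-x (∑-payoffAt-hits≤1 S u)))
    where
    ρ = payoffAt S (hits u)
    X = ∑ (members S) (λ v → 1# - ρ v)
    Y = ∑ (members S) ρ
    sum : X + Y ≡ 1# + fromℕ k
    sum = begin
      X + Y                                         ≡⟨ ∑-+ (members S) (λ v → 1# - ρ v) ρ ⟨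
      ∑ (members S) (λ v → 1# - ρ v + ρ v)
        ≡⟨ ∑-cong (members S) (λ v → solve 1 (λ r → con (pos 1) :- r :+ r := con (pos 1)) refl (ρ v)) ⟩
      ∑ (members S) (λ _ → 1#)                      ≡⟨ ∑-const (members S) 1# ⟩
      fromℕ (length (members S)) * 1#               ≡⟨ *-identityʳ _ ⟩
      fromℕ (length (members S))                    ≡⟨ cong fromℕ size ⟩
      1# + fromℕ k                                  ∎
      where open ≡-Reasoning
    eq : 1# - Y ≡ X - fromℕ k
    eq = trans (solve 2 (λ b k → con (pos 1) :- b := (con (pos 1) :+ k) :- b :- k) refl Y (fromℕ k))
      (trans (cong (λ z → z - Y - fromℕ k) (sym sum)) (solve 3 (λ a b k → a :+ b :- b :- k := a :- k) refl X Y (fromℕ k)))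

  -- For `S` of size `k` this is `k !` times the average over uniformly random orders; leaving it
  -- unnormalised keeps inverses out of the recursions.
  total : ℕ → Subset n → (List (Edge G) → R) → R
  total k S f = ∑ (orders k S) (λ vs → 𝔼 (matching vs) f)

  total-suc : ∀ {k S} → Size (suc k) S → ∀ f → total (suc k) S f ≡
    ∑ (members S) (λ v → ∑ (orders k (S ∖ v)) (λ vs → 𝔼 (matching vs) (λ M → 𝔼 (step (suc k) S v M) f)))
  total-suc {k} {S} size f = trans (∑-concatMap (λ v → map (_∷ʳ v) (orders k (S ∖ v))) (members S) _) $
    ∑-cong-∈ (members S) λ {v} v∈ → trans (∑-map (_∷ʳ v) (orders k (S ∖ v)) _) $
    ∑-cong-∈ (orders k (S ∖ v)) λ vs∈ → matching-∷ʳ size (members-∈ v∈) vs∈ f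

  total-early : ∀ {k S} → Size (suc k) S → suc k ℕ.≤ a → ∀ f →
    total (suc k) S f ≡ ∑ (members S) (λ v → total k (S ∖ v) f)
  total-early {k} {S} size le f = trans (total-suc size f) $ ∑-cong (members S) λ v → ∑-cong (orders k (S ∖ v)) λ vs →
    𝔼-cong (matching vs) λ M → 𝔼-step-early S v M f le

  -- The survival factor is the same for every earlier matching `M`, so it can be pulled out of all
  -- sums over the past.
  free-late : ∀ {k S v} u M → v Subset.∈ S → ¬ suc k ℕ.≤ a →
    𝔼 (step (suc k) S v M) (free u) ≡ (1# - payoffAt S (hits u) v) * free u M
  free-late {k} {S} {v} u M v∈S late = begin
    𝔼 (step (suc k) S v M) (free u)                          ≡⟨ 𝔼-step-late S v M (free u) late ⟩
    𝔼 D (λ r → free u (addEdge G M r v))                     ≡⟨ 𝔼-cong D (λ r → free-addEdge u M r v) ⟩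
    𝔼 D (λ r → free u M * (1# - hit r))                      ≡⟨ 𝔼-*ˡ D (free u M) _ ⟩
    free u M * 𝔼 D (λ r → 1# - hit r)                        ≡⟨ *-comm _ _ ⟩
    𝔼 D (λ r → 1# - hit r) * free u M                        ≡⟨ cong (_* free u M) miss ⟩
    (1# - 𝔼 D hit) * free u M                                ∎
    where
    open ≡-Reasoning
    D = probeFrom S v
    hit = payoff (λ u′ → hits u u′ v)
    miss : 𝔼 D (λ r → 1# - hit r) ≡ 1# - 𝔼 D hit
    miss = begin
      𝔼 D (λ r → 1# - hit r)
        ≡⟨ solve 2 (λ a b → a := a :+ b :- b) refl (𝔼 D (λ r → 1# - hit r)) (𝔼 D hit) ⟩
      𝔼 D (λ r → 1# - hit r) + 𝔼 D hit - 𝔼 D hit      ≡⟨ cong (_- 𝔼 D hit) (𝔼-+ D _ hit) ⟨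
      𝔼 D (λ r → 1# - hit r + hit r) - 𝔼 D hit
        ≡⟨ cong (_- 𝔼 D hit) (𝔼-cong D (λ r → solve 1 (λ h → con (pos 1) :- h :+ h := con (pos 1)) refl (hit r))) ⟩
      𝔼 D (λ _ → 1#) - 𝔼 D hit                        ≡⟨ cong (_- 𝔼 D hit) (probeFrom-normalised v∈S 1#) ⟩
      1# - 𝔼 D hit                                    ∎

  total-free-late : ∀ {k S} → Size (suc k) S → ¬ suc k ℕ.≤ a → ∀ u →
    total (suc k) S (free u) ≡ ∑ (members S) (λ v → (1# - payoffAt S (hits u) v) * total k (S ∖ v) (free u))
  total-free-late {k} {S} size late u = trans (total-suc size (free u)) $ ∑-cong-∈ (members S) λ {v} v∈ → trans
    (∑-cong (orders k (S ∖ v)) λ vs → trans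
      (𝔼-cong (matching vs) (λ M → free-late u M (members-∈ v∈) late))
      (𝔼-*ˡ (matching vs) (1# - payoffAt S (hits u) v) (free u)))
    (∑-*ˡ (orders k (S ∖ v)) (1# - payoffAt S (hits u) v) _)

  -- A lower bound for the probability that an offline vertex is free after k arrivals.
  β : ℕ → R
  β k = if does (k ℕₚ.≤? a) then 1# else fromℕ a * fromℕ k ⁻¹

  β-early : ∀ {k} → k ℕ.≤ a → β k ≡ 1#
  β-early {k} le rewrite dec-true (k ℕₚ.≤? a) le = refl

  β-late : ∀ {k} → ¬ k ℕ.≤ a → β k ≡ fromℕ a * fromℕ k ⁻¹
  β-late {k} late rewrite dec-false (k ℕₚ.≤? a) late = refl

  -- The two branches of `β` agree at `a`, and from there on the product with `k` is constant; this
  -- matches the loss factor of `∑-miss`.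
  fromℕ-*-β : ∀ {k} → a ℕ.≤ k → fromℕ k * β k ≡ fromℕ a
  fromℕ-*-β {k} a≤k with ℕₚ.m≤n⇒m<n∨m≡n a≤k
  ... | inj₂ a≡k = trans (cong₂ _*_ (cong fromℕ (sym a≡k)) (β-early (ℕₚ.≤-reflexive (sym a≡k)))) (*-identityʳ (fromℕ a))
  fromℕ-*-β {suc k} a≤k | inj₁ a<k = begin
    fromℕ (suc k) * β (suc k)                       ≡⟨ cong (fromℕ (suc k) *_) (β-late (ℕₚ.<⇒≱ a<k)) ⟩
    fromℕ (suc k) * (fromℕ a * fromℕ (suc k) ⁻¹)
      ≡⟨ solve 3 (λ x y z → x :* (y :* z) := y :* (x :* z)) refl (fromℕ (suc k)) (fromℕ a) (fromℕ (suc k) ⁻¹) ⟩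
    fromℕ a * (fromℕ (suc k) * fromℕ (suc k) ⁻¹)    ≡⟨ cong (fromℕ a *_) (⁻¹-inverseʳ (fromℕ-positive k)) ⟩
    fromℕ a * 1#                                    ≡⟨ *-identityʳ (fromℕ a) ⟩
    fromℕ a                                         ∎
    where open ≡-Reasoning

  β-nonNeg : ∀ k → 0# ≤ β k
  β-nonNeg k with k ℕₚ.≤? a
  ... | yes le = subst (0# ≤_) (sym (β-early le)) 0≤1
  β-nonNeg zero    | no late = ⊥-elim (late ℕ.z≤n)
  β-nonNeg (suc k) | no late = subst (0# ≤_) (sym (β-late late)) (*-nonNeg (fromℕ-nonNeg a) (⁻¹-nonNeg (fromℕ-positive k)))

  -- The bound `β` on the scale of `total`.
  κ : ℕ → R
  κ k = fromℕ (k !) * β k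

  κ-nonNeg : ∀ k → 0# ≤ κ k
  κ-nonNeg k = *-nonNeg (fromℕ-nonNeg (k !)) (β-nonNeg k)

  fromℕ-! : ∀ k → fromℕ (suc k !) ≡ fromℕ (suc k) * fromℕ (k !)
  fromℕ-! k = fromℕ-* (suc k) (k !)

  -- Passing arrivals leave `u` free, and each later arrival costs the factor of `∑-miss`. The
  -- induction is on the set of arrivals, so the bound is uniform in `S` and `u`.
  κ≤total-free : ∀ k {S} u → Size k S → κ k ≤ total k S (free u)
  κ≤total-free zero {S} u size = ≤-reflexive (begin
    fromℕ 1 * β 0                          ≡⟨ cong₂ _*_ fromℕ-1 (β-early {0} ℕ.z≤n) ⟩
    1# * 1#
      ≡⟨ solve 0 (con (pos 1) :* con (pos 1) := con (pos 1) :+ con (pos 0)) refl ⟩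
    1# + 0#                                ≡⟨ cong (_+ 0#) (𝔼-return {A = List (Edge G)} [] (free u)) ⟨
    𝔼 (return {A = List (Edge G)} []) (free u) + 0#           ∎)
    where open ≡-Reasoning
  κ≤total-free (suc k) {S} u size with suc k ℕₚ.≤? a
  ... | yes early = begin
    fromℕ (suc k !) * β (suc k)
      ≡⟨ cong₂ _*_ (fromℕ-! k) (trans (β-early early) (sym (β-early {k} (ℕₚ.<⇒≤ early)))) ⟩
    fromℕ (suc k) * fromℕ (k !) * β k              ≡⟨ *-assoc _ _ _ ⟩
    fromℕ (suc k) * κ k                            ≡⟨ cong (λ j → fromℕ j * κ k) size ⟨
    fromℕ (length (members S)) * κ k               ≡⟨ ∑-const (members S) (κ k) ⟨
    ∑ (members S) (λ _ → κ k)
      ≤⟨ ∑-mono-∈ (members S) (λ v∈ → κ≤total-free k u (size-∖ size (members-∈ v∈))) ⟩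
    ∑ (members S) (λ v → total k (S ∖ v) (free u)) ≡⟨ total-early size early (free u) ⟨
    total (suc k) S (free u)                       ∎
    where open ≤-Reasoning
  ... | no late = begin
    fromℕ (suc k !) * β (suc k)                    ≡⟨ cong (_* β (suc k)) (fromℕ-! k) ⟩
    fromℕ (suc k) * fromℕ (k !) * β (suc k)
      ≡⟨ solve 3 (λ x y z → x :* y :* z := y :* (x :* z)) refl (fromℕ (suc k)) (fromℕ (k !)) (β (suc k)) ⟩
    -- Both products are `fromℕ a`: `late` gives `a ≤ k`, including `k` equal to `a`, where `β` is
    -- still 1.
    fromℕ (k !) * (fromℕ (suc k) * β (suc k))
      ≡⟨ cong (fromℕ (k !) *_) (trans (fromℕ-*-β (ℕₚ.<⇒≤ a<1+k)) (sym (fromℕ-*-β (ℕₚ.≤-pred a<1+k)))) ⟩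
    fromℕ (k !) * (fromℕ k * β k)
      ≡⟨ solve 3 (λ x y z → x :* (y :* z) := y :* (x :* z)) refl (fromℕ (k !)) (fromℕ k) (β k) ⟩
    fromℕ k * κ k                                  ≤⟨ *-monoˡ-≤ (κ-nonNeg k) (∑-miss u size) ⟩
    ∑ (members S) (λ v → 1# - ρ v) * κ k           ≡⟨ ∑-*ʳ (members S) (κ k) (λ v → 1# - ρ v) ⟨
    ∑ (members S) (λ v → (1# - ρ v) * κ k)         ≤⟨ ∑-mono-∈ (members S) (λ v∈ →
                                                        *-monoʳ-≤ (x≤y⇒0≤y-x (payoffAt-hits≤1 u (members-∈ v∈))) (κ≤total-free k u (size-∖ size (members-∈ v∈)))) ⟩
    ∑ (members S) (λ v → (1# - ρ v) * total k (S ∖ v) (free u)) ≡⟨ total-free-late size late u ⟨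
    total (suc k) S (free u)                       ∎
    where
    open ≤-Reasoning
    ρ = payoffAt S (hits u)
    a<1+k = ℕₚ.≰⇒> late

  -- The probe at `v` is independent of the earlier matching, so summing over the past replaces
  -- `free u` by its total inside the payoff.
  total-weight-late : ∀ {k S} → Size (suc k) S → ¬ suc k ℕ.≤ a → total (suc k) S (weight G) ≡
    ∑ (members S) (λ v → total k (S ∖ v) (weight G)) +
    ∑ (members S) (λ v → payoffAt S (λ u v → w u v * total k (S ∖ v) (free u)) v)
  total-weight-late {k} {S} size late = trans (total-suc size (weight G)) $
    trans (∑-cong-∈ (members S) (λ v∈ → at v∈)) (∑-+ (members S) _ _)
    where
    at : ∀ {v} → v ∈ members S →
      ∑ (orders k (S ∖ v)) (λ vs → 𝔼 (matching vs) (λ M → 𝔼 (step (suc k) S v M) (weight G))) ≡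
      total k (S ∖ v) (weight G) + payoffAt S (λ u v → w u v * total k (S ∖ v) (free u)) v
    at {v} v∈ = begin
      ∑ O (λ vs → 𝔼 (matching vs) (λ M → 𝔼 (step (suc k) S v M) (weight G)))
        ≡⟨ ∑-cong O (λ vs → 𝔼-cong (matching vs) (λ M → one-step M)) ⟩
      -- `D` does not mention `vs` or `M`; the two expectations can be exchanged.
      ∑ O (λ vs → 𝔼 (matching vs) (λ M → weight G M + 𝔼 D (won M)))
        ≡⟨ ∑-cong O (λ vs → trans (𝔼-+ (matching vs) _ _) (cong (𝔼 (matching vs) (weight G) +_) (𝔼-swap (matching vs) D won))) ⟩
      ∑ O (λ vs → 𝔼 (matching vs) (weight G) + 𝔼 D (λ r → 𝔼 (matching vs) (λ M → won M r)))
        ≡⟨ ∑-+ O _ _ ⟩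
      total k (S ∖ v) (weight G) + ∑ O (λ vs → 𝔼 D (λ r → 𝔼 (matching vs) (λ M → won M r)))
        ≡⟨ cong (total k (S ∖ v) (weight G) +_) (𝔼-∑ D O (λ vs r → 𝔼 (matching vs) (λ M → won M r))) ⟨
      total k (S ∖ v) (weight G) + 𝔼 D (λ r → total k (S ∖ v) (λ M → won M r))
        ≡⟨ cong (total k (S ∖ v) (weight G) +_) (𝔼-cong D total-won) ⟩
      total k (S ∖ v) (weight G) + 𝔼 D (payoff (λ u → w u v * total k (S ∖ v) (free u))) ∎
      where
      open ≡-Reasoning
      O = orders k (S ∖ v)
      D = probeFrom S v
      won : List (Edge G) → Maybe (Fin m) → R
      won M = payoff (λ u → w u v * free u M)
      one-step : ∀ M → 𝔼 (step (suc k) S v M) (weight G) ≡ weight G M + 𝔼 D (won M)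
      one-step M = begin
        𝔼 (step (suc k) S v M) (weight G)        ≡⟨ 𝔼-step-late S v M (weight G) late ⟩
        𝔼 D (λ r → weight G (addEdge G M r v))   ≡⟨ 𝔼-cong D (λ r → weight-addEdge M r v) ⟩
        𝔼 D (λ r → weight G M + won M r)         ≡⟨ 𝔼-+ D _ (won M) ⟩
        𝔼 D (λ _ → weight G M) + 𝔼 D (won M)
          ≡⟨ cong (_+ 𝔼 D (won M)) (probeFrom-normalised (members-∈ v∈) (weight G M)) ⟩
        weight G M + 𝔼 D (won M)                 ∎
      total-won : ∀ r → total k (S ∖ v) (λ M → won M r) ≡ payoff (λ u → w u v * total k (S ∖ v) (free u)) r
      total-won nothing  = trans (∑-cong O (λ vs → trans (∑-cong (matching vs) (λ (q , _) → zeroʳ q)) (∑-0 (matching vs)))) (∑-0 O)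
      total-won (just u) = trans (∑-cong O (λ vs → 𝔼-*ˡ (matching vs) (w u v) (free u))) (∑-*ˡ O (w u v) _)

  -- The contribution of v to the optimal value for the whole graph.
  g : Fin n → R
  g = payoffAt Subset.⊤ w

  g-objective : ∀ S → ConfigLP.objective G S (solution Subset.⊤) ≡ ∑ (members S) g
  g-objective S = trans (objective-gain S (solution Subset.⊤)) (sym (∑-cong (members S) (payoffAt-∑ Subset.⊤ w)))

  -- Normalisation is a condition on each online vertex separately, and dropping vertices only
  -- removes nonnegative terms from the loads.
  solution-⊤-feasible : ∀ S → Feasible G S (solution Subset.⊤)
  solution-⊤-feasible S = record
    { nonNeg     = λ v us _ → Feasible.nonNeg (feasible Subset.⊤) v us ∈⊤
    ; load≤1     = λ u → begin
        ConfigLP.load G S (solution Subset.⊤) u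
          ≡⟨ trans (load-gain S (solution Subset.⊤) u) (sym (∑-cong (members S) (payoffAt-∑ Subset.⊤ (hits u)))) ⟩
        ∑ (members S) (ρ u)                                     ≡⟨ ∑-filter (_∈? S) (allFin n) (ρ u) ⟩
        ∑ (allFin n) (λ v → 𝟙 (v ∈? S) * ρ u v)
          ≤⟨ ∑-mono-∈ (allFin n) (λ {v} _ → 𝟙*≤ (v ∈? S) (v ∈? Subset.⊤) (λ _ → ∈⊤)
                                                                     (payoffAt-hits-nonNeg u ∈⊤)) ⟩
        ∑ (allFin n) (λ v → 𝟙 (v ∈? Subset.⊤) * ρ u v)          ≡⟨ ∑-filter (_∈? Subset.⊤) (allFin n) (ρ u) ⟨
        ∑ (members Subset.⊤) (ρ u)                              ≤⟨ ∑-payoffAt-hits≤1 Subset.⊤ u ⟩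
        1#                                                      ∎
    ; normalised = λ v _ → Feasible.normalised (feasible Subset.⊤) v ∈⊤
    }
    where
    open ≤-Reasoning
    ρ = λ u → payoffAt Subset.⊤ (hits u)
    𝟙*≤ : ∀ {P Q : Set} (P? : Dec P) (Q? : Dec Q) → (P → Q) → ∀ {x} → 0# ≤ x → 𝟙 P? * x ≤ 𝟙 Q? * x
    𝟙*≤ (yes p) (yes q) _ 0≤x = ≤-refl
    𝟙*≤ (yes p) (no ¬q) f 0≤x = ⊥-elim (¬q (f p))
    𝟙*≤ (no ¬p) Q?      f 0≤x = *-monoˡ-≤ 0≤x (0≤𝟙 Q?)

  -- Optimality on `S` beats the restricted solution. The survival bound has the same constant for
  -- every `u`, so it scales the whole LP value, with nonnegative weights keeping the direction.
  κ*g≤returns : ∀ {k S} → Size (suc k) S →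
    κ k * ∑ (members S) g ≤ ∑ (members S) (λ v → payoffAt S (λ u v → w u v * total k (S ∖ v) (free u)) v)
  κ*g≤returns {k} {S} size = begin
    κ k * ∑ (members S) g                                       ≡⟨ cong (κ k *_) (g-objective S) ⟨
    κ k * ConfigLP.objective G S (solution Subset.⊤)
      ≤⟨ *-monoʳ-≤ (κ-nonNeg k) (Optimal.maximal (optimal S) _ (solution-⊤-feasible S)) ⟩
    κ k * ConfigLP.objective G S (solution S)
      ≡⟨ cong (κ k *_) (trans (objective-gain S (solution S)) (sym (∑-cong (members S) (payoffAt-∑ S w)))) ⟩
    κ k * ∑ (members S) (payoffAt S w)                         ≡⟨ ∑-*ˡ (members S) (κ k) _ ⟨
    ∑ (members S) (λ v → κ k * payoffAt S w v)
      ≡⟨ ∑-cong (members S) (λ v → 𝔼-*ˡ (probeFrom S v) (κ k) _) ⟨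
    ∑ (members S) (λ v → 𝔼 (probeFrom S v) (λ r → κ k * payoff (λ u → w u v) r))
      ≡⟨ ∑-cong (members S) (λ v → 𝔼-cong (probeFrom S v) λ { nothing → zeroʳ (κ k) ; (just u) → *-comm (κ k) (w u v) }) ⟩
    ∑ (members S) (payoffAt S (λ u v → w u v * κ k))
      ≤⟨ ∑-mono-∈ (members S) (λ {v} v∈ → payoffAt-mono (λ u v → w u v * κ k)
           (λ u v → w u v * total k (S ∖ v) (free u)) (members-∈ v∈)
           (λ u → *-monoʳ-≤ (w-nonNeg u v) (κ≤total-free k u (size-∖ size (members-∈ v∈))))) ⟩
    ∑ (members S) (λ v → payoffAt S (λ u v → w u v * total k (S ∖ v) (free u)) v) ∎
    where open ≤-Reasoning

  -- The vertex arriving after k others passes for k < a, and is otherwise worth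
  -- at least β k times its share of the optimal value; d adds up these factors.
  late-β : ℕ → R
  late-β k = if does (suc k ℕₚ.≤? a) then 0# else β k

  d : ℕ → R
  d zero    = 0#
  d (suc k) = d k + late-β k

  late-β-early : ∀ {k} → suc k ℕ.≤ a → late-β k ≡ 0#
  late-β-early {k} early rewrite dec-true (suc k ℕₚ.≤? a) early = refl

  late-β-late : ∀ {k} → ¬ suc k ℕ.≤ a → late-β k ≡ β k
  late-β-late {k} late rewrite dec-false (suc k ℕₚ.≤? a) late = refl

  late-β-nonNeg : ∀ k → 0# ≤ late-β k
  late-β-nonNeg k with suc k ℕₚ.≤? a
  ... | yes early = ≤-reflexive (sym (late-β-early early))
  ... | no late   = subst (0# ≤_) (sym (late-β-late late)) (β-nonNeg k)

  d-nonNeg : ∀ k → 0# ≤ d k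
  d-nonNeg zero    = ≤-refl
  d-nonNeg (suc k) = +-nonNeg (d-nonNeg k) (late-β-nonNeg k)

  total-weight-step : ∀ {k S} → Size (suc k) S →
    ∑ (members S) (λ v → total k (S ∖ v) (weight G)) + fromℕ (k !) * late-β k * ∑ (members S) g ≤ total (suc k) S (weight G)
  total-weight-step {k} {S} size with suc k ℕₚ.≤? a
  ... | yes early = ≤-reflexive (begin
    W + f * late-β k * T   ≡⟨ cong (λ z → W + f * z * T) (late-β-early early) ⟩
    W + f * 0# * T         ≡⟨ solve 3 (λ w f t → w :+ f :* con (pos 0) :* t := w) refl W f T ⟩
    W                      ≡⟨ total-early size early (weight G) ⟨
    total (suc k) S (weight G) ∎)
    where
    open ≡-Reasoning
    W = ∑ (members S) (λ v → total k (S ∖ v) (weight G))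
    T = ∑ (members S) g
    f = fromℕ (k !)
  ... | no late = begin
    W + f * late-β k * T   ≡⟨ cong (λ z → W + f * z * T) (late-β-late late) ⟩
    W + κ k * T            ≤⟨ +-monoʳ-≤ W (κ*g≤returns size) ⟩
    W + ∑ (members S) (λ v → payoffAt S (λ u v → w u v * total k (S ∖ v) (free u)) v)
                           ≡⟨ total-weight-late size late ⟨
    total (suc k) S (weight G) ∎
    where
    open ≤-Reasoning
    W = ∑ (members S) (λ v → total k (S ∖ v) (weight G))
    T = ∑ (members S) g
    f = fromℕ (k !)

  -- Each member is left in the set by the `k` removals of another member.
  ∑-∑-∖ : ∀ {k S} → Size (suc k) S → ∑ (members S) (λ v → ∑ (members (S ∖ v)) g) ≡ fromℕ k * ∑ (members S) g
  ∑-∑-∖ {k} {S} size = begin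
    X                                                   ≡⟨ solve 2 (λ a b → a := a :+ b :- b) refl X T ⟩
    X + T - T
      ≡⟨ cong (_- T) (trans (+-comm X T) (sym (∑-+ (members S) g _))) ⟩
    ∑ (members S) (λ v → g v + ∑ (members (S ∖ v)) g) - T
      ≡⟨ cong (_- T) (∑-cong-∈ (members S) (λ v∈ → sym (∑-↭ g (members-∖ (members-∈ v∈))))) ⟩
    ∑ (members S) (λ _ → T) - T
      ≡⟨ cong (_- T) (trans (∑-const (members S) T) (cong (λ j → fromℕ j * T) size)) ⟩
    (1# + fromℕ k) * T - T
      ≡⟨ solve 2 (λ k t → (con (pos 1) :+ k) :* t :- t := k :* t) refl (fromℕ k) T ⟩
    fromℕ k * T                                         ∎
    where
    open ≡-Reasoning
    X = ∑ (members S) (λ v → ∑ (members (S ∖ v)) g)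
    T = ∑ (members S) g

  -- Divided by `suc k !`, this says that the expected weight is at least `d (suc k)` times the mean
  -- of `g` over `S`. By `∑-∑-∖`, averaging over the removed vertex preserves this mean.
  d≤total-weight : ∀ k {S} → Size (suc k) S → fromℕ (k !) * d (suc k) * ∑ (members S) g ≤ total (suc k) S (weight G)
  d≤total-weight zero {S} size = begin
    F * (0# + b) * T
      ≡⟨ solve 3 (λ f b t → f :* (con (pos 0) :+ b) :* t := con (pos 0) :+ f :* b :* t) refl F b T ⟩
    0# + F * b * T
      ≡⟨ cong (_+ F * b * T) (trans (∑-cong (members S) (λ _ → no-arrivals)) (∑-0 (members S))) ⟨
    ∑ (members S) (λ v → total 0 (S ∖ v) (weight G)) + F * b * T      ≤⟨ total-weight-step size ⟩
    total 1 S (weight G)                                              ∎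
    where
    open ≤-Reasoning
    F = fromℕ (0 !)
    b = late-β 0
    T = ∑ (members S) g
    no-arrivals : 𝔼 (return {A = List (Edge G)} []) (weight G) + 0# ≡ 0#
    no-arrivals = trans (+-identityʳ _) (𝔼-return {A = List (Edge G)} [] (weight G))
  d≤total-weight (suc k) {S} size = begin
    F * (d (suc k) + b) * T
      ≡⟨ cong (λ z → z * (d (suc k) + b) * T) (fromℕ-! k) ⟩
    (fromℕ (suc k) * f) * (d (suc k) + b) * T
      ≡⟨ solve 5 (λ s f d b t → s :* f :* (d :+ b) :* t := f :* d :* (s :* t) :+ s :* f :* b :* t) refl (fromℕ (suc k)) f (d (suc k)) b T ⟩
    f * d (suc k) * (fromℕ (suc k) * T) + (fromℕ (suc k) * f) * b * T
      ≡⟨ cong₂ (λ y z → f * d (suc k) * y + z * b * T) (∑-∑-∖ size) (fromℕ-! k) ⟨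
    f * d (suc k) * ∑ (members S) (λ v → ∑ (members (S ∖ v)) g) + F * b * T
      ≡⟨ cong (_+ F * b * T) (∑-*ˡ (members S) (f * d (suc k)) _) ⟨
    ∑ (members S) (λ v → f * d (suc k) * ∑ (members (S ∖ v)) g) + F * b * T
      ≤⟨ +-monoˡ-≤ (F * b * T) (∑-mono-∈ (members S) (λ v∈ → d≤total-weight k (size-∖ size (members-∈ v∈)))) ⟩
    ∑ (members S) (λ v → total (suc k) (S ∖ v) (weight G)) + F * b * T
      ≤⟨ total-weight-step size ⟩
    total (suc (suc k)) S (weight G) ∎
    where
    open ≤-Reasoning
    F = fromℕ (suc k !)
    f = fromℕ (k !)
    b = late-β (suc k)
    T = ∑ (members S) g

  -- Evaluation of the constant

  d-early : ∀ {k} → k ℕ.≤ a → d k ≡ 0#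
  d-early {zero}  _  = refl
  d-early {suc k} le = trans (cong₂ _+_ (d-early (ℕₚ.<⇒≤ le)) (late-β-early le)) (+-identityʳ 0#)

  d-harmonic : ∀ .{{_ : ℕ.NonZero a}} j → d (a ℕ.+ j) ≡ fromℕ a * harmonic a j
  d-harmonic zero = trans (d-early (ℕₚ.≤-reflexive (ℕₚ.+-identityʳ a))) (sym (zeroʳ (fromℕ a)))
  d-harmonic (suc j) = begin
    d (a ℕ.+ suc j)                                                ≡⟨ cong d (ℕₚ.+-suc a j) ⟩
    d (a ℕ.+ j) + late-β (a ℕ.+ j)                                 ≡⟨ cong₂ _+_ (d-harmonic j) late ⟩
    fromℕ a * harmonic a j + fromℕ a * fromℕ (a ℕ.+ j) ⁻¹          ≡⟨ distribˡ (fromℕ a) _ _ ⟨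
    fromℕ a * harmonic a (suc j)                                   ∎
    where
    open ≡-Reasoning
    k>0 : Positive (fromℕ (a ℕ.+ j))
    k>0 = positive-≤ (fromℕ-positive′ a) (fromℕ-mono (ℕₚ.m≤m+n a j))
    late : late-β (a ℕ.+ j) ≡ fromℕ a * fromℕ (a ℕ.+ j) ⁻¹
    -- Time `suc (a + j)` is late even for `j = 0`. There `β a` is 1, which `fromℕ-*-β` identifies
    -- with `a / a`.
    late = trans (late-β-late (ℕₚ.<⇒≱ (ℕ.s≤s (ℕₚ.m≤m+n a j)))) $ *-cancelˡ-≡ k>0
      (trans (fromℕ-*-β (ℕₚ.m≤m+n a j))
        (sym (trans (solve 3 (λ x y z → x :* (y :* z) := y :* (x :* z)) refl (fromℕ (a ℕ.+ j)) (fromℕ a) (fromℕ (a ℕ.+ j) ⁻¹))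
               (trans (cong (fromℕ a *_) (⁻¹-inverseʳ k>0)) (*-identityʳ (fromℕ a))))))

  private
    n/e-nonNeg : 0# ≤ fromℕ n * e ⁻¹
    n/e-nonNeg = *-nonNeg (fromℕ-nonNeg n) (⁻¹-nonNeg e-positive)

    a≤n/e : fromℕ a ≤ fromℕ n * e ⁻¹
    a≤n/e = greatest≤-≤ n n/e-nonNeg

    a≤n : a ℕ.≤ n
    a≤n = greatest≤-bound n (fromℕ n * e ⁻¹)

    e⁻¹≤1 : e ⁻¹ ≤ 1#
    e⁻¹≤1 = *-cancelˡ-≤ e-positive (≤-trans (≤-reflexive (⁻¹-inverseʳ e-positive)) (≤-trans 1≤e (≤-reflexive (sym (*-identityʳ e)))))

  n/e≤1+a : fromℕ n * e ⁻¹ ≤ fromℕ (suc a)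
  n/e≤1+a with ℕₚ.m≤n⇒m<n∨m≡n a≤n
  ... | inj₁ a<n = ≰⇒≥ (greatest≤-maximal n (fromℕ n * e ⁻¹) a<n)
  -- The search was capped at `n`, so maximality is silent; `1# ≤ e` bounds the quotient by `n`
  -- instead.
  ... | inj₂ a≡n = begin
    fromℕ n * e ⁻¹    ≤⟨ *-monoʳ-≤ (fromℕ-nonNeg n) e⁻¹≤1 ⟩
    fromℕ n * 1#      ≡⟨ *-identityʳ (fromℕ n) ⟩
    fromℕ n           ≤⟨ fromℕ-mono (ℕₚ.≤-trans (ℕₚ.≤-reflexive (sym a≡n)) (ℕₚ.n≤1+n a)) ⟩
    fromℕ (suc a)     ∎
    where open ≤-Reasoning

  a≤d-n : fromℕ a ≤ d n
  a≤d-n with a ℕₚ.≟ 0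
  -- A harmonic sum from 0 would contain an inverse of zero, but here the claim is only that `d n`
  -- is nonnegative.
  ... | yes a≡0 = subst (λ k → fromℕ k ≤ d n) (sym a≡0) (d-nonNeg n)
  ... | no a≢0  = begin
    fromℕ a                           ≡⟨ *-identityʳ (fromℕ a) ⟨
    fromℕ a * 1#                      ≤⟨ *-monoʳ-≤ (fromℕ-nonNeg a) (1≤harmonic a (n ℕ.∸ a) ea≤n) ⟩
    fromℕ a * harmonic a (n ℕ.∸ a)    ≡⟨ d-harmonic (n ℕ.∸ a) ⟨
    d (a ℕ.+ (n ℕ.∸ a))               ≡⟨ cong d (ℕₚ.m+[n∸m]≡n a≤n) ⟩
    d n                               ∎
    where
    open ≤-Reasoning
    instance
      a-nonZero : ℕ.NonZero a
      a-nonZero = ℕ.≢-nonZero a≢0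
    ea≤n : e * fromℕ a ≤ fromℕ (a ℕ.+ (n ℕ.∸ a))
    ea≤n = begin
      e * fromℕ a                     ≤⟨ *-monoʳ-≤ (positive-nonNeg e-positive) a≤n/e ⟩
      e * (fromℕ n * e ⁻¹)
        ≡⟨ solve 3 (λ x y z → x :* (y :* z) := y :* (x :* z)) refl e (fromℕ n) (e ⁻¹) ⟩
      fromℕ n * (e * e ⁻¹)            ≡⟨ cong (fromℕ n *_) (⁻¹-inverseʳ e-positive) ⟩
      fromℕ n * 1#                    ≡⟨ *-identityʳ (fromℕ n) ⟩
      fromℕ n                         ≡⟨ cong fromℕ (ℕₚ.m+[n∸m]≡n a≤n) ⟨
      fromℕ (a ℕ.+ (n ℕ.∸ a))         ∎

  -- After multiplication by `n` the loss `1/n` is the 1 lost by rounding `n/e` down to `a`.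
  e⁻¹-n⁻¹≤ : ∀ {k} → n ≡ suc k → e ⁻¹ - fromℕ n ⁻¹ ≤ fromℕ n ⁻¹ * d n
  e⁻¹-n⁻¹≤ {k} n≡1+k = *-cancelˡ-≤ n>0 (begin
    N * (e ⁻¹ - N ⁻¹)         ≡⟨ solve 3 (λ n x y → n :* (x :- y) := n :* x :- n :* y) refl N (e ⁻¹) (N ⁻¹) ⟩
    N * e ⁻¹ - N * N ⁻¹       ≡⟨ cong (λ z → N * e ⁻¹ - z) (⁻¹-inverseʳ n>0) ⟩
    N * e ⁻¹ - 1#             ≤⟨ +-monoˡ-≤ (- 1#) n/e≤1+a ⟩
    fromℕ (suc a) - 1#        ≡⟨ solve 1 (λ x → con (pos 1) :+ x :- con (pos 1) := x) refl (fromℕ a) ⟩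
    fromℕ a                   ≤⟨ a≤d-n ⟩
    d n                       ≡⟨ *-identityˡ (d n) ⟨
    1# * d n                  ≡⟨ cong (_* d n) (⁻¹-inverseʳ n>0) ⟨
    N * N ⁻¹ * d n            ≡⟨ *-assoc N (N ⁻¹) (d n) ⟩
    N * (N ⁻¹ * d n)          ∎)
    where
    open ≤-Reasoning
    N = fromℕ n
    n>0 : Positive N
    n>0 = subst (Positive ∘ fromℕ) (sym n≡1+k) (fromℕ-positive k)

  𝔼-onlineMatching-total : 𝔼 (onlineMatching G solution) (weight G) ≡ 1/ n ! * total n Subset.⊤ (weight G)
  𝔼-onlineMatching-total = trans 𝔼-onlineMatching (cong₂ (λ l t → fromℕ l ⁻¹ * t)
    (trans (↭-length arrivalOrders-↭) (orders-count n size-⊤))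
    (∑-↭ _ arrivalOrders-↭))

  1/suc!-* : ∀ k → 1/ suc k ! * fromℕ (k !) ≡ fromℕ (suc k) ⁻¹
  1/suc!-* k = *-cancelˡ-≡ (fromℕ-positive k) (begin
    s * (1/ suc k ! * fromℕ (k !))   ≡⟨ *-assoc _ _ _ ⟨
    s * 1/ suc k ! * fromℕ (k !)     ≡⟨ cong (_* fromℕ (k !)) (suc-*-1/suc! k) ⟩
    1/ k ! * fromℕ (k !)             ≡⟨ ⁻¹-inverseˡ (k!-positive k) ⟩
    1#                               ≡⟨ ⁻¹-inverseʳ (fromℕ-positive k) ⟨
    s * s ⁻¹                         ∎)
    where
    open ≡-Reasoning
    s = fromℕ (suc k)

  guarantee : ∀ {k} → n ≡ suc k → (e ⁻¹ - fromℕ n ⁻¹) * OPT G ≤ 𝔼 (onlineMatching G solution) (weight G)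
  guarantee {k} n≡1+k = begin
    (e ⁻¹ - fromℕ n ⁻¹) * OPT G                          ≤⟨ *-monoˡ-≤ (0≤OPT (optimal Subset.⊤)) (e⁻¹-n⁻¹≤ n≡1+k) ⟩
    fromℕ n ⁻¹ * d n * OPT G
      ≤⟨ *-monoʳ-≤ (*-nonNeg (⁻¹-nonNeg n>0) (d-nonNeg n)) (OPT≤objective (optimal Subset.⊤)) ⟩
    fromℕ n ⁻¹ * d n * ConfigLP.objective G Subset.⊤ (solution Subset.⊤)
                                                         ≡⟨ cong (fromℕ n ⁻¹ * d n *_) (g-objective Subset.⊤) ⟩
    fromℕ n ⁻¹ * d n * T                                 ≡⟨ cong (λ j → fromℕ j ⁻¹ * d j * T) n≡1+k ⟩
    -- The factor `1 / (k + 1)` is split as `k ! / (k + 1) !`: the numerator belongs to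
    -- `d≤total-weight`, the denominator counts the arrival orders.
    fromℕ (suc k) ⁻¹ * d (suc k) * T                     ≡⟨ cong (λ z → z * d (suc k) * T) (1/suc!-* k) ⟨
    1/ suc k ! * fromℕ (k !) * d (suc k) * T
      ≡⟨ solve 4 (λ x y z t → x :* y :* z :* t := x :* (y :* z :* t)) refl (1/ suc k !) (fromℕ (k !)) (d (suc k)) T ⟩
    1/ suc k ! * (fromℕ (k !) * d (suc k) * T)
      ≤⟨ *-monoʳ-≤ (1/k!-nonNeg (suc k)) (d≤total-weight k (trans size-⊤ n≡1+k)) ⟩
    1/ suc k ! * total (suc k) Subset.⊤ (weight G)
      ≡⟨ cong (λ j → 1/ j ! * total j Subset.⊤ (weight G)) n≡1+k ⟨
    1/ n ! * total n Subset.⊤ (weight G)                 ≡⟨ 𝔼-onlineMatching-total ⟨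
    𝔼 (onlineMatching G solution) (weight G)             ∎
    where
    open ≤-Reasoning
    T = ∑ (members Subset.⊤) g
    n>0 : Positive (fromℕ n)
    n>0 = subst (Positive ∘ fromℕ) (sym n≡1+k) (fromℕ-positive k)

theorem6p3 : (ℝ : CompleteOrderedField) →
    let open CompleteOrderedField ℝ
        open Probing ℝ
    in
    {m n : ℕ} .{{_ : NonZero n}} (G : StochasticGraph m n)
    (solve : Subset n → Assignment G) →
    (∀ S → ConfigLP.Optimal G S (solve S)) →
    (e ⁻¹ - fromℕ n ⁻¹) * OPT G ≤ 𝔼 (onlineMatching G solve) (weight G)
theorem6p3 ℝ {n = suc _} G solve optimal = Averaging.guarantee ℝ G solve optimal refl
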